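{- Let $n\ge 3$ be odd and let $G$ be a connected well-covered unicyclic graph of order $n$. If $n\le 7$, then $C_n\preceq G$. If $n\ge 9$ and $H_n$ is a graph of order $n$ in $\mathcal{S}_P$, then $H_n\preceq G$.
   Context: All graphs are finite, simple and undirected. A graph is well-covered if all of its maximal independent sets have the same size. A connected unicyclic graph is a connected graph containing exactly one cycle. The independence polynomial of a graph $G$ is $I(G,x)=\sum_{k\ge 0} i_kx^k$, where $i_k$ is the number of independent sets of size $k$ in $G$. It is known that the root of $I(G,x)$ of smallest modulus is real and lies in $[-1,0)$; it is denoted $\xi(G)$ (equivalently, the largest real root of $I(G,x)$). For graphs $G,H$, write $H\preceq G$ if and only if $I(H,x)\ge I(G,x)$ for all $x\in[\xi(G),0]$. $C_n$ is the cycle and $P_n$ the path on $n$ vertices. For a graph $G$, the graph star $G^{\ast}$ is obtained from $G$ by attaching, for each vertex $v$ of $G$, a new vertex $v^{\ast}$ joined by an edge to $v$ only. For $g\in\{3,5\}$ and integers $k,\ell\ge 0$ with $k>0$ or $\ell>0$, $G(g,k,\ell)$ is the graph obtained from a cycle with vertices $c_1,c_2,\dots,c_g$ in cyclic order as follows: if $k>0$, take a disjoint copy of $P_k^{\ast}$ and join $c_1$ by an edge to an end vertex of the path $P_k$ (so for $k\ge2$ this unique neighbour of $c_1$ in $P_k^{\ast}$ has degree $3$); if $\ell>0$, take a disjoint copy of $P_\ell^{\ast}$ and join $c_3$ by an edge to an end vertex of the path $P_\ell$. $\mathcal{S}_P$ is the set of all graphs $G(g,k,\ell)$ for all such $g,k,\ell$.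 -}

module Defs where

open import Data.Empty using (⊥)
open import Data.Fin.Base using (Fin; toℕ)
open import Data.Fin.Properties using (all?) renaming (_≟_ to _≟ᶠ_)
open import Data.Fin.Subset using (Subset; inside; outside; _∈_; _⊆_; ∣_∣)
open import Data.Fin.Subset.Properties using (_∈?_)
import Data.Integer.Base as ℤ
open import Data.List.Base using (List; []; _∷_; _++_; map; filter; length; foldr; upTo)
open import Data.Nat.Base as ℕ using (ℕ; zero; suc; s≤s; _⊔_)
import Data.Nat.Properties as ℕₚ
open import Data.Product.Base using (∃-syntax; Σ-syntax; _×_; _,_; proj₁; proj₂)
open import Data.Rational.Base as ℚ using (ℚ; 0ℚ; 1ℚ; ½)
import Data.Rational.Properties as ℚₚ
open import Data.Rational.Solver using (module +-*-Solver)
open import Data.Sum.Base using (_⊎_; inj₁; inj₂; swap)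
open import Data.Vec.Base using ([]; _∷_)
open import Function.Bundles using (_↔_; _⇔_; Inverse)
open import Level using (0ℓ)
open import Relation.Binary.Construct.Closure.ReflexiveTransitive using (Star)
open import Relation.Binary.Core using (Rel; REL)
import Relation.Binary.Definitions as B
open import Relation.Binary.PropositionalEquality using (_≡_; refl; sym; trans; cong; cong₂; subst)
open import Relation.Nullary.Decidable using (Dec; yes; no; _×-dec_; _⊎-dec_; _→-dec_; ¬?)
open import Relation.Nullary.Negation using (¬_)

-- Cauchy sequences of rationals, with real equality given by _≈_.

record ℝ : Set where
  constructor mkℝ
  field
    seq    : ℕ → ℚ
    cauchy : ∀ ε → 0ℚ ℚ.< ε → ∃[ N ] (∀ m n → N ℕ.≤ m → N ℕ.≤ n →
               ℚ.∣ seq m ℚ.- seq n ∣ ℚ.< ε)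

open ℝ public

infix 4 _≈_ _≤_

_≈_ : Rel ℝ 0ℓ
x ≈ y = ∀ ε → 0ℚ ℚ.< ε → ∃[ N ] (∀ n → N ℕ.≤ n → ℚ.∣ seq x n ℚ.- seq y n ∣ ℚ.< ε)

_≤_ : Rel ℝ 0ℓ
x ≤ y = ∀ ε → 0ℚ ℚ.< ε → ∃[ N ] (∀ n → N ℕ.≤ n → seq x n ℚ.≤ seq y n ℚ.+ ε)

fromℚ : ℚ → ℝ
fromℚ q = mkℝ (λ _ → q) λ ε 0<ε → 0 , λ _ _ _ _ →
  subst (ℚ._< ε) (sym (cong ℚ.∣_∣ (ℚₚ.+-inverseʳ q))) 0<ε

fromℕ : ℕ → ℝ
fromℕ n = fromℚ (ℤ.+ n ℚ./ 1)

0ℝ 1ℝ : ℝ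
0ℝ = fromℚ 0ℚ
1ℝ = fromℚ 1ℚ

private
  open +-*-Solver using (solve; _:=_; _:+_; _:*_; :-_; con)

  half-pos : ∀ {ε} → 0ℚ ℚ.< ε → 0ℚ ℚ.< ε ℚ.* ½
  half-pos {ε} 0<ε = subst (ℚ._< ε ℚ.* ½) (ℚₚ.*-zeroˡ ½) (ℚₚ.*-monoˡ-<-pos ½ 0<ε)

  half+half : ∀ ε → ε ℚ.* ½ ℚ.+ ε ℚ.* ½ ≡ ε
  half+half ε = trans (sym (ℚₚ.*-distribˡ-+ ε ½ ½)) (ℚₚ.*-identityʳ ε)

  sum-diff : ∀ a b c d →
    (a ℚ.+ b) ℚ.- (c ℚ.+ d) ≡ (a ℚ.- c) ℚ.+ (b ℚ.- d)
  sum-diff = solve 4 (λ a b c d →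
    (a :+ b) :+ (:- (c :+ d)) := (a :+ (:- c)) :+ (b :+ (:- d))) refl

  prod-diff : ∀ a b c d →
    (a ℚ.* b) ℚ.- (c ℚ.* d) ≡ a ℚ.* (b ℚ.- d) ℚ.+ d ℚ.* (a ℚ.- c)
  prod-diff = solve 4 (λ a b c d →
    (a :* b) :+ (:- (c :* d)) := a :* (b :+ (:- d)) :+ d :* (a :+ (:- c))) refl

  shift : ∀ a b → a ≡ (a ℚ.- b) ℚ.+ b
  shift = solve 2 (λ a b → a := (a :+ (:- b)) :+ b) refl

  bounded : ∀ x → ∃[ N ] Σ[ B ∈ ℚ ] (0ℚ ℚ.< B × (∀ n → N ℕ.≤ n → ℚ.∣ seq x n ∣ ℚ.< B))
  bounded x = N , B , 0<B , bnd
    where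
    open ℚₚ.≤-Reasoning
    N = proj₁ (cauchy x 1ℚ (ℚₚ.positive⁻¹ 1ℚ))
    B = 1ℚ ℚ.+ ℚ.∣ seq x N ∣
    bnd : ∀ n → N ℕ.≤ n → ℚ.∣ seq x n ∣ ℚ.< B
    bnd n N≤n = begin-strict
      ℚ.∣ seq x n ∣                                   ≡⟨ cong ℚ.∣_∣ (shift (seq x n) (seq x N)) ⟩
      ℚ.∣ (seq x n ℚ.- seq x N) ℚ.+ seq x N ∣          ≤⟨ ℚₚ.∣p+q∣≤∣p∣+∣q∣ (seq x n ℚ.- seq x N) (seq x N) ⟩
      ℚ.∣ seq x n ℚ.- seq x N ∣ ℚ.+ ℚ.∣ seq x N ∣      <⟨ ℚₚ.+-monoˡ-< ℚ.∣ seq x N ∣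
                                                          (proj₂ (cauchy x 1ℚ (ℚₚ.positive⁻¹ 1ℚ)) n N N≤n ℕₚ.≤-refl) ⟩
      B                                               ∎
    0<B : 0ℚ ℚ.< B
    0<B = ℚₚ.≤-<-trans (ℚₚ.0≤∣p∣ (seq x N)) (bnd N ℕₚ.≤-refl)

  *-mono-abs : ∀ p q {B δ} → 0ℚ ℚ.< B → ℚ.∣ p ∣ ℚ.< B → ℚ.∣ q ∣ ℚ.< δ →
               ℚ.∣ p ℚ.* q ∣ ℚ.< B ℚ.* δ
  *-mono-abs p q {B} {δ} 0<B p<B q<δ = begin-strict
    ℚ.∣ p ℚ.* q ∣           ≡⟨ ℚₚ.∣p*q∣≡∣p∣*∣q∣ p q ⟩
    ℚ.∣ p ∣ ℚ.* ℚ.∣ q ∣     ≤⟨ ℚₚ.*-monoʳ-≤-nonNeg ℚ.∣ q ∣ {{ℚₚ.∣-∣-nonNeg q}} (ℚₚ.<⇒≤ p<B) ⟩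
    B ℚ.* ℚ.∣ q ∣           <⟨ ℚₚ.*-monoʳ-<-pos B {{ℚ.positive 0<B}} q<δ ⟩
    B ℚ.* δ                 ∎
    where open ℚₚ.≤-Reasoning

  prod-close : ∀ a b c d B C δ → 0ℚ ℚ.< B → 0ℚ ℚ.< C →
               ℚ.∣ a ∣ ℚ.< B → ℚ.∣ d ∣ ℚ.< C → ℚ.∣ b ℚ.- d ∣ ℚ.< δ → ℚ.∣ a ℚ.- c ∣ ℚ.< δ →
               ℚ.∣ a ℚ.* b ℚ.- c ℚ.* d ∣ ℚ.< (B ℚ.+ C) ℚ.* δ
  prod-close a b c d B C δ 0<B 0<C a<B d<C bd<δ ac<δ = begin-strict
    ℚ.∣ a ℚ.* b ℚ.- c ℚ.* d ∣
      ≡⟨ cong ℚ.∣_∣ (prod-diff a b c d) ⟩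
    ℚ.∣ a ℚ.* (b ℚ.- d) ℚ.+ d ℚ.* (a ℚ.- c) ∣
      ≤⟨ ℚₚ.∣p+q∣≤∣p∣+∣q∣ (a ℚ.* (b ℚ.- d)) (d ℚ.* (a ℚ.- c)) ⟩
    ℚ.∣ a ℚ.* (b ℚ.- d) ∣ ℚ.+ ℚ.∣ d ℚ.* (a ℚ.- c) ∣
      <⟨ ℚₚ.+-mono-< (*-mono-abs a (b ℚ.- d) 0<B a<B bd<δ) (*-mono-abs d (a ℚ.- c) 0<C d<C ac<δ) ⟩
    B ℚ.* δ ℚ.+ C ℚ.* δ
      ≡⟨ sym (ℚₚ.*-distribʳ-+ δ B C) ⟩
    (B ℚ.+ C) ℚ.* δ ∎
    where open ℚₚ.≤-Reasoning

  divide : ∀ ε B → 0ℚ ℚ.< ε → 0ℚ ℚ.< B → Σ[ δ ∈ ℚ ] (0ℚ ℚ.< δ × B ℚ.* δ ≡ ε)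
  divide ε B 0<ε 0<B = ε ℚ.* 1/B , 0<δ , B*δ
    where
    instance
      pos-B : ℚ.Positive B
      pos-B = ℚ.positive 0<B
    1/B : ℚ
    1/B = (ℚ.1/ B) {{ℚₚ.pos⇒nonZero B}}
    0<δ : 0ℚ ℚ.< ε ℚ.* 1/B
    0<δ = subst (ℚ._< ε ℚ.* 1/B) (ℚₚ.*-zeroˡ 1/B)
            (ℚₚ.*-monoˡ-<-pos 1/B {{ℚₚ.1/pos⇒pos B}} 0<ε)
    B*δ : B ℚ.* (ε ℚ.* 1/B) ≡ ε
    B*δ = trans (ℚₚ.*-comm B (ε ℚ.* 1/B))
            (trans (ℚₚ.*-assoc ε 1/B B)
              (trans (cong (ε ℚ.*_) (ℚₚ.*-inverseˡ B {{ℚₚ.pos⇒nonZero B}})) (ℚₚ.*-identityʳ ε)))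

  +-pos : ∀ {p q} → 0ℚ ℚ.< p → 0ℚ ℚ.< q → 0ℚ ℚ.< p ℚ.+ q
  +-pos {p} {q} 0<p 0<q = subst (ℚ._< p ℚ.+ q) (ℚₚ.+-identityʳ 0ℚ) (ℚₚ.+-mono-< 0<p 0<q)

  ⊔⁴ : ∀ a b c d → let N = (a ⊔ b) ⊔ (c ⊔ d) in
       (∀ k → N ℕ.≤ k → a ℕ.≤ k) × (∀ k → N ℕ.≤ k → b ℕ.≤ k) ×
       (∀ k → N ℕ.≤ k → c ℕ.≤ k) × (∀ k → N ℕ.≤ k → d ℕ.≤ k)
  ⊔⁴ a b c d =
    (λ k h → ℕₚ.m⊔n≤o⇒m≤o a b (ℕₚ.m⊔n≤o⇒m≤o (a ⊔ b) (c ⊔ d) h)) ,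
    (λ k h → ℕₚ.m⊔n≤o⇒n≤o a b (ℕₚ.m⊔n≤o⇒m≤o (a ⊔ b) (c ⊔ d) h)) ,
    (λ k h → ℕₚ.m⊔n≤o⇒m≤o c d (ℕₚ.m⊔n≤o⇒n≤o (a ⊔ b) (c ⊔ d) h)) ,
    (λ k h → ℕₚ.m⊔n≤o⇒n≤o c d (ℕₚ.m⊔n≤o⇒n≤o (a ⊔ b) (c ⊔ d) h))

infixl 6 _+_
infixl 7 _*_
infixr 8 _^_

_+_ : ℝ → ℝ → ℝ
x + y = mkℝ (λ n → seq x n ℚ.+ seq y n) λ ε 0<ε →
  let Nx , hx = cauchy x (ε ℚ.* ½) (half-pos 0<ε)
      Ny , hy = cauchy y (ε ℚ.* ½) (half-pos 0<ε)
      l : ∀ {k} → Nx ⊔ Ny ℕ.≤ k → Nx ℕ.≤ k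
      l = ℕₚ.m⊔n≤o⇒m≤o Nx Ny
      r : ∀ {k} → Nx ⊔ Ny ℕ.≤ k → Ny ℕ.≤ k
      r = ℕₚ.m⊔n≤o⇒n≤o Nx Ny
  in Nx ⊔ Ny , λ m n N≤m N≤n → begin-strict
    ℚ.∣ (seq x m ℚ.+ seq y m) ℚ.- (seq x n ℚ.+ seq y n) ∣
      ≡⟨ cong ℚ.∣_∣ (sum-diff (seq x m) (seq y m) (seq x n) (seq y n)) ⟩
    ℚ.∣ (seq x m ℚ.- seq x n) ℚ.+ (seq y m ℚ.- seq y n) ∣
      ≤⟨ ℚₚ.∣p+q∣≤∣p∣+∣q∣ (seq x m ℚ.- seq x n) (seq y m ℚ.- seq y n) ⟩
    ℚ.∣ seq x m ℚ.- seq x n ∣ ℚ.+ ℚ.∣ seq y m ℚ.- seq y n ∣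
      <⟨ ℚₚ.+-mono-< (hx m n (l N≤m) (l N≤n)) (hy m n (r N≤m) (r N≤n)) ⟩
    ε ℚ.* ½ ℚ.+ ε ℚ.* ½
      ≡⟨ half+half ε ⟩
    ε ∎
  where open ℚₚ.≤-Reasoning

_*_ : ℝ → ℝ → ℝ
x * y = mkℝ (λ n → seq x n ℚ.* seq y n) λ ε 0<ε →
  let Mx , Bx , 0<Bx , bx = bounded x
      My , By , 0<By , by = bounded y
      δ , 0<δ , B*δ       = divide ε (Bx ℚ.+ By) 0<ε (+-pos 0<Bx 0<By)
      Nx , hx             = cauchy x δ 0<δ
      Ny , hy             = cauchy y δ 0<δ
      lMx , lMy , lNx , lNy = ⊔⁴ Mx My Nx Ny
  in (Mx ⊔ My) ⊔ (Nx ⊔ Ny) , λ m n N≤m N≤n →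
    ℚₚ.<-≤-trans
      (prod-close (seq x m) (seq y m) (seq x n) (seq y n) Bx By δ 0<Bx 0<By
        (bx m (lMx m N≤m)) (by n (lMy n N≤n))
        (hy m n (lNy m N≤m) (lNy n N≤n)) (hx m n (lNx m N≤m) (lNx n N≤n)))
      (ℚₚ.≤-reflexive B*δ)

_^_ : ℝ → ℕ → ℝ
x ^ zero  = 1ℝ
x ^ suc k = x * x ^ k

∑[_≤_] : (ℕ → ℝ) → ℕ → ℝ
∑[ f ≤ n ] = foldr (λ k s → f k + s) 0ℝ (upTo (suc n))

-- A finite simple graph of order n is a Graph (Fin n); general
-- vertex types are allowed so that constructions can use _⊎_.

record Graph (V : Set) : Set₁ where
  infix 4 _~_ _~?_
  field
    _~_      : Rel V 0ℓ
    _~?_     : B.Decidable _~_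
    ~-sym    : B.Symmetric _~_
    ~-irrefl : ∀ {v} → ¬ (v ~ v)

infix 4 _≅_

_≅_ : ∀ {V W} → Graph V → Graph W → Set
_≅_ {V} {W} G H = Σ[ f ∈ V ↔ W ] (∀ u v → (u G.~ v) ⇔ (Inverse.to f u H.~ Inverse.to f v))
  where
  module G = Graph G
  module H = Graph H

Connected : ∀ {V} → Graph V → Set
Connected G = ∀ u v → Star (Graph._~_ G) u v

-- The vertices are arranged as 0, 1, …, n-1.
path : ∀ n → Graph (Fin n)
path n = record
  { _~_      = λ i j → Next i j ⊎ Next j i
  ; _~?_     = λ i j → (suc (toℕ i) ℕₚ.≟ toℕ j) ⊎-dec (suc (toℕ j) ℕₚ.≟ toℕ i)
  ; ~-sym    = swap
  ; ~-irrefl = λ { (inj₁ p) → ℕₚ.1+n≢n p ; (inj₂ p) → ℕₚ.1+n≢n p }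
  }
  where
  Next : Rel (Fin n) 0ℓ
  Next i j = suc (toℕ i) ≡ toℕ j

cycle : ∀ n → 3 ℕ.≤ n → Graph (Fin n)
cycle n 3≤n = record
  { _~_      = λ i j → Next i j ⊎ Next j i
  ; _~?_     = λ i j → next? i j ⊎-dec next? j i
  ; ~-sym    = swap
  ; ~-irrefl = λ { (inj₁ p) → next-irrefl p ; (inj₂ p) → next-irrefl p }
  }
  where
  Next : Rel (Fin n) 0ℓ
  Next i j = suc (toℕ i) ≡ toℕ j ⊎ (suc (toℕ i) ≡ n × toℕ j ≡ 0)

  next? : B.Decidable Next
  next? i j = (suc (toℕ i) ℕₚ.≟ toℕ j) ⊎-dec ((suc (toℕ i) ℕₚ.≟ n) ×-dec (toℕ j ℕₚ.≟ 0))

  3≰1 : ∀ {m} → 3 ℕ.≤ m → ¬ (1 ≡ m)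
  3≰1 (s≤s ()) refl

  next-irrefl : ∀ {i} → ¬ Next i i
  next-irrefl (inj₁ p)       = ℕₚ.1+n≢n p
  next-irrefl (inj₂ (p , q)) = 3≰1 3≤n (trans (cong suc (sym q)) p)

edgeless : ∀ V → Graph V
edgeless V = record
  { _~_      = λ _ _ → ⊥
  ; _~?_     = λ _ _ → no λ ()
  ; ~-sym    = λ ()
  ; ~-irrefl = λ ()
  }

-- Disjoint union of G and H, together with the edges between G and H
-- prescribed by R.
link : ∀ {V W} → Graph V → Graph W → (R : REL V W 0ℓ) → B.Decidable R → Graph (V ⊎ W)
link {V} {W} G H R R? = record
  { _~_      = Adj
  ; _~?_     = adj?
  ; ~-sym    = λ {u} {v} → adj-sym u v
  ; ~-irrefl = λ {v} → adj-irrefl v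
  }
  where
  module G = Graph G
  module H = Graph H

  Adj : Rel (V ⊎ W) 0ℓ
  Adj (inj₁ v) (inj₁ v′) = v G.~ v′
  Adj (inj₁ v) (inj₂ w)  = R v w
  Adj (inj₂ w) (inj₁ v)  = R v w
  Adj (inj₂ w) (inj₂ w′) = w H.~ w′

  adj? : B.Decidable Adj
  adj? (inj₁ v) (inj₁ v′) = v G.~? v′
  adj? (inj₁ v) (inj₂ w)  = R? v w
  adj? (inj₂ w) (inj₁ v)  = R? v w
  adj? (inj₂ w) (inj₂ w′) = w H.~? w′

  adj-sym : ∀ u v → Adj u v → Adj v u
  adj-sym (inj₁ _) (inj₁ _) = G.~-sym
  adj-sym (inj₁ _) (inj₂ _) = λ r → r
  adj-sym (inj₂ _) (inj₁ _) = λ r → r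
  adj-sym (inj₂ _) (inj₂ _) = H.~-sym

  adj-irrefl : ∀ v → ¬ Adj v v
  adj-irrefl (inj₁ _) = G.~-irrefl
  adj-irrefl (inj₂ _) = H.~-irrefl

-- The vertex v* is inj₂ v.
star : ∀ {n} → Graph (Fin n) → Graph (Fin n ⊎ Fin n)
star {n} G = link G (edgeless (Fin n)) _≡_ _≟ᶠ_

-- A cycle of G is a subgraph, presented by a traversal: an injective
-- homomorphism from a standard cycle.  Two traversals present the same
-- cycle iff they have the same edge set, regardless of starting point
-- and direction.

record Cycle {V} (G : Graph V) : Set where
  private module G = Graph G
  field
    len       : ℕ
    3≤len     : 3 ℕ.≤ len
    vertex    : Fin len → V
    injective : ∀ {i j} → vertex i ≡ vertex j → i ≡ j
    adjacent  : ∀ {i j} → Graph._~_ (cycle len 3≤len) i j → vertex i G.~ vertex j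

  Edge : Rel V 0ℓ
  Edge u v = ∃[ i ] ∃[ j ] (Graph._~_ (cycle len 3≤len) i j × vertex i ≡ u × vertex j ≡ v)

SameCycle : ∀ {V} {G : Graph V} → Cycle G → Cycle G → Set
SameCycle C D = ∀ u v → Cycle.Edge C u v ⇔ Cycle.Edge D u v

Unicyclic : ∀ {V} → Graph V → Set
Unicyclic G = Σ[ C ∈ Cycle G ] (∀ D → SameCycle C D)

subsets : ∀ n → List (Subset n)
subsets zero    = [] ∷ []
subsets (suc n) = map (outside ∷_) (subsets n) ++ map (inside ∷_) (subsets n)

module _ {n : ℕ} (G : Graph (Fin n)) where
  open Graph G

  Independent : Subset n → Set
  Independent S = ∀ u v → u ∈ S → v ∈ S → ¬ (u ~ v)

  independent? : ∀ S → Dec (Independent S)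
  independent? S = all? λ u → all? λ v → (u ∈? S) →-dec ((v ∈? S) →-dec ¬? (u ~? v))

  MaximalIndependent : Subset n → Set
  MaximalIndependent S = Independent S × (∀ T → Independent T → S ⊆ T → T ⊆ S)

  WellCovered : Set
  WellCovered = ∀ S T → MaximalIndependent S → MaximalIndependent T → ∣ S ∣ ≡ ∣ T ∣

  i[_] : ℕ → ℕ
  i[ k ] = length (filter (λ S → independent? S ×-dec (∣ S ∣ ℕₚ.≟ k)) (subsets n))

  I : ℝ → ℝ
  I x = ∑[ (λ k → fromℕ i[ k ] * x ^ k) ≤ n ]

  Root : ℝ → Set
  Root x = I x ≈ 0ℝ

  -- The root of I(G,x) of smallest modulus is real, negative and equal to
  -- the largest real root.
  Isξ : ℝ → Set
  Isξ ξ = Root ξ × (∀ y → Root y → y ≤ ξ)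

infix 4 _⪯_

-- ξ(G) exists and is unique up to _≈_, so it is named by its defining
-- property rather than constructed.
_⪯_ : ∀ {m n} → Graph (Fin m) → Graph (Fin n) → Set
H ⪯ G = ∀ ξ → Isξ G ξ → ∀ x → ξ ≤ x → x ≤ 0ℝ → I G x ≤ I H x

-- Relates vertex c of the cycle, counting from 0, to an end vertex of the
-- path inside the star of a path.
AttachAt : ℕ → ∀ {g k} → REL (Fin g) (Fin k ⊎ Fin k) 0ℓ
AttachAt c i (inj₁ p) = toℕ i ≡ c × toℕ p ≡ 0
AttachAt c i (inj₂ _) = ⊥

attachAt? : ∀ c {g k} → B.Decidable (AttachAt c {g} {k})
attachAt? c i (inj₁ p) = (toℕ i ℕₚ.≟ c) ×-dec (toℕ p ℕₚ.≟ 0)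
attachAt? c i (inj₂ _) = no λ ()

-- c₁ and c₃ are the vertices 0 and 2 of the cycle.  When k or ℓ is 0 the
-- corresponding star of a path is the empty graph, and nothing is added.
graphG : ∀ g → 3 ℕ.≤ g → (k ℓ : ℕ) →
         Graph ((Fin g ⊎ (Fin k ⊎ Fin k)) ⊎ (Fin ℓ ⊎ Fin ℓ))
graphG g 3≤g k ℓ =
  link (link (cycle g 3≤g) (star (path k)) (AttachAt 0) (attachAt? 0))
       (star (path ℓ)) AttachAt₃ attachAt₃?
  where
  AttachAt₃ : REL (Fin g ⊎ (Fin k ⊎ Fin k)) (Fin ℓ ⊎ Fin ℓ) 0ℓ
  AttachAt₃ (inj₁ i) = AttachAt 2 i
  AttachAt₃ (inj₂ _) = λ _ → ⊥

  attachAt₃? : B.Decidable AttachAt₃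
  attachAt₃? (inj₁ i) w = attachAt? 2 i w
  attachAt₃? (inj₂ _) _ = no λ ()

-- Membership is up to isomorphism.
_∈𝒮P : ∀ {n} → Graph (Fin n) → Set
H ∈𝒮P = ∃[ g ] Σ[ 3≤g ∈ 3 ℕ.≤ g ] ∃[ k ] ∃[ ℓ ]
  ((g ≡ 3 ⊎ g ≡ 5) × (0 ℕ.< k ⊎ 0 ℕ.< ℓ) × H ≅ graphG g 3≤g k ℓ)

{-# OPTIONS --safe #-}

-- In a well-covered graph, independent sets J₁ and J₂ with N[J₁] ⊆ N[J₂] satisfy
-- |J₁| ≤ |J₂|.  Comparing suitable local pairs J₁, J₂ shows that a connected
-- well-covered unicyclic graph G of odd order n = 2h + 1 is C₇, or its cycle is a
-- triangle or a pentagon to which trees of the form T* are joined at their stems,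
-- and at least one vertex of the triangle has degree 2, resp. the vertices of
-- degree ≥ 3 of the pentagon are at most two and nonadjacent.
--
-- Put y = x / (1 + x).  Summing over the leaves and over the degree-2 vertices of
-- the cycle gives I(G, x) = (1 + x)^h I(T, y) for a tree T with h + 1 vertices, and
-- T is a path when G is in 𝒮P.  When the independence polynomials of all subtrees
-- are positive at y ≤ 0, grafting one rooted tree onto another shows that, for a
-- given number of vertices, the path maximises both I(T, y) and I(T, y) / I(T - r, y).
-- The required positivity holds on (ξ(G), 0]: a point where it fails for an induced
-- subgraph lies, by bisection, to the left of a real root of I(G, x).

module Submission where

open import Data.Bool.Base using (Bool; true; false; if_then_else_; not; _∧_)
open import Data.Bool.Properties using (∧-assoc; ∧-identityʳ; ∧-zeroʳ; T?)
open import Data.Empty using (⊥)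
open import Data.Fin.Base using (Fin; zero; suc; toℕ)
import Data.Fin.Properties as Finₚ
open import Data.Fin.Subset using (Subset; inside; outside) renaming (_∈_ to _∈ˢ_; ∣_∣ to ∣_∣ˢ)
open import Data.Fin.Subset.Properties using (∣p∣≤n)
import Data.Integer.Base as ℤ
import Data.Integer.Properties as ℤₚ
open import Data.List.Base using (List; []; _∷_; _++_; map; filterᵇ; filter; foldr; length; applyUpTo; upTo; tabulate; allFin; lookup)
import Data.List.Membership.DecPropositional as DecMembership
open import Data.List.Membership.Propositional using (_∈_; _∉_; find; lose)
open import Data.List.Membership.Propositional.Properties using (∈-++⁺ˡ; ∈-++⁺ʳ; ∈-filter⁺; ∈-filter⁻; ∈-allFin; ∈-++⁻; ∈-tabulate⁺; ∈-tabulate⁻; ∈-lookup; ∈-map⁺; ∈-map⁻)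
open import Data.List.Membership.Propositional.Properties.WithK using (unique∧set⇒bag)
import Data.List.Properties as Listₚ
open import Data.List.Relation.Binary.BagAndSetEquality using (∼bag⇒↭)
import Data.List.Relation.Binary.Permutation.Propositional as Perm
open import Data.List.Relation.Binary.Permutation.Propositional using (_↭_; refl; prep; swap; ↭-sym; ↭-trans; ↭-refl; ↭-prep; ↭-swap; ↭-reflexive)
open import Data.List.Relation.Binary.Permutation.Propositional.Properties using (shift; ↭-length; All-resp-↭; ++-comm)
import Data.List.Relation.Unary.All as All
open import Data.List.Relation.Unary.All using ([]; _∷_; All)
import Data.List.Relation.Unary.All.Properties as Allₚ
import Data.List.Relation.Unary.AllPairs as AllPairs
open import Data.List.Relation.Unary.AllPairs using ([]; _∷_; AllPairs)
import Data.List.Relation.Unary.AllPairs.Properties as AllPairsₚ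
import Data.List.Relation.Unary.Any as Any
open import Data.List.Relation.Unary.Any using (here; there)
import Data.List.Relation.Unary.Unique.DecPropositional as DecUnique
open import Data.List.Relation.Unary.Unique.Propositional using (Unique)
import Data.List.Relation.Unary.Unique.Propositional.Properties as Uniqueₚ
import Data.Nat.Base as ℕ
open import Data.Nat.Base using (ℕ; zero; suc; s≤s; z≤n; _%_) renaming (_≤_ to _≤ⁿ_)
open import Data.Nat.DivMod using (_mod_; m%n<n; m<n⇒m%n≡m; [m+kn]%n≡m%n; [m+n]%n≡m%n; m≡m%n+[m/n]*n; n%n≡0)
import Data.Nat.Properties as ℕₚ
open import Data.Nat.Tactic.RingSolver using (solve-∀)
open import Data.Product.Base using (∃-syntax; Σ-syntax; _×_; _,_; proj₁; proj₂)
open import Data.Rational.Base using (ℚ; 0ℚ; 1ℚ; ½; _+_; _*_; -_; _-_; _≤_; _<_; nonNegative; positive; _/_; mkℚ; toℚᵘ; ∣_∣; 1/_; Positive)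
import Data.Rational.Properties as ℚₚ
open import Data.Rational.Solver using (module +-*-Solver)
import Data.Rational.Unnormalised.Base as ℚᵘ
import Data.Rational.Unnormalised.Properties as ℚᵘₚ
open import Data.Sum.Base using (_⊎_; inj₁; inj₂; [_,_]′)
open import Data.Unit.Base using (⊤; tt)
open import Data.Vec.Base using ([]; _∷_) renaming (here to hereᵛ; there to thereᵛ; tabulate to tabulateᵛ)
import Data.Vec.Properties as Vecₚ
import Defs
open import Defs using (Graph; subsets; Independent; independent?; i[_]; I; ℝ; seq; fromℕ; 0ℝ; mkℝ; cauchy; Isξ; _⪯_; Root; WellCovered; MaximalIndependent; Connected; Cycle; SameCycle; cycle; Unicyclic; path; star; graphG; _≅_; _∈𝒮P)
open import Function.Base using (_∘_; id)
open import Function.Bundles using (mk⇔; Equivalence; Inverse)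
open import Relation.Binary.Construct.Closure.ReflexiveTransitive using (Star; _◅_; _◅◅_; gmap; reverse) renaming (ε to done)
open import Relation.Binary.PropositionalEquality using (_≡_; refl; sym; trans; cong; cong₂; subst; subst₂; module ≡-Reasoning; _≢_)
open import Relation.Nullary.Decidable using (does; dec-true; dec-false; yes; no; Dec; _×-dec_; _⊎-dec_; map′; ¬?; True; toWitness; from-yes; from-no)
open import Relation.Nullary.Negation using (¬_; contradiction)

open +-*-Solver using (solve; _:=_; _:+_; _:*_; _:-_; :-_; con)

-- Paths among trees

-- A bound on I(T, y) alone does not survive grafting. Joining the roots of two trees with values a
-- and c by an edge gives ac - (α - a)(γ - c), where α and γ belong to the trees without their
-- roots. The relative loss depends on α / a and γ / c only, so the induction carries a ratio beside
-- the total. The divisions by such values are the reason for asking positivity of all induced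
-- subgraphs and not just of G. At a rational point this positivity is decidable, unlike the sign of
-- a real number, so it is the property that is bisected, and the root of I(G, x) arises as a limit.
-- No classification is stated separately: each hanging tree carries its polynomials together with
-- the independent sets that later refute bad configurations. A cycle vertex and its tree account
-- for an even number of vertices exactly when it is a stem, so the odd order excludes the patterns
-- of stems that no exchange excludes. For n = 7 the cycle exceeds the value shared by 𝒮P by exactly
-- -x³, whence the separate answer for small n.

0<1 : 0ℚ < 1ℚ
0<1 = ℚₚ.positive⁻¹ 1ℚ

0≤1 : 0ℚ ≤ 1ℚ
0≤1 = ℚₚ.<⇒≤ 0<1

0≤⇒≤ : ∀ {p q} → 0ℚ ≤ q - p → p ≤ q
0≤⇒≤ {p} {q} h = subst₂ _≤_ (ℚₚ.+-identityʳ p) (solve 2 (λ p q → p :+ (q :- p) := q) refl p q)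
                   (ℚₚ.+-monoʳ-≤ p h)

≤⇒0≤ : ∀ {p q} → p ≤ q → 0ℚ ≤ q - p
≤⇒0≤ {p} {q} h = subst (_≤ q - p) (ℚₚ.+-inverseʳ p) (ℚₚ.+-monoˡ-≤ (- p) h)

0≤-+ : ∀ {p q} → 0ℚ ≤ p → 0ℚ ≤ q → 0ℚ ≤ p + q
0≤-+ = ℚₚ.+-mono-≤

0≤-* : ∀ {p q} → 0ℚ ≤ p → 0ℚ ≤ q → 0ℚ ≤ p * q
0≤-* {p} {q} hp hq = subst (_≤ p * q) (ℚₚ.*-zeroˡ q) (ℚₚ.*-monoʳ-≤-nonNeg q {{nonNegative hq}} hp)

0<-* : ∀ {p q} → 0ℚ < p → 0ℚ < q → 0ℚ < p * q
0<-* {p} {q} hp hq = subst (_< p * q) (ℚₚ.*-zeroˡ q) (ℚₚ.*-monoˡ-<-pos q {{positive hq}} hp)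

0<-*-cancelˡ : ∀ {p q} → 0ℚ < p → 0ℚ < p * q → 0ℚ < q
0<-*-cancelˡ {p} {q} hp h =
  ℚₚ.*-cancelˡ-<-nonNeg p {{nonNegative (ℚₚ.<⇒≤ hp)}} (subst (_< p * q) (sym (ℚₚ.*-zeroʳ p)) h)

*-cancelˡ-≤ : ∀ {p q r} → 0ℚ < r → r * p ≤ r * q → p ≤ q
*-cancelˡ-≤ {r = r} hr = ℚₚ.*-cancelˡ-≤-pos r {{positive hr}}

*-monoˡ-≤ : ∀ {p q r} → 0ℚ ≤ r → p ≤ q → r * p ≤ r * q
*-monoˡ-≤ {r = r} hr = ℚₚ.*-monoˡ-≤-nonNeg r {{nonNegative hr}}

0≤- : ∀ {p} → p ≤ 0ℚ → 0ℚ ≤ - p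
0≤- = ℚₚ.neg-antimono-≤

neg-involutive : ∀ p → - (- p) ≡ p
neg-involutive = solve 1 (λ p → :- (:- p) := p) refl

by-difference : ∀ {p q} d → 0ℚ ≤ d → d ≡ q - p → p ≤ q
by-difference d hd e = 0≤⇒≤ (subst (0ℚ ≤_) e hd)

-- q k is the polynomial of the path with k - 1 vertices, at weight y.
q : ℚ → ℕ → ℚ
q y zero          = 1ℚ
q y (suc zero)    = 1ℚ
q y (suc (suc k)) = q y (suc k) + y * q y k

module PathBounds (y : ℚ) (y≤0 : y ≤ 0ℚ) where

  private
    -y : ℚ
    -y = - y

    0≤-y : 0ℚ ≤ -y
    0≤-y = 0≤- y≤0

  -- Deletion of an inner vertex from the path with a + b + 1 vertices, which leaves a and b
  -- vertices on its sides. The value `q y 0 = 1` makes this true of an end vertex as well.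
  q-split : ∀ a b → q y (2 ℕ.+ (a ℕ.+ b)) ≡ q y (suc a) * q y (suc b) + y * (q y a * q y b)
  q-split zero b = solve 3 (λ y c d → c :+ y :* d := con 1ℚ :* c :+ y :* (con 1ℚ :* d)) refl y (q y (suc b)) (q y b)
  q-split (suc a) b = trans (cong (λ k → q y (2 ℕ.+ k)) (sym (ℕₚ.+-suc a b)))
    (trans (q-split a (suc b))
      (solve 5 (λ y a1 a b1 b → a1 :* (b1 :+ y :* b) :+ y :* (a :* b1) := (a1 :+ y :* a) :* b1 :+ y :* (a1 :* b))
        refl y (q y (suc a)) (q y a) (q y (suc b)) (q y b)))

  -- The same identity one index lower, with `q y (suc a) - q y a` for y times the value preceding
  -- `q y a`, so that a = 0 is no exception.
  q-split′ : ∀ a b → q y (suc (a ℕ.+ b)) ≡ q y a * q y (suc b) + (q y (suc a) - q y a) * q y b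
  q-split′ zero b = solve 2 (λ c d → c := con 1ℚ :* c :+ (con 1ℚ :- con 1ℚ) :* d) refl (q y (suc b)) (q y b)
  q-split′ (suc a) b = trans (q-split a b)
    (solve 5 (λ y a1 a b1 b → a1 :* b1 :+ y :* (a :* b) := a1 :* b1 :+ (a1 :+ y :* a :- a1) :* b)
        refl y (q y (suc a)) (q y a) (q y (suc b)) (q y b))

  -- The difference starts at -y and is multiplied by -y from each j to the next, so it equals
  -- (-y)^(j + 1).
  turan : ∀ j → 0ℚ ≤ q y (suc j) * q y (suc j) - q y j * q y (2 ℕ.+ j)
  turan zero = subst (0ℚ ≤_) (solve 1 (λ y → :- y := con 1ℚ :* con 1ℚ :- con 1ℚ :* (con 1ℚ :+ y :* con 1ℚ)) refl y) 0≤-y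
  turan (suc j) = subst (0ℚ ≤_)
    (solve 3 (λ y b a → :- y :* (b :* b :- a :* (b :+ y :* a))
                := (b :+ y :* a) :* (b :+ y :* a) :- b :* (b :+ y :* a :+ y :* b)) refl y (q y (suc j)) (q y j))
    (0≤-* 0≤-y (turan j))

  PosUpTo : ℕ → Set
  PosUpTo M = ∀ j → j ℕ.≤ M → 0ℚ < q y j

  posUpTo-suc : ∀ {M} → PosUpTo M → 0ℚ < q y (suc M) → PosUpTo (suc M)
  posUpTo-suc {M} pos p j j≤ with ℕₚ.m≤n⇒m<n∨m≡n j≤
  ... | inj₁ (s≤s j≤M) = pos j j≤M
  ... | inj₂ refl      = p

  q-decreasing : ∀ {M} → PosUpTo M → q y (suc M) ≤ q y M
  q-decreasing {zero} _ = ℚₚ.≤-refl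
  q-decreasing {suc M} pos = by-difference (-y * q y M) (0≤-* 0≤-y (ℚₚ.<⇒≤ (pos M (ℕₚ.n≤1+n M))))
    (solve 3 (λ y a b → :- y :* a := b :- (b :+ y :* a)) refl y (q y M) (q y (suc M)))

  -- Turán's inequality makes q (a + j + 2) / q (j + 1) decreasing in j, so the
  -- positivity of the last value forces that of the preceding ones.
  posUpTo-+ : ∀ a j → PosUpTo (suc a) → PosUpTo (suc j) → 0ℚ < q y (2 ℕ.+ (a ℕ.+ j)) → PosUpTo (2 ℕ.+ (a ℕ.+ j))
  posUpTo-+ a zero posa posj p = subst (λ k → PosUpTo (2 ℕ.+ k)) (sym (ℕₚ.+-identityʳ a))
    (posUpTo-suc posa (subst (λ k → 0ℚ < q y (2 ℕ.+ k)) (ℕₚ.+-identityʳ a) p))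
  posUpTo-+ a (suc j) posa posj p = posUpTo-suc
    (subst (λ k → PosUpTo (suc k)) (sym (ℕₚ.+-suc a j)) (posUpTo-+ a j posa posj′ p′)) p
    where
    posj′ : PosUpTo (suc j)
    posj′ i i≤ = posj i (ℕₚ.m≤n⇒m≤1+n i≤)
    g = q y (2 ℕ.+ (a ℕ.+ j))
    g′ = q y (2 ℕ.+ (a ℕ.+ suc j))
    posb = posj (suc j) (ℕₚ.n≤1+n _)
    drop : q y (suc j) * g′ ≤ q y (2 ℕ.+ j) * g
    drop = by-difference (-y * q y a * (q y (suc j) * q y (suc j) - q y j * q y (2 ℕ.+ j)))
      (0≤-* (0≤-* 0≤-y (ℚₚ.<⇒≤ (posa a (ℕₚ.n≤1+n a)))) (turan j))
      (trans (solve 6 (λ y a a1 b b1 b2 → :- y :* a :* (b1 :* b1 :- b :* b2)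
                  := b2 :* (a1 :* b1 :+ y :* (a :* b)) :- b1 :* (a1 :* b2 :+ y :* (a :* b1)))
                refl y (q y a) (q y (suc a)) (q y j) (q y (suc j)) (q y (2 ℕ.+ j)))
             (cong₂ (λ u v → q y (2 ℕ.+ j) * u - q y (suc j) * v) (sym (q-split a j)) (sym (q-split a (suc j)))))
    p′ : 0ℚ < g
    p′ = 0<-*-cancelˡ (posj (2 ℕ.+ j) ℕₚ.≤-refl) (ℚₚ.<-≤-trans (0<-* posb p) drop)

  -- A tree with N + 1 vertices, all of weight y: α is the polynomial of the
  -- tree without its root, β that of the tree without the root and its neighbours.
  record Dominated (N : ℕ) (α β : ℚ) : Set where
    field
      positive-q : PosUpTo (2 ℕ.+ N)
      total      : α + y * β ≤ q y (2 ℕ.+ N)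
      ratio      : α * q y N ≤ β * q y (suc N)

  -- Domination is conditional because the total of a tree is not known to be positive while its
  -- root is still without a leaf. Positivity of the larger tree is passed back to the smaller one
  -- by `0<a`.
  record Bounded (N : ℕ) (α β : ℚ) : Set where
    field
      0<α       : 0ℚ < α
      0<β       : 0ℚ < β
      dominated : 0ℚ < α + y * β → Dominated N α β

  bounded-point : Bounded 0 1ℚ 1ℚ
  bounded-point = record
    { 0<α = 0<1
    ; 0<β = 0<1
    ; dominated = λ h → record
      { positive-q = λ { zero _ → 0<1 ; (suc zero) _ → 0<1
                       ; (suc (suc zero)) _ → h ; (suc (suc (suc _))) (s≤s (s≤s ())) }
      ; total = ℚₚ.≤-refl
      ; ratio = ℚₚ.≤-refl } }

  module _ {m k : ℕ} {α β γ δ : ℚ} (A : Bounded m α β) (C : Bounded k γ δ) (0<c : 0ℚ < γ + y * δ) where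
    private
      module A = Bounded A
      module C = Bounded C
      module DC = Dominated (C.dominated 0<c)

      a c E : ℚ
      a = α + y * β
      c = γ + y * δ
      E = α * c + y * (β * γ)

      N : ℕ
      N = suc (m ℕ.+ k)

      c≤γ : c ≤ γ
      c≤γ = by-difference (-y * δ) (0≤-* 0≤-y (ℚₚ.<⇒≤ C.0<β))
        (solve 3 (λ y g d → :- y :* d := g :- (g :+ y :* d)) refl y γ δ)

      -- The product c * a exceeds E by -y * β * (γ - c), which is nonnegative.
      0<a : 0ℚ < E → 0ℚ < a
      0<a 0<E = 0<-*-cancelˡ 0<c (ℚₚ.<-≤-trans 0<E
        (by-difference (-y * β * (γ - c)) (0≤-* (0≤-* 0≤-y (ℚₚ.<⇒≤ A.0<β)) (≤⇒0≤ c≤γ))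
          (solve 5 (λ y a b c g → :- y :* b :* (g :- c) := c :* (a :+ y :* b) :- (a :* c :+ y :* (b :* g)))
            refl y α β c γ)))

      module Given (0<E : 0ℚ < E) where
        module DA = Dominated (A.dominated (0<a 0<E))

        a0 = q y m
        a1 = q y (suc m)
        a2 = q y (2 ℕ.+ m)
        c0 = q y k
        c1 = q y (suc k)
        c2 = q y (2 ℕ.+ k)
        e = q y (2 ℕ.+ N)
        e1 = q y (suc N)
        e0 = q y N

        0<a0 : 0ℚ < a0
        0<a0 = DA.positive-q m (ℕₚ.m≤n+m m 2)
        0<a2 : 0ℚ < a2
        0<a2 = DA.positive-q (2 ℕ.+ m) ℕₚ.≤-refl
        0<c0 : 0ℚ < c0
        0<c0 = DC.positive-q k (ℕₚ.m≤n+m k 2)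
        0<c1 : 0ℚ < c1
        0<c1 = DC.positive-q (suc k) (ℕₚ.n≤1+n _)
        0<c2 : 0ℚ < c2
        0<c2 = DC.positive-q (2 ℕ.+ k) ℕₚ.≤-refl

        -- Since a = α + y * β with y ≤ 0, an upper bound on α / β is a lower bound on α / a.
        ratio-a : a * a1 ≤ α * a2
        ratio-a = by-difference (-y * (β * a1 - α * a0)) (0≤-* 0≤-y (≤⇒0≤ DA.ratio))
          (solve 5 (λ y al b x1 x0 → :- y :* (b :* x1 :- al :* x0)
                     := al :* (x1 :+ y :* x0) :- (al :+ y :* b) :* x1) refl y α β a1 a0)

        ratio-c : c * c1 ≤ γ * c2
        ratio-c = by-difference (-y * (δ * c1 - γ * c0)) (0≤-* 0≤-y (≤⇒0≤ DC.ratio))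
          (solve 5 (λ y al b x1 x0 → :- y :* (b :* x1 :- al :* x0)
                     := al :* (x1 :+ y :* x0) :- (al :+ y :* b) :* x1) refl y γ δ c1 c0)

        a≤α : a ≤ α
        a≤α = by-difference (-y * β) (0≤-* 0≤-y (ℚₚ.<⇒≤ A.0<β))
          (solve 3 (λ y g d → :- y :* d := g :- (g :+ y :* d)) refl y α β)

        e-split : e ≡ a2 * c1 + y * (a1 * c0)
        e-split = q-split (suc m) k

        e-split′ : e ≡ a1 * c2 + y * (a0 * c1)
        e-split′ = trans (cong (λ j → q y (2 ℕ.+ j)) (sym (ℕₚ.+-suc m k))) (q-split m (suc k))

        -- Here E / (a * c) = 1 - (α / a - 1) * (γ / c - 1), and e / (a2 * c2) has the same form
        -- with a1 / a2 and c1 / c2. The ratios of the trees are at least those of the paths, which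
        -- are at least 1.
        E-bound : E * (a2 * c2) ≤ a * c * e
        E-bound = by-difference
          (a2 * (α - a) * (γ * c2 - c * c1) + c * (c1 - c2) * (α * a2 - a * a1))
          (0≤-+ (0≤-* (0≤-* (ℚₚ.<⇒≤ 0<a2) (≤⇒0≤ a≤α)) (≤⇒0≤ ratio-c))
                (0≤-* (0≤-* (ℚₚ.<⇒≤ 0<c) (≤⇒0≤ (q-decreasing λ j j≤ → DC.positive-q j (ℕₚ.m≤n⇒m≤1+n j≤))))
                      (≤⇒0≤ ratio-a)))
          (trans (solve 9 (λ y al b g d x1 x2 w0 w1 →
                    x2 :* (al :- (al :+ y :* b)) :* (g :* (w1 :+ y :* w0) :- (g :+ y :* d) :* w1)
                    :+ (g :+ y :* d) :* (w1 :- (w1 :+ y :* w0)) :* (al :* x2 :- (al :+ y :* b) :* x1)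
                    := (al :+ y :* b) :* (g :+ y :* d) :* (x2 :* w1 :+ y :* (x1 :* w0))
                       :- (al :* (g :+ y :* d) :+ y :* (b :* g)) :* (x2 :* (w1 :+ y :* w0)))
                  refl y α β γ δ a1 a2 c0 c1)
                 (cong (λ e → a * c * e - E * (a2 * c2)) (sym e-split)))

        0<e : 0ℚ < e
        0<e = 0<-*-cancelˡ (0<-* (0<a 0<E) 0<c) (ℚₚ.<-≤-trans (0<-* 0<E (0<-* 0<a2 0<c2)) E-bound)

        E≤e : E ≤ e
        E≤e = *-cancelˡ-≤ (0<-* 0<a2 0<c2) (ℚₚ.≤-trans (ℚₚ.≤-reflexive (ℚₚ.*-comm (a2 * c2) E))
          (ℚₚ.≤-trans E-bound (subst₂ _≤_ (ℚₚ.*-comm e (a * c)) (ℚₚ.*-comm e (a2 * c2)) (*-monoˡ-≤ (ℚₚ.<⇒≤ 0<e)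
            (ℚₚ.≤-trans (*-monoˡ-≤ (ℚₚ.<⇒≤ (0<a 0<E)) DC.total)
              (subst₂ _≤_ (ℚₚ.*-comm c2 a) (ℚₚ.*-comm c2 a2) (*-monoˡ-≤ (ℚₚ.<⇒≤ 0<c2) DA.total)))))))

        -- for the ratios q (j + 1) / q j
        supermultiplicative : a1 * c2 * e0 ≤ e1 * (a0 * c1)
        supermultiplicative = by-difference ((a0 - a1) * c0 * e)
          (0≤-* (0≤-* (≤⇒0≤ (q-decreasing λ j j≤ → DA.positive-q j (ℕₚ.≤-trans j≤ (ℕₚ.m≤n+m m 2)))) (ℚₚ.<⇒≤ 0<c0))
                (ℚₚ.<⇒≤ 0<e))
          (trans (cong ((a0 - a1) * c0 *_) e-split′)
            (trans (solve 5 (λ y x0 x1 w0 w1 →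
                      (x0 :- x1) :* w0 :* (x1 :* (w1 :+ y :* w0) :+ y :* (x0 :* w1))
                      := (x1 :* w1 :+ y :* (x0 :* w0)) :* (x0 :* w1)
                         :- x1 :* (w1 :+ y :* w0) :* (x0 :* w1 :+ (x1 :- x0) :* w0))
                    refl y a0 a1 c0 c1)
              (cong₂ (λ u v → u * (a0 * c1) - a1 * c2 * v) (sym (q-split m k)) (sym (q-split′ m k)))))

        -- Cleared of denominators: α / β ≤ a1 / a0 and c / γ ≤ c2 / c1, and the product of the
        -- right-hand sides is at most e1 / e0 by `supermultiplicative`.
        ratio-E : α * c * e0 ≤ β * γ * e1
        ratio-E = *-cancelˡ-≤ (0<-* 0<a0 0<c1) (ℚₚ.≤-trans
          (by-difference (e0 * (α * a0 * (γ * c2 - c * c1) + γ * c2 * (β * a1 - α * a0)))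
            (0≤-* 0≤e0 (0≤-+ (0≤-* (0≤-* (ℚₚ.<⇒≤ A.0<α) (ℚₚ.<⇒≤ 0<a0)) (≤⇒0≤ ratio-c))
                             (0≤-* (0≤-* (ℚₚ.<⇒≤ C.0<α) (ℚₚ.<⇒≤ 0<c2)) (≤⇒0≤ DA.ratio))))
            (solve 9 (λ e0 al b g c x0 x1 w1 w2 →
               e0 :* (al :* x0 :* (g :* w2 :- c :* w1) :+ g :* w2 :* (b :* x1 :- al :* x0))
               := b :* g :* (x1 :* w2 :* e0) :- (x0 :* w1) :* (al :* c :* e0))
              refl e0 α β γ c a0 a1 c1 c2))
          (ℚₚ.≤-trans (*-monoˡ-≤ (ℚₚ.<⇒≤ (0<-* A.0<β C.0<α)) supermultiplicative)
            (ℚₚ.≤-reflexive (solve 5 (λ b g e x w → b :* g :* (e :* (x :* w)) := x :* w :* (b :* g :* e))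
              refl β γ e1 a0 c1))))
          where
          pos : PosUpTo (2 ℕ.+ N)
          pos = posUpTo-+ (suc m) k DA.positive-q (λ j j≤ → DC.positive-q j (ℕₚ.m≤n⇒m≤1+n j≤)) 0<e
          0≤e0 : 0ℚ ≤ e0
          0≤e0 = ℚₚ.<⇒≤ (pos N (ℕₚ.m≤n+m N 2))

    -- The root of the second tree becomes a child of the root of the first. Without the common root
    -- the parts separate, giving α * c; without its closed neighbourhood the second tree loses its
    -- root too, giving β * γ.
    bounded-graft : Bounded (suc (m ℕ.+ k)) (α * c) (β * γ)
    bounded-graft = record
      { 0<α = 0<-* A.0<α 0<c
      ; 0<β = 0<-* A.0<β C.0<α
      ; dominated = λ 0<E → let open Given 0<E in record
        { positive-q = posUpTo-+ (suc m) k DA.positive-q (λ j j≤ → DC.positive-q j (ℕₚ.m≤n⇒m≤1+n j≤)) 0<e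
        ; total = E≤e
        ; ratio = ratio-E } }

-- Independence polynomials of vertex lists

module Polynomial {V : Set} (G : Graph V) where
  open Graph G

  adj : V → V → Bool
  adj u v = does (u ~? v)

  adj-sym : ∀ u v → adj u v ≡ adj v u
  adj-sym u v with u ~? v
  ... | yes p = sym (dec-true (v ~? u) (~-sym p))
  ... | no ¬p = sym (dec-false (v ~? u) (λ p → ¬p (~-sym p)))

  open-to : V → List V → Bool
  open-to v []      = true
  open-to v (f ∷ F) = not (adj v f) ∧ open-to v F

  weight : ℚ → Bool → ℚ
  weight x b = if b then x else 0ℚ

  -- The independence polynomial of the subgraph induced by the vertices of L
  -- that are not adjacent to F.
  Z : ℚ → List V → List V → ℚ
  Z x []      F = 1ℚ
  Z x (v ∷ L) F = Z x L F + weight x (open-to v F) * Z x L (v ∷ F)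

  _≁*_ : V → List V → Set
  v ≁* L = ∀ {u} → u ∈ L → ¬ (u ~ v)

  open-to-~ : ∀ {v f} F → v ~ f → open-to v (f ∷ F) ≡ false
  open-to-~ {v} {f} F p rewrite dec-true (v ~? f) p = refl

  open-to-≁ : ∀ {v f} F → ¬ (v ~ f) → open-to v (f ∷ F) ≡ open-to v F
  open-to-≁ {v} {f} F p rewrite dec-false (v ~? f) p = refl

  open-to-++ : ∀ v E F → open-to v (E ++ F) ≡ open-to v E ∧ open-to v F
  open-to-++ v []      F = refl
  open-to-++ v (e ∷ E) F = trans (cong (not (adj v e) ∧_) (open-to-++ v E F))
    (sym (∧-assoc (not (adj v e)) (open-to v E) (open-to v F)))

  module _ (x : ℚ) where

    Z-cong : ∀ L {F F′} → (∀ {v} → v ∈ L → open-to v F ≡ open-to v F′) → Z x L F ≡ Z x L F′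
    Z-cong []      h = refl
    Z-cong (v ∷ L) h = cong₂ _+_ (Z-cong L (λ i → h (there i)))
      (cong₂ _*_ (cong (weight x) (h (here refl)))
        (Z-cong L (λ {u} i → cong (not (adj u v) ∧_) (h (there i)))))

    Z-ignore : ∀ L {f} F → f ≁* L → Z x L (f ∷ F) ≡ Z x L F
    Z-ignore L F h = Z-cong L (λ i → open-to-≁ F (h i))

    Z-keep : ∀ v L F → open-to v F ≡ true → Z x (v ∷ L) F ≡ Z x L F + x * Z x L (v ∷ F)
    Z-keep v L F h rewrite h = refl

    Z-blocked : ∀ v L F → open-to v F ≡ false → Z x (v ∷ L) F ≡ Z x L F
    Z-blocked v L F h rewrite h = solve 2 (λ a b → a :+ con 0ℚ :* b := a) refl (Z x L F) (Z x L (v ∷ F))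

    Z-isolated : ∀ v L F → open-to v F ≡ true → v ≁* L → Z x (v ∷ L) F ≡ (1ℚ + x) * Z x L F
    Z-isolated v L F h i = trans (Z-keep v L F h) (trans (cong (λ z → Z x L F + x * z) (Z-ignore L F i))
      (solve 2 (λ x z → z :+ x :* z := (con 1ℚ :+ x) :* z) refl x (Z x L F)))

    Z-swap : ∀ u v L F → Z x (u ∷ v ∷ L) F ≡ Z x (v ∷ u ∷ L) F
    Z-swap u v L F = begin
      Z₀ + w v F * Z₁ v + w u F * (Z₁ u + w v (u ∷ F) * Z x L (v ∷ u ∷ F))
        ≡⟨ solve 7 (λ a wv zv wu zu wuv zuv → a :+ wv :* zv :+ wu :* (zu :+ wuv :* zuv)
                      := a :+ wu :* zu :+ wv :* zv :+ wu :* wuv :* zuv) refl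
             Z₀ (w v F) (Z₁ v) (w u F) (Z₁ u) (w v (u ∷ F)) (Z x L (v ∷ u ∷ F)) ⟩
      Z₀ + w u F * Z₁ u + w v F * Z₁ v + w u F * w v (u ∷ F) * Z x L (v ∷ u ∷ F)
        ≡⟨ cong₂ (λ a b → Z₀ + w u F * Z₁ u + w v F * Z₁ v + a * b) (pair (open-to u F) (open-to v F)) (Z-cong L same) ⟩
      Z₀ + w u F * Z₁ u + w v F * Z₁ v + w v F * w u (v ∷ F) * Z x L (u ∷ v ∷ F)
        ≡⟨ solve 7 (λ a wv zv wu zu wuv zuv → a :+ wv :* zv :+ wu :* zu :+ wu :* wuv :* zuv
                      := a :+ wv :* zv :+ wu :* (zu :+ wuv :* zuv)) refl
             Z₀ (w u F) (Z₁ u) (w v F) (Z₁ v) (w u (v ∷ F)) (Z x L (u ∷ v ∷ F)) ⟩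
      Z₀ + w u F * Z₁ u + w v F * (Z₁ v + w u (v ∷ F) * Z x L (u ∷ v ∷ F)) ∎
      where
      open ≡-Reasoning
      Z₀ = Z x L F
      Z₁ : V → ℚ
      Z₁ a = Z x L (a ∷ F)
      w : V → List V → ℚ
      w a E = weight x (open-to a E)
      same : ∀ {a} → a ∈ L → open-to a (v ∷ u ∷ F) ≡ open-to a (u ∷ v ∷ F)
      same {a} _ with adj a u | adj a v
      ... | true  | true  = refl
      ... | true  | false = refl
      ... | false | true  = refl
      ... | false | false = refl
      pair : ∀ b c → weight x b * weight x (not (adj v u) ∧ c) ≡ weight x c * weight x (not (adj u v) ∧ b)
      pair b c rewrite adj-sym v u with adj u v
      ... | true  = trans (ℚₚ.*-zeroʳ (weight x b)) (sym (ℚₚ.*-zeroʳ (weight x c)))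
      ... | false = ℚₚ.*-comm (weight x b) (weight x c)

    Z-↭ : ∀ {L L′} F → L ↭ L′ → Z x L F ≡ Z x L′ F
    Z-↭ F Perm.refl = refl
    Z-↭ F (Perm.prep v p) = cong₂ (λ a b → a + weight x (open-to v F) * b) (Z-↭ F p) (Z-↭ (v ∷ F) p)
    Z-↭ F (Perm.swap {xs = L} u v p) = trans (Z-swap u v L F)
      (cong₂ _+_ (cong₂ (λ a b → a + weight x (open-to u F) * b) (Z-↭ F p) (Z-↭ (u ∷ F) p))
        (cong (weight x (open-to v F) *_)
          (cong₂ (λ a b → a + weight x (open-to u (v ∷ F)) * b) (Z-↭ (v ∷ F) p) (Z-↭ (u ∷ v ∷ F) p))))
    Z-↭ F (Perm.trans p p′) = trans (Z-↭ F p) (Z-↭ F p′)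

    Z-++ : ∀ A B F → (∀ {a b} → a ∈ A → b ∈ B → ¬ (b ~ a)) → Z x (A ++ B) F ≡ Z x A F * Z x B F
    Z-++ []      B F h = sym (ℚₚ.*-identityˡ (Z x B F))
    Z-++ (a ∷ A) B F h = trans
      (cong₂ (λ p r → p + w * r) (Z-++ A B F (λ i → h (there i)))
        (trans (Z-++ A B (a ∷ F) (λ i → h (there i))) (cong (Z x A (a ∷ F) *_) (Z-ignore B F (h (here refl))))))
      (solve 4 (λ w p r z → p :* z :+ w :* (r :* z) := (p :+ w :* r) :* z) refl w (Z x A F) (Z x A (a ∷ F)) (Z x B F))
      where w = weight x (open-to a F)

    -- Blocking amounts to passing to an induced subgraph. This extends positivity of induced
    -- subgraphs to arbitrary F.
    Z-restrict : ∀ L E F → Z x L (E ++ F) ≡ Z x (filterᵇ (λ v → open-to v F) L) E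
    Z-restrict []      E F = refl
    Z-restrict (v ∷ L) E F with open-to v F in eq
    ... | true  = cong₂ _+_ (Z-restrict L E F) (cong₂ (λ b z → weight x b * z)
                    (trans (open-to-++ v E F) (trans (cong (open-to v E ∧_) eq) (∧-identityʳ _))) (Z-restrict L (v ∷ E) F))
    ... | false = trans (Z-blocked v L (E ++ F) (trans (open-to-++ v E F)
                    (trans (cong (open-to v E ∧_) eq) (∧-zeroʳ (open-to v E))))) (Z-restrict L E F)

    Z-stem : ∀ w l A → l ~ w → l ≁* A → Z x (w ∷ l ∷ A) [] ≡ (1ℚ + x) * Z x A [] + x * Z x A (w ∷ [])
    Z-stem w l A l~w h = cong₂ _+_ (Z-isolated l A [] refl h)
      (cong (x *_) (Z-blocked l A (w ∷ []) (open-to-~ [] l~w)))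

    Z-stem-blocked : ∀ r w l A → w ~ r → l ≁* A → r ≁* (l ∷ A) → Z x (w ∷ l ∷ A) (r ∷ []) ≡ (1ℚ + x) * Z x A []
    Z-stem-blocked r w l A w~r h h′ = trans (Z-blocked w (l ∷ A) (r ∷ []) (open-to-~ [] w~r))
      (trans (Z-isolated l A (r ∷ []) (open-to-≁ [] (h′ (here refl))) h)
        (cong ((1ℚ + x) *_) (Z-ignore A [] (λ i → h′ (there i)))))

    module _ {b c : V} {B C : List V} (b≁C : b ≁* C) (c≁B : c ≁* B)
             (B≁C : ∀ {u v} → u ∈ B → v ∈ C → ¬ (v ~ u)) where
      private
        α β γ δ : ℚ
        α = Z x B []
        β = Z x B (b ∷ [])
        γ = Z x C []
        δ = Z x C (c ∷ [])

        R : List V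
        R = B ++ C

        Z-R : Z x R [] ≡ α * γ
        Z-R = Z-++ B C [] B≁C

        Z-Rb : Z x R (b ∷ []) ≡ β * γ
        Z-Rb = trans (Z-++ B C (b ∷ []) B≁C) (cong (β *_) (Z-ignore C [] b≁C))

        Z-Rc : Z x R (c ∷ []) ≡ α * δ
        Z-Rc = trans (Z-++ B C (c ∷ []) B≁C) (cong (_* δ) (Z-ignore B [] c≁B))

        Z-Rcb : Z x R (c ∷ b ∷ []) ≡ β * δ
        Z-Rcb = trans (Z-++ B C (c ∷ b ∷ []) B≁C)
          (cong₂ _*_ (Z-ignore B (b ∷ []) c≁B)
            (Z-cong C λ {v} i → trans (cong (not (adj v c) ∧_) (open-to-≁ [] (b≁C i))) refl))

      -- Trees B and C hang at b and c, none at a. The four terms come from choosing no corner, a, c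
      -- or b.
      Z-triangle : ∀ {a} → b ~ c → b ~ a → c ~ a → a ≁* (B ++ C) →
        Z x (a ∷ b ∷ c ∷ B ++ C) [] ≡ (1ℚ + x) * (α * γ) + x * (α * δ + β * γ)
      Z-triangle {a} b~c b~a c~a a≁R = trans
        (cong₂ (λ p r → p + x * r)
          (cong₂ (λ p r → p + x * r) (cong₂ (λ p r → p + x * r) Z-R Z-Rc)
            (trans (Z-blocked c R (b ∷ []) (open-to-~ [] (~-sym b~c))) Z-Rb))
          (trans (Z-blocked b (c ∷ R) (a ∷ []) (open-to-~ [] b~a))
            (trans (Z-blocked c R (a ∷ []) (open-to-~ [] c~a)) (trans (Z-ignore R [] a≁R) Z-R))))
        (solve 4 (λ x ag ad bg → ag :+ x :* ad :+ x :* bg :+ x :* ag := (con 1ℚ :+ x) :* ag :+ x :* (ad :+ bg))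
          refl x (α * γ) (α * δ) (β * γ))

      -- The cyclic order is b, d, c, e, f, with trees at the nonadjacent corners b and c. The four
      -- local lemmas fix which of b and c are chosen and sum over d, e and f.
      Z-pentagon : ∀ {d e f} → ¬ (c ~ b) → d ~ b → d ~ c → e ~ c → f ~ e → f ~ b →
        d ≁* (e ∷ f ∷ B ++ C) → ¬ (e ~ b) → ¬ (f ~ c) → e ≁* (B ++ C) → f ≁* (B ++ C) →
        Z x (b ∷ c ∷ d ∷ e ∷ f ∷ B ++ C) []
          ≡ (1ℚ + x) * ((1ℚ + x + x) * (α * γ)) + x * ((1ℚ + x) * (α * δ + β * γ) + x * (β * δ))
      Z-pentagon {d} {e} {f} c≁b d~b d~c e~c f~e f~b d≁ e≁b f≁c e≁R f≁R = trans
        (cong₂ (λ p r → p + x * r)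
          (cong₂ (λ p r → p + x * r) T-none T-c)
          (trans (Z-keep c (d ∷ e ∷ f ∷ R) (b ∷ []) (open-to-≁ [] c≁b))
            (cong₂ (λ p r → p + x * r) T-b T-bc)))
        (solve 5 (λ x ag ad bg bd →
            (con 1ℚ :+ x) :* ((con 1ℚ :+ x) :* ag :+ x :* ag) :+ x :* ((con 1ℚ :+ x) :* ad)
              :+ x :* (bg :+ x :* bg :+ x :* bd)
            := (con 1ℚ :+ x) :* ((con 1ℚ :+ x :+ x) :* ag)
              :+ x :* ((con 1ℚ :+ x) :* (ad :+ bg) :+ x :* bd))
          refl x (α * γ) (α * δ) (β * γ) (β * δ))
        where
        T = d ∷ e ∷ f ∷ R
        T-none : Z x T [] ≡ (1ℚ + x) * ((1ℚ + x) * (α * γ) + x * (α * γ))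
        T-none = trans (Z-isolated d (e ∷ f ∷ R) [] refl d≁) (cong ((1ℚ + x) *_) (cong₂ (λ p r → p + x * r)
          (trans (Z-isolated f R [] refl f≁R) (cong ((1ℚ + x) *_) Z-R))
          (trans (Z-blocked f R (e ∷ []) (open-to-~ [] f~e)) (trans (Z-ignore R [] e≁R) Z-R))))
        T-c : Z x T (c ∷ []) ≡ (1ℚ + x) * (α * δ)
        T-c = trans (Z-blocked d (e ∷ f ∷ R) (c ∷ []) (open-to-~ [] d~c))
          (trans (Z-blocked e (f ∷ R) (c ∷ []) (open-to-~ [] e~c))
            (trans (Z-isolated f R (c ∷ []) (open-to-≁ [] f≁c) f≁R) (cong ((1ℚ + x) *_) Z-Rc)))
        T-b : Z x T (b ∷ []) ≡ β * γ + x * (β * γ)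
        T-b = trans (Z-blocked d (e ∷ f ∷ R) (b ∷ []) (open-to-~ [] d~b))
          (trans (Z-keep e (f ∷ R) (b ∷ []) (open-to-≁ [] e≁b))
            (cong₂ (λ p r → p + x * r)
              (trans (Z-blocked f R (b ∷ []) (open-to-~ [] f~b)) Z-Rb)
              (trans (Z-blocked f R (e ∷ b ∷ []) (open-to-~ (b ∷ []) f~e)) (trans (Z-ignore R (b ∷ []) e≁R) Z-Rb))))
        T-bc : Z x T (c ∷ b ∷ []) ≡ β * δ
        T-bc = trans (Z-blocked d (e ∷ f ∷ R) (c ∷ b ∷ []) (open-to-~ (b ∷ []) d~c))
          (trans (Z-blocked e (f ∷ R) (c ∷ b ∷ []) (open-to-~ (b ∷ []) e~c))
            (trans (Z-blocked f R (c ∷ b ∷ []) (trans (open-to-≁ (b ∷ []) f≁c) (open-to-~ [] f~b))) Z-Rcb))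

module _ {V W : Set} (G : Graph V) (H : Graph W) (f : V → W)
         (f-adj : ∀ u v → Polynomial.adj H (f u) (f v) ≡ Polynomial.adj G u v) where
  private
    module G = Polynomial G
    module H = Polynomial H

  open-to-map : ∀ v F → H.open-to (f v) (map f F) ≡ G.open-to v F
  open-to-map v []      = refl
  open-to-map v (u ∷ F) = cong₂ (λ a b → not a ∧ b) (f-adj v u) (open-to-map v F)

  Z-map : ∀ x L F → H.Z x (map f L) (map f F) ≡ G.Z x L F
  Z-map x []      F = refl
  Z-map x (v ∷ L) F = cong₂ _+_ (Z-map x L F)
    (cong₂ (λ b z → G.weight x b * z) (open-to-map v F) (Z-map x L (v ∷ F)))

-- Independence polynomials as sums over subsets

fromℕᵠ : ℕ → ℚ
fromℕᵠ m = ℤ.+ m / 1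

fromℕᵠ-suc : ∀ m → fromℕᵠ (suc m) ≡ 1ℚ + fromℕᵠ m
fromℕᵠ-suc m = ℚₚ.toℚᵘ-injective (begin-equality
  toℚᵘ (fromℕᵠ (suc m))              ≃⟨ ℚₚ.toℚᵘ-fromℚᵘ (ℚᵘ.mkℚᵘ (ℤ.+ suc m) 0) ⟩
  ℚᵘ.mkℚᵘ (ℤ.+ suc m) 0              ≃⟨ ℚᵘ.*≡* (cong (ℤ._* ℤ.1ℤ) (cong (λ i → ℤ.1ℤ ℤ.+ i) (sym (ℤₚ.*-identityʳ (ℤ.+ m))))) ⟩
  toℚᵘ 1ℚ ℚᵘ.+ ℚᵘ.mkℚᵘ (ℤ.+ m) 0     ≃⟨ ℚᵘₚ.+-congʳ (toℚᵘ 1ℚ) (ℚᵘₚ.≃-sym (ℚₚ.toℚᵘ-fromℚᵘ (ℚᵘ.mkℚᵘ (ℤ.+ m) 0))) ⟩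
  toℚᵘ 1ℚ ℚᵘ.+ toℚᵘ (fromℕᵠ m)       ≃⟨ ℚᵘₚ.≃-sym (ℚₚ.toℚᵘ-homo-+ 1ℚ (fromℕᵠ m)) ⟩
  toℚᵘ (1ℚ + fromℕᵠ m)               ∎)
  where open ℚᵘₚ.≤-Reasoning

archimedean : ∀ ε → 0ℚ < ε → ∃[ N ] 1ℚ ≤ fromℕᵠ N * ε
archimedean ε@(mkℚ (ℤ.+ zero) d c) h = contradiction (ℚₚ.drop-*<* h) λ { (ℤ.+<+ ()) }
-- The denominator serves as N: N * ε is then the numerator, which is at least 1.
archimedean ε@(mkℚ ℤ.+[1+ a ] d c) h = suc d , ℚₚ.toℚᵘ-cancel-≤ (begin
  toℚᵘ 1ℚ                                  ≤⟨ ℚᵘ.*≤* (ℤ.+≤+ (begin′)) ⟩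
  ℚᵘ.mkℚᵘ (ℤ.+ suc d) 0 ℚᵘ.* toℚᵘ ε        ≃⟨ ℚᵘₚ.*-congʳ {toℚᵘ ε} (ℚᵘₚ.≃-sym (ℚₚ.toℚᵘ-fromℚᵘ (ℚᵘ.mkℚᵘ (ℤ.+ suc d) 0))) ⟩
  toℚᵘ (fromℕᵠ (suc d)) ℚᵘ.* toℚᵘ ε        ≃⟨ ℚᵘₚ.≃-sym (ℚₚ.toℚᵘ-homo-* (fromℕᵠ (suc d)) ε) ⟩
  toℚᵘ (fromℕᵠ (suc d) * ε)                ∎)
  where
  open ℚᵘₚ.≤-Reasoning
  begin′ : 1 ℕ.* (1 ℕ.* suc d) ℕ.≤ suc d ℕ.* suc a ℕ.* 1
  begin′ = ℕₚ.≤-trans (ℕₚ.≤-reflexive (trans (ℕₚ.*-identityˡ _) (ℕₚ.*-identityˡ _)))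
    (ℕₚ.≤-trans (ℕₚ.m≤m*n (suc d) (suc a)) (ℕₚ.≤-reflexive (sym (ℕₚ.*-identityʳ _))))
archimedean ε@(mkℚ ℤ.-[1+ a ] d c) h = contradiction (ℚₚ.drop-*<* h) λ ()

sumᵠ : ∀ {A : Set} → (A → ℚ) → List A → ℚ
sumᵠ f = foldr (λ a s → f a + s) 0ℚ

module _ {A : Set} where

  sumᵠ-cong : ∀ {f g : A → ℚ} L → (∀ a → f a ≡ g a) → sumᵠ f L ≡ sumᵠ g L
  sumᵠ-cong []      h = refl
  sumᵠ-cong (a ∷ L) h = cong₂ _+_ (h a) (sumᵠ-cong L h)

  sumᵠ-++ : ∀ (f : A → ℚ) L M → sumᵠ f (L ++ M) ≡ sumᵠ f L + sumᵠ f M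
  sumᵠ-++ f []      M = sym (ℚₚ.+-identityˡ _)
  sumᵠ-++ f (a ∷ L) M = trans (cong (f a +_) (sumᵠ-++ f L M)) (sym (ℚₚ.+-assoc (f a) _ _))

  sumᵠ-map : ∀ {B : Set} (f : A → ℚ) (g : B → A) L → sumᵠ f (map g L) ≡ sumᵠ (f ∘ g) L
  sumᵠ-map f g []      = refl
  sumᵠ-map f g (b ∷ L) = cong (f (g b) +_) (sumᵠ-map f g L)

  sumᵠ-+ : ∀ (f g : A → ℚ) L → sumᵠ (λ a → f a + g a) L ≡ sumᵠ f L + sumᵠ g L
  sumᵠ-+ f g []      = refl
  sumᵠ-+ f g (a ∷ L) = trans (cong (f a + g a +_) (sumᵠ-+ f g L))
    (solve 4 (λ a b c d → a :+ b :+ (c :+ d) := a :+ c :+ (b :+ d)) refl (f a) (g a) (sumᵠ f L) (sumᵠ g L))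

  sumᵠ-* : ∀ c (f : A → ℚ) L → sumᵠ (λ a → c * f a) L ≡ c * sumᵠ f L
  sumᵠ-* c f []      = sym (ℚₚ.*-zeroʳ c)
  sumᵠ-* c f (a ∷ L) = trans (cong (c * f a +_) (sumᵠ-* c f L)) (sym (ℚₚ.*-distribˡ-+ c (f a) _))

  sumᵠ-0 : ∀ (L : List A) → sumᵠ (λ _ → 0ℚ) L ≡ 0ℚ
  sumᵠ-0 []      = refl
  sumᵠ-0 (a ∷ L) = trans (ℚₚ.+-identityˡ _) (sumᵠ-0 L)

pow : ℚ → ℕ → ℚ
pow r zero    = 1ℚ
pow r (suc k) = r * pow r k

seq-^ : ∀ x k m → seq (x Defs.^ k) m ≡ pow (seq x m) k
seq-^ x zero    m = refl
seq-^ x (suc k) m = cong (seq x m *_) (seq-^ x k m)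

seq-∑ : ∀ (f : ℕ → ℝ) m L → seq (foldr (λ k s → f k Defs.+ s) 0ℝ L) m ≡ sumᵠ (λ k → seq (f k) m) L
seq-∑ f m []      = refl
seq-∑ f m (k ∷ L) = cong (seq (f k) m +_) (seq-∑ f m L)

indicator : Bool → ℚ
indicator b = if b then 1ℚ else 0ℚ

sumᵠ-absent : ∀ (g : ℕ → ℚ) j f N → (∀ i → j ≢ f i) →
  sumᵠ (λ k → indicator (does (j ℕₚ.≟ k)) * g k) (applyUpTo f N) ≡ 0ℚ
sumᵠ-absent g j f zero    h = refl
sumᵠ-absent g j f (suc N) h rewrite dec-false (j ℕₚ.≟ f 0) (h 0) = trans
  (cong₂ _+_ (ℚₚ.*-zeroˡ (g (f 0))) (sumᵠ-absent g j (f ∘ suc) N (h ∘ suc))) refl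

sumᵠ-single : ∀ (g : ℕ → ℚ) f N → (∀ {a b} → f a ≡ f b → a ≡ b) → ∀ j → j ℕ.< N →
  sumᵠ (λ k → indicator (does (f j ℕₚ.≟ k)) * g k) (applyUpTo f N) ≡ g (f j)
sumᵠ-single g f (suc N) inj zero j<N rewrite dec-true (f 0 ℕₚ.≟ f 0) refl = trans
  (cong₂ _+_ (ℚₚ.*-identityˡ (g (f 0))) (sumᵠ-absent g (f 0) (f ∘ suc) N (λ i e → ℕₚ.0≢1+n (inj e))))
  (ℚₚ.+-identityʳ (g (f 0)))
sumᵠ-single g f (suc N) inj (suc j) (s≤s j<N)
  rewrite dec-false (f (suc j) ℕₚ.≟ f 0) (λ e → ℕₚ.0≢1+n (sym (inj e))) = trans
  (cong₂ _+_ (ℚₚ.*-zeroˡ (g (f 0)))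
    (sumᵠ-single g (f ∘ suc) N (λ e → ℕₚ.suc-injective (inj e)) j j<N))
  (ℚₚ.+-identityˡ _)

length-filter-∷ : ∀ {A : Set} {P Q : A → Set} (P? : ∀ a → Dec (P a)) (Q? : ∀ a → Dec (Q a)) a L →
  fromℕᵠ (length (filter (λ b → P? b ×-dec Q? b) (a ∷ L)))
    ≡ indicator (does (P? a)) * indicator (does (Q? a)) + fromℕᵠ (length (filter (λ b → P? b ×-dec Q? b) L))
length-filter-∷ P? Q? a L with does (P? a) | does (Q? a)
... | true  | true  = fromℕᵠ-suc (length (filter (λ b → P? b ×-dec Q? b) L))
... | true  | false = sym (ℚₚ.+-identityˡ _)
... | false | true  = sym (ℚₚ.+-identityˡ _)
... | false | false = sym (ℚₚ.+-identityˡ _)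

module _ {A : Set} {P : A → Set} (P? : ∀ a → Dec (P a)) (size : A → ℕ) {n : ℕ} (size≤n : ∀ a → size a ℕ.≤ n) (r : ℚ) where

  count-of-size : ℕ → List A → ℕ
  count-of-size k L = length (filter (λ a → P? a ×-dec (size a ℕₚ.≟ k)) L)

  -- Interchange of summation: each set contributes to the single exponent equal to its size, which
  -- `size≤n` places in the range.
  sum-by-size : ∀ L → sumᵠ (λ k → fromℕᵠ (count-of-size k L) * pow r k) (upTo (suc n))
                        ≡ sumᵠ (λ a → indicator (does (P? a)) * pow r (size a)) L
  sum-by-size [] = trans (sumᵠ-cong (upTo (suc n)) (λ k → ℚₚ.*-zeroˡ (pow r k))) (sumᵠ-0 (upTo (suc n)))
  sum-by-size (a ∷ L) = begin
    sumᵠ (λ k → fromℕᵠ (count-of-size k (a ∷ L)) * pow r k) U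
      ≡⟨ sumᵠ-cong U (λ k → trans (cong (_* pow r k) (length-filter-∷ P? (λ b → size b ℕₚ.≟ k) a L))
           (solve 4 (λ i d c p → (i :* d :+ c) :* p := i :* (d :* p) :+ c :* p) refl
             i (indicator (does (size a ℕₚ.≟ k))) (fromℕᵠ (count-of-size k L)) (pow r k))) ⟩
    sumᵠ (λ k → i * f k + g k) U
      ≡⟨ sumᵠ-+ (λ k → i * f k) g U ⟩
    sumᵠ (λ k → i * f k) U + sumᵠ g U
      ≡⟨ cong₂ _+_ (trans (sumᵠ-* i f U) (cong (i *_)
           (sumᵠ-single (pow r) id (suc n) id (size a) (s≤s (size≤n a))))) (sum-by-size L) ⟩
    i * pow r (size a) + sumᵠ (λ b → indicator (does (P? b)) * pow r (size b)) L ∎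
    where
    open ≡-Reasoning
    U = upTo (suc n)
    i = indicator (does (P? a))
    f g : ℕ → ℚ
    f k = indicator (does (size a ℕₚ.≟ k)) * pow r k
    g k = fromℕᵠ (count-of-size k L) * pow r k

elements : ∀ {k} {V : Set} → (Fin k → V) → Subset k → List V
elements φ []            = []
elements φ (outside ∷ S) = elements (φ ∘ suc) S
elements φ (inside ∷ S)  = φ zero ∷ elements (φ ∘ suc) S

elements⁺ : ∀ {k} {V : Set} (φ : Fin k → V) {S i} → i ∈ˢ S → φ i ∈ elements φ S
elements⁺ φ {inside ∷ S}  {zero}  hereᵛ      = here refl
elements⁺ φ {inside ∷ S}  {suc i} (thereᵛ h) = there (elements⁺ (φ ∘ suc) h)
elements⁺ φ {outside ∷ S} {suc i} (thereᵛ h) = elements⁺ (φ ∘ suc) h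

elements⁻ : ∀ {k} {V : Set} (φ : Fin k → V) S {v} → v ∈ elements φ S → ∃[ i ] (i ∈ˢ S × v ≡ φ i)
elements⁻ φ (inside ∷ S) (here e) = zero , hereᵛ , e
elements⁻ φ (inside ∷ S) (there h) = let i , i∈ , e = elements⁻ (φ ∘ suc) S h in suc i , thereᵛ i∈ , e
elements⁻ φ (outside ∷ S) h = let i , i∈ , e = elements⁻ (φ ∘ suc) S h in suc i , thereᵛ i∈ , e

module SubsetSum {n : ℕ} (G : Graph (Fin n)) where
  open Graph G
  open Polynomial G

  independentᵇ : List (Fin n) → List (Fin n) → Bool
  independentᵇ []      F = true
  independentᵇ (v ∷ L) F = open-to v F ∧ independentᵇ L (v ∷ F)

  open-to-all : ∀ v F → (∀ {f} → f ∈ F → ¬ (v ~ f)) → open-to v F ≡ true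
  open-to-all v []      h = refl
  open-to-all v (f ∷ F) h = trans (open-to-≁ F (h (here refl))) (open-to-all v F (λ i → h (there i)))

  all-open-to : ∀ v F → open-to v F ≡ true → ∀ {f} → f ∈ F → ¬ (v ~ f)
  all-open-to v (g ∷ F) h (here refl) p with trans (sym h) (open-to-~ F p)
  ... | ()
  all-open-to v (g ∷ F) h (there i) with v ~? g
  ... | no _ = all-open-to v F h i
  all-open-to v (g ∷ F) () (there i) | yes _

  independentᵇ⁺ : ∀ L F → (∀ {u v} → u ∈ L → v ∈ L → ¬ (u ~ v)) → (∀ {v f} → v ∈ L → f ∈ F → ¬ (v ~ f)) →
    independentᵇ L F ≡ true
  independentᵇ⁺ []      F h h′ = refl
  independentᵇ⁺ (v ∷ L) F h h′ = cong₂ _∧_ (open-to-all v F (h′ (here refl)))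
    (independentᵇ⁺ L (v ∷ F) (λ i j → h (there i) (there j))
      λ { i (here refl) → h (there i) (here refl) ; i (there j) → h′ (there i) j })

  independentᵇ⁻ : ∀ L F → independentᵇ L F ≡ true →
    (∀ {u v} → u ∈ L → v ∈ L → ¬ (u ~ v)) × (∀ {v f} → v ∈ L → f ∈ F → ¬ (v ~ f))
  independentᵇ⁻ []      F h = (λ ()) , λ ()
  independentᵇ⁻ (w ∷ L) F h with open-to w F in eq
  independentᵇ⁻ (w ∷ L) F h | true =
    let hL , hF = independentᵇ⁻ L (w ∷ F) h in
    (λ { (here refl) (here refl) → ~-irrefl
       ; (here refl) (there j) → λ p → hF j (here refl) (~-sym p)
       ; (there i) (here refl) → hF i (here refl)
       ; (there i) (there j) → hL i j }) ,
    λ { (here refl) j → all-open-to w F eq j ; (there i) j → hF i (there j) }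

  independentᵇ-elements : ∀ S → does (independent? G S) ≡ independentᵇ (elements id S) []
  independentᵇ-elements S with independentᵇ (elements id S) [] in eq
  ... | true  = dec-true (independent? G S) λ u v u∈ v∈ →
                  proj₁ (independentᵇ⁻ (elements id S) [] eq) (elements⁺ id u∈) (elements⁺ id v∈)
  ... | false = dec-false (independent? G S) λ ind → contradiction
    (trans (sym eq) (independentᵇ⁺ (elements id S) [] (pairs ind) λ _ ())) λ ()
    where
    pairs : Independent G S → ∀ {u v} → u ∈ elements id S → v ∈ elements id S → ¬ (u ~ v)
    pairs ind i j with elements⁻ id S i | elements⁻ id S j
    ... | u , u∈ , refl | v , v∈ , refl = ind u v u∈ v∈

  module _ (r : ℚ) where

    -- `subsets` branches on the first vertex exactly as Z does, with F collecting the vertices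
    -- already chosen, so the two recursions agree term by term.
    sum-subsets : ∀ k (φ : Fin k → Fin n) F →
      sumᵠ (λ S → indicator (independentᵇ (elements φ S) F) * pow r ∣ S ∣ˢ) (subsets k) ≡ Z r (tabulate φ) F
    sum-subsets zero    φ F = refl
    sum-subsets (suc k) φ F = trans
      (sumᵠ-++ f (map (outside ∷_) (subsets k)) (map (inside ∷_) (subsets k)))
      (cong₂ _+_ (trans (sumᵠ-map f (outside ∷_) (subsets k)) (sum-subsets k (φ ∘ suc) F))
        (trans (sumᵠ-map f (inside ∷_) (subsets k)) (trans (sumᵠ-cong (subsets k) factor)
          (trans (sumᵠ-* (weight r (open-to (φ zero) F)) f₁ (subsets k))
            (cong (weight r (open-to (φ zero) F) *_) (sum-subsets k (φ ∘ suc) (φ zero ∷ F)))))))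
      where
      f : Subset (suc k) → ℚ
      f S = indicator (independentᵇ (elements φ S) F) * pow r ∣ S ∣ˢ
      f₁ : Subset k → ℚ
      f₁ S = indicator (independentᵇ (elements (φ ∘ suc) S) (φ zero ∷ F)) * pow r ∣ S ∣ˢ
      factor : ∀ S → f (inside ∷ S) ≡ weight r (open-to (φ zero) F) * f₁ S
      factor S with open-to (φ zero) F
      ... | true  = solve 3 (λ i r p → i :* (r :* p) := r :* (i :* p)) refl
                      (indicator (independentᵇ (elements (φ ∘ suc) S) (φ zero ∷ F))) r (pow r ∣ S ∣ˢ)
      ... | false = trans (ℚₚ.*-zeroˡ (r * pow r ∣ S ∣ˢ)) (sym (ℚₚ.*-zeroˡ (f₁ S)))

  -- Exact at every index of the Cauchy sequence, so that statements about the real number `I G x`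
  -- turn into statements about rational values of Z.
  seq-I : ∀ x m → seq (I G x) m ≡ Z (seq x m) (allFin n) []
  seq-I x m = trans (seq-∑ (λ k → fromℕ (i[ G ] k) Defs.* x Defs.^ k) m (upTo (suc n)))
    (trans (sumᵠ-cong (upTo (suc n)) (λ k → cong (fromℕᵠ (i[ G ] k) *_) (seq-^ x k m)))
      (trans (sum-by-size (independent? G) ∣_∣ˢ ∣p∣≤n (seq x m) (subsets n))
        (trans (sumᵠ-cong (subsets n) (λ S → cong (λ b → indicator b * pow (seq x m) ∣ S ∣ˢ) (independentᵇ-elements S)))
          (sum-subsets (seq x m) n id []))))

-- Locating ξ(G)

unique-↭ : ∀ {A : Set} {X Y : List A} → Unique X → Unique Y →
  (∀ {v} → v ∈ X → v ∈ Y) → (∀ {v} → v ∈ Y → v ∈ X) → X ↭ Y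
unique-↭ X! Y! f g = ∼bag⇒↭ (unique∧set⇒bag X! Y! (mk⇔ f g))

unique-resp-↭ : ∀ {A : Set} {X Y : List A} → X ↭ Y → Unique X → Unique Y
unique-resp-↭ refl u = u
unique-resp-↭ (prep x p) (a ∷ u) = All-resp-↭ p a ∷ unique-resp-↭ p u
unique-resp-↭ (swap x y p) ((x≢y ∷ a) ∷ b ∷ u) =
  ((x≢y ∘ sym) ∷ All-resp-↭ p b) ∷ All-resp-↭ p a ∷ unique-resp-↭ p u
unique-resp-↭ (_↭_.trans p p′) u = unique-resp-↭ p′ (unique-resp-↭ p u)

AllSublists : ∀ {A : Set} → (List A → Set) → List A → Set
AllSublists P []      = P []
AllSublists P (v ∷ L) = AllSublists P L × AllSublists (P ∘ (v ∷_)) L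

allSublists-filter : ∀ {A : Set} {P : List A → Set} {Q : A → Set} (Q? : ∀ a → Dec (Q a)) L →
  AllSublists P L → P (filter Q? L)
allSublists-filter Q? []      h = h
allSublists-filter Q? (v ∷ L) (h , h′) with does (Q? v)
... | true  = allSublists-filter Q? L h′
... | false = allSublists-filter Q? L h

-- The failing sublist H comes with its complement K, whose vertices are put back when the value for
-- the whole graph is estimated.
allSublists? : ∀ {A : Set} {P : List A → Set} (P? : ∀ L → Dec (P L)) L →
  AllSublists P L ⊎ ∃[ K ] ∃[ H ] (¬ P H × K ++ H ↭ L)
allSublists? P? [] with P? []
... | yes p = inj₁ p
... | no ¬p = inj₂ ([] , [] , ¬p , ↭-refl)
allSublists? P? (v ∷ L) with allSublists? P? L | allSublists? (P? ∘ (v ∷_)) L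
... | inj₁ h | inj₁ h′ = inj₁ (h , h′)
... | inj₂ (K , H , ¬p , e) | _ = inj₂ (v ∷ K , H , ¬p , ↭-prep v e)
... | inj₁ _ | inj₂ (K , H , ¬p , e) = inj₂ (K , v ∷ H , ¬p , ↭-trans (shift v K H) (↭-prep v e))

∣p∣≤⇒ : ∀ {p B} → ∣ p ∣ ≤ B → p ≤ B × - B ≤ p
∣p∣≤⇒ {p} {B} h with ℚₚ.∣p∣≡p∨∣p∣≡-p p
... | inj₁ e = subst (_≤ B) e h , ℚₚ.≤-trans (ℚₚ.neg-antimono-≤ (ℚₚ.≤-trans (ℚₚ.0≤∣p∣ p) h)) (ℚₚ.∣p∣≡p⇒0≤p e)
... | inj₂ e = ℚₚ.≤-trans (subst (_≤ 0ℚ) (neg-involutive p)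
                   (ℚₚ.neg-antimono-≤ (subst (0ℚ ≤_) e (ℚₚ.0≤∣p∣ p)))) (ℚₚ.≤-trans (ℚₚ.0≤∣p∣ p) h)
             , subst (- B ≤_) (neg-involutive p) (ℚₚ.neg-antimono-≤ (subst (_≤ B) e h))

⇒∣p∣≤ : ∀ {p B} → p ≤ B → - B ≤ p → ∣ p ∣ ≤ B
⇒∣p∣≤ {p} {B} h h′ with ℚₚ.∣p∣≡p∨∣p∣≡-p p
... | inj₁ e = subst (_≤ B) (sym e) h
... | inj₂ e = subst (_≤ B) (sym e) (subst (- p ≤_) (neg-involutive B) (ℚₚ.neg-antimono-≤ h′))

∣∣-nonPos : ∀ {p} → p ≤ 0ℚ → ∣ p ∣ ≡ - p
∣∣-nonPos {p} h = trans (sym (ℚₚ.∣-p∣≡∣p∣ p)) (ℚₚ.0≤p⇒∣p∣≡p (0≤- h))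

*-mono-≤ : ∀ {p q r s} → 0ℚ ≤ p → 0ℚ ≤ s → p ≤ q → r ≤ s → p * r ≤ q * s
*-mono-≤ {p} {q} {r} {s} hp hs p≤q r≤s = ℚₚ.≤-trans (*-monoˡ-≤ hp r≤s)
  (subst₂ _≤_ (ℚₚ.*-comm s p) (ℚₚ.*-comm s q) (*-monoˡ-≤ hs p≤q))

fromℕᵠ-nonNeg : ∀ m → 0ℚ ≤ fromℕᵠ m
fromℕᵠ-nonNeg zero    = ℚₚ.≤-refl
fromℕᵠ-nonNeg (suc m) = subst (0ℚ ≤_) (sym (fromℕᵠ-suc m)) (0≤-+ 0≤1 (fromℕᵠ-nonNeg m))

fromℕᵠ-mono : ∀ {m k} → m ℕ.≤ k → fromℕᵠ m ≤ fromℕᵠ k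
fromℕᵠ-mono {k = k} z≤n = fromℕᵠ-nonNeg k
fromℕᵠ-mono {suc m} {suc k} (s≤s h) = subst₂ _≤_ (sym (fromℕᵠ-suc m)) (sym (fromℕᵠ-suc k))
  (ℚₚ.+-monoʳ-≤ 1ℚ (fromℕᵠ-mono h))

pow-nonNeg : ∀ {r} k → 0ℚ ≤ r → 0ℚ ≤ pow r k
pow-nonNeg zero    h = 0≤1
pow-nonNeg (suc k) h = 0≤-* h (pow-nonNeg k h)

0≤½ : 0ℚ ≤ ½
0≤½ = ℚₚ.<⇒≤ (ℚₚ.positive⁻¹ ½)

½^k≤1 : ∀ k → pow ½ k ≤ 1ℚ
½^k≤1 zero    = ℚₚ.≤-refl
½^k≤1 (suc k) = ℚₚ.≤-trans (*-monoˡ-≤ 0≤½ (½^k≤1 k)) (0≤⇒≤ 0≤½)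

-- The bound for k + 1 is the average of `½^k≤1` and the bound for k. Together with `archimedean` it
-- shows that the powers of ½ vanish.
k½^k≤1 : ∀ k → fromℕᵠ k * pow ½ k ≤ 1ℚ
k½^k≤1 zero    = 0≤1
k½^k≤1 (suc k) = by-difference (½ * (1ℚ - pow ½ k) + ½ * (1ℚ - fromℕᵠ k * pow ½ k))
  (0≤-+ (0≤-* 0≤½ (≤⇒0≤ (½^k≤1 k))) (0≤-* 0≤½ (≤⇒0≤ (k½^k≤1 k))))
  (trans (solve 2 (λ p k → con ½ :* (con 1ℚ :- p) :+ con ½ :* (con 1ℚ :- k :* p)
                    := con 1ℚ :- (con 1ℚ :+ k) :* (con ½ :* p)) refl (pow ½ k) (fromℕᵠ k))
         (cong (λ t → 1ℚ - t * pow ½ (suc k)) (sym (fromℕᵠ-suc k))))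

divide : ∀ ε D → 0ℚ < ε → 0ℚ < D → Σ[ δ ∈ ℚ ] (0ℚ < δ × D * δ ≡ ε)
divide ε D 0<ε 0<D = ε * 1/D , 0<-* 0<ε (ℚₚ.positive⁻¹ 1/D {{ℚₚ.1/pos⇒pos D}}) ,
  trans (solve 3 (λ d e i → d :* (e :* i) := e :* (d :* i)) refl D ε 1/D)
    (trans (cong (ε *_) (ℚₚ.*-inverseʳ D {{ℚₚ.pos⇒nonZero D}})) (ℚₚ.*-identityʳ ε))
  where
  instance
    D-pos : Positive D
    D-pos = positive 0<D
  1/D : ℚ
  1/D = (1/ D) {{ℚₚ.pos⇒nonZero D}}

½^-vanishes : ∀ w ε → 0ℚ ≤ w → 0ℚ < ε → ∃[ N ] (∀ k → N ℕ.≤ k → w * pow ½ k < ε)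
½^-vanishes w ε 0≤w 0<ε = N , bound
  where
  0<1+w : 0ℚ < 1ℚ + w
  0<1+w = ℚₚ.<-≤-trans 0<1 (by-difference w 0≤w (solve 1 (λ w → w := con 1ℚ :+ w :- con 1ℚ) refl w))
  -- Dividing by 1 + w instead of w keeps the divisor positive when w = 0.
  δ = proj₁ (divide ε (1ℚ + w) 0<ε 0<1+w)
  0<δ = proj₁ (proj₂ (divide ε (1ℚ + w) 0<ε 0<1+w))
  Dδ = proj₂ (proj₂ (divide ε (1ℚ + w) 0<ε 0<1+w))
  N = proj₁ (archimedean δ 0<δ)
  1≤Nδ = proj₂ (archimedean δ 0<δ)
  w<1+w : w < 1ℚ + w
  w<1+w = subst (_< 1ℚ + w) (ℚₚ.+-identityˡ w) (ℚₚ.+-monoˡ-< w 0<1)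
  bound : ∀ k → N ℕ.≤ k → w * pow ½ k < ε
  bound k N≤k = ℚₚ.≤-<-trans
    (ℚₚ.≤-trans (*-monoˡ-≤ 0≤w (ℚₚ.≤-trans (ℚₚ.≤-reflexive (sym (ℚₚ.*-identityˡ (pow ½ k))))
        (*-mono-≤ 0≤1 (pow-nonNeg k 0≤½)
          (ℚₚ.≤-trans 1≤Nδ (*-mono-≤ (fromℕᵠ-nonNeg N) (ℚₚ.<⇒≤ 0<δ) (fromℕᵠ-mono N≤k) ℚₚ.≤-refl)) ℚₚ.≤-refl)))
      (ℚₚ.≤-trans (ℚₚ.≤-reflexive (solve 4 (λ w k d p → w :* (k :* d :* p) := w :* d :* (k :* p)) refl w (fromℕᵠ k) δ (pow ½ k)))
        (ℚₚ.≤-trans (*-monoˡ-≤ (0≤-* 0≤w (ℚₚ.<⇒≤ 0<δ)) (k½^k≤1 k)) (ℚₚ.≤-reflexive (ℚₚ.*-identityʳ (w * δ))))))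
    (subst (w * δ <_) Dδ (ℚₚ.*-monoˡ-<-pos δ {{positive 0<δ}} w<1+w))

module Lipschitz {V : Set} (G : Graph V) where
  open Polynomial G

  private
    weight-bound : ∀ {x B} b → 0ℚ ≤ B → ∣ x ∣ ≤ B → ∣ weight x b ∣ ≤ B
    weight-bound true  hB h = h
    weight-bound false hB h = hB

    weight-diff : ∀ x y b → ∣ weight x b - weight y b ∣ ≤ ∣ x - y ∣
    weight-diff x y true  = ℚₚ.≤-refl
    weight-diff x y false = ℚₚ.0≤∣p∣ (x - y)

  -- `maximum B k` is (1 + B)^k, the polynomial of the edgeless graph with k vertices at B;
  -- `slope B k` is its derivative k (1 + B)^(k - 1).
  maximum : ℚ → ℕ → ℚ
  maximum B zero    = 1ℚ
  maximum B (suc k) = maximum B k + B * maximum B k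

  slope : ℚ → ℕ → ℚ
  slope B zero    = 0ℚ
  slope B (suc k) = slope B k + (B * slope B k + maximum B k)

  module _ {B : ℚ} (0≤B : 0ℚ ≤ B) where

    maximum-nonNeg : ∀ k → 0ℚ ≤ maximum B k
    maximum-nonNeg zero    = 0≤1
    maximum-nonNeg (suc k) = 0≤-+ (maximum-nonNeg k) (0≤-* 0≤B (maximum-nonNeg k))

    slope-nonNeg : ∀ k → 0ℚ ≤ slope B k
    slope-nonNeg zero    = ℚₚ.≤-refl
    slope-nonNeg (suc k) = 0≤-+ (slope-nonNeg k) (0≤-+ (0≤-* 0≤B (slope-nonNeg k)) (maximum-nonNeg k))

    slope-mono : ∀ {j k} → j ℕ.≤ k → slope B j ≤ slope B k
    slope-mono {k = k} z≤n = slope-nonNeg k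
    slope-mono {suc j} {suc k} (s≤s h) = ℚₚ.+-mono-≤ (slope-mono h) (ℚₚ.+-mono-≤ (*-monoˡ-≤ 0≤B (slope-mono h)) (maximum-mono h))
      where
      maximum-mono : ∀ {j k} → j ℕ.≤ k → maximum B j ≤ maximum B k
      maximum-mono {k = zero}  z≤n = ℚₚ.≤-refl
      maximum-mono {k = suc k} z≤n = ℚₚ.≤-trans (maximum-mono {k = k} z≤n)
        (by-difference (B * maximum B k) (0≤-* 0≤B (maximum-nonNeg k))
          (solve 2 (λ m b → b := m :+ b :- m) refl (maximum B k) (B * maximum B k)))
      maximum-mono (s≤s h) = ℚₚ.+-mono-≤ (maximum-mono h) (*-monoˡ-≤ 0≤B (maximum-mono h))

    Z-bound : ∀ {x} → ∣ x ∣ ≤ B → ∀ L F → ∣ Z x L F ∣ ≤ maximum B (length L)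
    Z-bound h []      F = ℚₚ.≤-refl
    Z-bound {x} h (v ∷ L) F = ℚₚ.≤-trans (ℚₚ.∣p+q∣≤∣p∣+∣q∣ (Z x L F) (w * Z x L (v ∷ F)))
      (ℚₚ.+-mono-≤ (Z-bound h L F) (ℚₚ.≤-trans (ℚₚ.≤-reflexive (ℚₚ.∣p*q∣≡∣p∣*∣q∣ w (Z x L (v ∷ F))))
        (*-mono-≤ (ℚₚ.0≤∣p∣ w) (maximum-nonNeg (length L)) (weight-bound (open-to v F) 0≤B h) (Z-bound h L (v ∷ F)))))
      where w = weight x (open-to v F)

    Z-lipschitz : ∀ {x y} → ∣ x ∣ ≤ B → ∣ y ∣ ≤ B → ∀ L F → ∣ Z x L F - Z y L F ∣ ≤ slope B (length L) * ∣ x - y ∣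
    Z-lipschitz {x} {y} hx hy []      F = ℚₚ.≤-reflexive (sym (ℚₚ.*-zeroˡ ∣ x - y ∣))
    Z-lipschitz {x} {y} hx hy (v ∷ L) F = begin
      ∣ (a + w * c) - (b + u * d) ∣
        ≡⟨ cong ∣_∣ (solve 6 (λ a b c d w u → (a :+ w :* c) :- (b :+ u :* d)
                       := (a :- b) :+ (w :* (c :- d) :+ (w :- u) :* d)) refl a b c d w u) ⟩
      ∣ (a - b) + (w * (c - d) + (w - u) * d) ∣
        ≤⟨ ℚₚ.≤-trans (ℚₚ.∣p+q∣≤∣p∣+∣q∣ (a - b) (w * (c - d) + (w - u) * d))
             (ℚₚ.+-monoʳ-≤ ∣ a - b ∣ (ℚₚ.∣p+q∣≤∣p∣+∣q∣ (w * (c - d)) ((w - u) * d))) ⟩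
      ∣ a - b ∣ + (∣ w * (c - d) ∣ + ∣ (w - u) * d ∣)
        ≡⟨ cong (∣ a - b ∣ +_) (cong₂ _+_ (ℚₚ.∣p*q∣≡∣p∣*∣q∣ w (c - d)) (ℚₚ.∣p*q∣≡∣p∣*∣q∣ (w - u) d)) ⟩
      ∣ a - b ∣ + (∣ w ∣ * ∣ c - d ∣ + ∣ w - u ∣ * ∣ d ∣)
        ≤⟨ ℚₚ.+-mono-≤ (Z-lipschitz hx hy L F) (ℚₚ.+-mono-≤
             (*-mono-≤ (ℚₚ.0≤∣p∣ w) (0≤-* (slope-nonNeg (length L)) (ℚₚ.0≤∣p∣ (x - y)))
               (weight-bound (open-to v F) 0≤B hx) (Z-lipschitz hx hy L (v ∷ F)))
             (*-mono-≤ (ℚₚ.0≤∣p∣ (w - u)) (maximum-nonNeg (length L)) (weight-diff x y (open-to v F)) (Z-bound hy L (v ∷ F)))) ⟩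
      s * e + (B * (s * e) + e * m)
        ≡⟨ solve 4 (λ s e b m → s :* e :+ (b :* (s :* e) :+ e :* m) := (s :+ (b :* s :+ m)) :* e) refl s e B m ⟩
      slope B (suc (length L)) * e ∎
      where
      open ℚₚ.≤-Reasoning
      a = Z x L F
      b = Z y L F
      c = Z x L (v ∷ F)
      d = Z y L (v ∷ F)
      w = weight x (open-to v F)
      u = weight y (open-to v F)
      s = slope B (length L)
      m = maximum B (length L)
      e = ∣ x - y ∣

module Region {n : ℕ} (G : Graph (Fin n)) where
  open Polynomial G
  open Lipschitz G

  private
    V : List (Fin n)
    V = allFin n

  Positive-at : ℚ → Set
  Positive-at r = AllSublists (λ L → 0ℚ < Z r L []) V

  positive-at? : ∀ r → Positive-at r ⊎ ∃[ K ] ∃[ H ] (¬ (0ℚ < Z r H []) × K ++ H ↭ V)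
  positive-at? r = allSublists? (λ L → 0ℚ ℚₚ.<? Z r L []) V

  -- `Positive-at` speaks of sublists of `allFin n` only. A duplicate-free list is a permutation of
  -- such a sublist, and `Z-restrict` removes F.
  Z-positive : ∀ {r} → Positive-at r → ∀ {L} → Unique L → ∀ F → 0ℚ < Z r L F
  Z-positive {r} pos {L} L! F = subst (0ℚ <_) (sym (trans (Z-restrict r L [] F) (Z-↭ r [] M↭)))
    (allSublists-filter (λ v → v ∈? M) V pos)
    where
    open import Data.List.Membership.DecPropositional (Finₚ._≟_ {n}) using (_∈?_)
    M = filterᵇ (λ v → open-to v F) L
    M↭ : M ↭ filter (λ v → v ∈? M) V
    M↭ = unique-↭ (Uniqueₚ.filter⁺ (λ v → T? (open-to v F)) L!) (Uniqueₚ.filter⁺ (λ v → v ∈? M) (Uniqueₚ.allFin⁺ n))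
      (λ {v} i → ∈-filter⁺ (λ v → v ∈? M) (∈-allFin v) i) (λ i → proj₂ (∈-filter⁻ (λ v → v ∈? M) {xs = V} i))

  positive-at-0 : Positive-at 0ℚ
  positive-at-0 with positive-at? 0ℚ
  ... | inj₁ h = h
  ... | inj₂ (_ , H , ¬p , _) = contradiction (subst (0ℚ <_) (sym (Z-0 H [])) 0<1) ¬p
    where
    Z-0 : ∀ L F → Z 0ℚ L F ≡ 1ℚ
    Z-0 []      F = refl
    Z-0 (v ∷ L) F with open-to v F
    ... | true  = cong₂ _+_ (Z-0 L F) (ℚₚ.*-zeroˡ (Z 0ℚ L (v ∷ F)))
    ... | false = cong₂ _+_ (Z-0 L F) (ℚₚ.*-zeroˡ (Z 0ℚ L (v ∷ F)))

<⇒≤-+ : ∀ {p q} → p ≤ q → ∀ {r} → 0ℚ ≤ r → p ≤ q + r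
<⇒≤-+ {p} {q} h {r} hr = subst (_≤ q + r) (ℚₚ.+-identityʳ p) (ℚₚ.+-mono-≤ h hr)

halves : ∀ ε → ε * ½ + ε * ½ ≡ ε
halves ε = solve 1 (λ e → e :* con ½ :+ e :* con ½ := e) refl ε

0<½* : ∀ {ε} → 0ℚ < ε → 0ℚ < ε * ½
0<½* h = 0<-* h (ℚₚ.positive⁻¹ ½)

-- If some induced subgraph has a nonpositive polynomial at lo while all of them
-- are positive at the nearby hi, then adding the missing vertices one by one
-- shows that the polynomial of G is at most slightly above 0 at lo.
module Bisection {n : ℕ} (G : Graph (Fin n)) (r : ℚ) (r≤0 : r ≤ 0ℚ) where
  open Polynomial G
  open Lipschitz G
  open Region G

  private
    V : List (Fin n)
    V = allFin n

    B S C : ℚ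
    B = - r
    S = slope B n
    C = fromℕᵠ n * (B * S) + S

    0≤B : 0ℚ ≤ B
    0≤B = 0≤- r≤0

    0≤S : 0ℚ ≤ S
    0≤S = slope-nonNeg 0≤B n

  Fails : ℚ → Set
  Fails s = ∃[ K ] ∃[ H ] (¬ (0ℚ < Z s H []) × K ++ H ↭ V)

  -- The subgraph that fails at `lo` may change from step to step; only the value for G is followed
  -- to the limit.
  record Bracket (k : ℕ) : Set where
    field
      lo hi : ℚ
      r≤lo  : r ≤ lo
      lo≤hi : lo ≤ hi
      hi≤0  : hi ≤ 0ℚ
      fails : Fails lo
      holds : Positive-at hi
      width : hi - lo ≡ B * pow ½ k

  module _ {k : ℕ} (b : Bracket k) where
    open Bracket b

    private
      d : ℚ
      d = hi - lo

      near : ∀ {s} → r ≤ s → s ≤ 0ℚ → ∣ s ∣ ≤ B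
      near h h′ = ℚₚ.≤-trans (ℚₚ.≤-reflexive (∣∣-nonPos h′)) (ℚₚ.neg-antimono-≤ h)

      lo≤0 : lo ≤ 0ℚ
      lo≤0 = ℚₚ.≤-trans lo≤hi hi≤0

      0≤d : 0ℚ ≤ d
      0≤d = ≤⇒0≤ lo≤hi

      -- Every induced subgraph is positive at `hi`, and from `hi` to `lo` its value changes by at
      -- most S * d.
      Z-lo : ∀ L F → Unique L → length L ℕ.≤ n → - (S * d) ≤ Z lo L F
      Z-lo L F L! len = by-difference (S * d - (Z hi L F - Z lo L F) + Z hi L F)
        (0≤-+ (≤⇒0≤ (ℚₚ.≤-trans (proj₁ (∣p∣≤⇒ (Z-lipschitz 0≤B (near (ℚₚ.≤-trans r≤lo lo≤hi) hi≤0) (near r≤lo lo≤0) L F)))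
                (subst (λ e → slope B (length L) * e ≤ S * d) (sym (ℚₚ.0≤p⇒∣p∣≡p 0≤d))
                  (subst₂ _≤_ (ℚₚ.*-comm d _) (ℚₚ.*-comm d S) (*-monoˡ-≤ 0≤d (slope-mono 0≤B len))))))
              (ℚₚ.<⇒≤ (Z-positive holds L! F)))
        (solve 3 (λ e h l → e :- (h :- l) :+ h := l :- (:- e)) refl (S * d) (Z hi L F) (Z lo L F))

      -- Putting v back adds `lo * Z lo L (v ∷ [])`. As -B ≤ lo ≤ 0 and the second factor is at
      -- least -(S * d), each vertex costs at most B * (S * d).
      Z-upper : ∀ K H → Unique (K ++ H) → length (K ++ H) ℕ.≤ n → Z lo H [] ≤ 0ℚ →
        Z lo (K ++ H) [] ≤ fromℕᵠ (length K) * (B * (S * d))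
      Z-upper []      H _ _ h = ℚₚ.≤-trans h (ℚₚ.≤-reflexive (sym (ℚₚ.*-zeroˡ (B * (S * d)))))
      Z-upper (v ∷ K) H (_ ∷ L!) len h = by-difference
        ((fromℕᵠ (length K) * e - Z lo L []) + (B + lo) * (S * d) + (- lo) * (Z lo L (v ∷ []) + S * d))
        (0≤-+ (0≤-+ (≤⇒0≤ (Z-upper K H L! (ℕₚ.≤-trans (ℕₚ.n≤1+n _) len) h))
                    (0≤-* (subst (0ℚ ≤_) (ℚₚ.+-comm lo B) (≤⇒0≤ r≤lo)) (0≤-* 0≤S 0≤d)))
              (0≤-* (0≤- lo≤0) (subst (0ℚ ≤_) (cong (Z lo L (v ∷ []) +_) (neg-involutive (S * d)))
                (≤⇒0≤ (Z-lo L (v ∷ []) L! (ℕₚ.≤-trans (ℕₚ.n≤1+n _) len))))))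
        (trans (solve 6 (λ f b g z lo y → (f :* (b :* g) :- z) :+ (b :+ lo) :* g :+ (:- lo) :* (y :+ g)
                   := (con 1ℚ :+ f) :* (b :* g) :- (z :+ lo :* y)) refl
                 (fromℕᵠ (length K)) B (S * d) (Z lo L []) lo (Z lo L (v ∷ [])))
               (cong (λ f → f * e - (Z lo L [] + lo * Z lo L (v ∷ []))) (sym (fromℕᵠ-suc (length K)))))
        where
        L = K ++ H
        e = B * (S * d)

    Z-near-0 : ∣ Z lo V [] ∣ ≤ C * d
    Z-near-0 = let K , H , ¬pos , K++H↭V = fails in ⇒∣p∣≤
      (ℚₚ.≤-trans (ℚₚ.≤-reflexive (sym (Z-↭ lo [] K++H↭V)))
        (ℚₚ.≤-trans (Z-upper K H (unique-resp-↭ (↭-sym K++H↭V) (Uniqueₚ.allFin⁺ n))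
                       (ℕₚ.≤-reflexive (trans (↭-length K++H↭V) (Listₚ.length-tabulate _))) (ℚₚ.≮⇒≥ ¬pos))
          (by-difference ((fromℕᵠ n - fromℕᵠ (length K)) * (B * (S * d)) + S * d)
            (0≤-+ (0≤-* (≤⇒0≤ (fromℕᵠ-mono (K≤n K H K++H↭V))) (0≤-* 0≤B (0≤-* 0≤S 0≤d))) (0≤-* 0≤S 0≤d))
            (solve 5 (λ n k b s d → (n :- k) :* (b :* (s :* d)) :+ s :* d := (n :* (b :* s) :+ s) :* d :- k :* (b :* (s :* d)))
              refl (fromℕᵠ n) (fromℕᵠ (length K)) B S d))))
      (ℚₚ.≤-trans (by-difference (fromℕᵠ n * (B * S) * d) (0≤-* (0≤-* (fromℕᵠ-nonNeg n) (0≤-* 0≤B 0≤S)) 0≤d)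
          (solve 3 (λ a s d → a :* d := (:- (s :* d)) :- (:- ((a :+ s) :* d))) refl (fromℕᵠ n * (B * S)) S d))
        (Z-lo V [] (Uniqueₚ.allFin⁺ n) (ℕₚ.≤-reflexive (Listₚ.length-tabulate _))))
      where
      K≤n : ∀ K H → K ++ H ↭ V → length K ℕ.≤ n
      K≤n K H p = ℕₚ.≤-trans (ℕₚ.m≤m+n (length K) (length H))
        (ℕₚ.≤-reflexive (trans (sym (Listₚ.length-++ K)) (trans (↭-length p) (Listₚ.length-tabulate _))))

    private
      mid : ℚ
      mid = (lo + hi) * ½

      lo≤mid : lo ≤ mid
      lo≤mid = by-difference (d * ½) (0≤-* 0≤d 0≤½) (solve 2 (λ l h → (h :- l) :* con ½ := (l :+ h) :* con ½ :- l) refl lo hi)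

      mid≤hi : mid ≤ hi
      mid≤hi = by-difference (d * ½) (0≤-* 0≤d 0≤½) (solve 2 (λ l h → (h :- l) :* con ½ := h :- (l :+ h) :* con ½) refl lo hi)

      half-width : d * ½ ≡ B * pow ½ (suc k)
      half-width = trans (cong (_* ½) width) (solve 2 (λ b p → b :* p :* con ½ := b :* (con ½ :* p)) refl B (pow ½ k))

    step : Σ[ b′ ∈ Bracket (suc k) ] (lo ≤ Bracket.lo b′ × Bracket.hi b′ ≤ hi)
    step with positive-at? mid
    ... | inj₁ pos = record
          { lo = lo ; hi = mid ; r≤lo = r≤lo ; lo≤hi = lo≤mid ; hi≤0 = ℚₚ.≤-trans mid≤hi hi≤0 ; fails = fails ; holds = pos
          ; width = trans (solve 2 (λ l h → (l :+ h) :* con ½ :- l := (h :- l) :* con ½) refl lo hi) half-width }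
        , ℚₚ.≤-refl , mid≤hi
    ... | inj₂ bad = record
          { lo = mid ; hi = hi ; r≤lo = ℚₚ.≤-trans r≤lo lo≤mid ; lo≤hi = mid≤hi ; hi≤0 = hi≤0 ; fails = bad ; holds = holds
          ; width = trans (solve 2 (λ l h → h :- (l :+ h) :* con ½ := (h :- l) :* con ½) refl lo hi) half-width }
        , lo≤mid , ℚₚ.≤-refl

  module _ (fails-r : Fails r) where

    bracket : ∀ k → Bracket k
    bracket zero = record
      { lo = r ; hi = 0ℚ ; r≤lo = ℚₚ.≤-refl ; lo≤hi = r≤0 ; hi≤0 = ℚₚ.≤-refl ; fails = fails-r
      ; holds = positive-at-0 ; width = solve 1 (λ r → con 0ℚ :- r := (:- r) :* con 1ℚ) refl r }
    bracket (suc k) = proj₁ (step (bracket k))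

    private
      open Bracket

      nested : ∀ N j → lo (bracket N) ≤ lo (bracket (j ℕ.+ N)) × hi (bracket (j ℕ.+ N)) ≤ hi (bracket N)
      nested N zero    = ℚₚ.≤-refl , ℚₚ.≤-refl
      nested N (suc j) = let a , b = nested N j ; c , d = proj₂ (step (bracket (j ℕ.+ N))) in
        ℚₚ.≤-trans a c , ℚₚ.≤-trans d b

      within : ∀ {N m} → N ℕ.≤ m → lo (bracket N) ≤ lo (bracket m) × lo (bracket m) ≤ hi (bracket N)
      within {N} {m} N≤m = subst (λ j → lo (bracket N) ≤ lo (bracket j) × lo (bracket j) ≤ hi (bracket N)) (ℕₚ.m∸n+n≡m N≤m)
        (proj₁ (nested N (m ℕ.∸ N)) , ℚₚ.≤-trans (lo≤hi (bracket (m ℕ.∸ N ℕ.+ N))) (proj₂ (nested N (m ℕ.∸ N))))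

    -- The left endpoints converge because the brackets are nested and halve in width. They never
    -- drop below r.
    root : ℝ
    root = mkℝ (λ k → lo (bracket k)) λ ε 0<ε →
      let N , small = ½^-vanishes B ε 0≤B 0<ε in
      N , λ m k N≤m N≤k →
        let lₘ , hₘ = within N≤m
            lₖ , hₖ = within N≤k
            l = lo (bracket N)
            h = hi (bracket N)
            a = lo (bracket m)
            b = lo (bracket k)
            bound : ∣ a - b ∣ ≤ h - l
            bound = ⇒∣p∣≤
              (by-difference ((h - a) + (b - l)) (0≤-+ (≤⇒0≤ hₘ) (≤⇒0≤ lₖ))
                (solve 4 (λ h l a b → (h :- a) :+ (b :- l) := (h :- l) :- (a :- b)) refl h l a b))
              (by-difference ((h - b) + (a - l)) (0≤-+ (≤⇒0≤ hₖ) (≤⇒0≤ lₘ))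
                (solve 4 (λ h l a b → (h :- b) :+ (a :- l) := (a :- b) :- (:- (h :- l))) refl h l a b))
        in ℚₚ.≤-<-trans bound (subst (_< ε) (sym (width (bracket N))) (small N ℕₚ.≤-refl))

    r≤root : ∀ k → r ≤ seq root k
    r≤root k = r≤lo (bracket k)

    root-isRoot : Root G root
    root-isRoot ε 0<ε =
      let 0≤C = 0≤-+ (0≤-* (fromℕᵠ-nonNeg n) (0≤-* 0≤B 0≤S)) 0≤S
          N , small = ½^-vanishes (C * B) ε (0≤-* 0≤C 0≤B) 0<ε in
      N , λ k N≤k → ℚₚ.≤-<-trans
        (subst (_≤ C * (hi (bracket k) - lo (bracket k)))
          (cong ∣_∣ (trans (solve 1 (λ z → z := z :- con 0ℚ) refl (Z (lo (bracket k)) V []))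
            (cong (_- 0ℚ) (sym (SubsetSum.seq-I G root k)))))
          (Z-near-0 (bracket k)))
        (subst (_< ε) (trans (ℚₚ.*-assoc C B (pow ½ k)) (cong (C *_) (sym (width (bracket k))))) (small k N≤k))

module _ {n : ℕ} (G : Graph (Fin n)) {ξ : ℝ} (isξ : Isξ G ξ) where
  open Region G

  -- A failure at r would produce a root of I(G, x) not below r, hence above ξ by at least δ,
  -- although ξ is the largest root. The order on reals holds up to an error, here taken as δ / 2.
  positive-above-ξ : ∀ r δ → r ≤ 0ℚ → 0ℚ < δ → ∃[ N ] (∀ k → N ℕ.≤ k → seq ξ k + δ ≤ r) → Positive-at r
  positive-above-ξ r δ r≤0 0<δ (N , above) = [ (λ pos → pos) , (λ bad → contradiction refl (impossible bad)) ]′ (positive-at? r)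
    where
    open Bisection G r r≤0
    half< : δ * ½ < δ
    half< = subst₂ _<_ (ℚₚ.+-identityˡ (δ * ½)) (halves δ) (ℚₚ.+-monoˡ-< (δ * ½) (0<½* 0<δ))
    squeeze : ∀ (b : ℝ) → (∀ k → r ≤ seq b k) → b Defs.≤ ξ → r ≢ r
    squeeze b r≤b b≤ξ _ = ℚₚ.<-irrefl refl (ℚₚ.≤-<-trans (above k (ℕₚ.m≤m⊔n N N′))
      (ℚₚ.≤-<-trans (r≤b k) (ℚₚ.≤-<-trans (below k (ℕₚ.m≤n⊔m N N′)) (ℚₚ.+-monoʳ-< (seq ξ k) half<))))
      where
      N′ = proj₁ (b≤ξ (δ * ½) (0<½* 0<δ))
      below = proj₂ (b≤ξ (δ * ½) (0<½* 0<δ))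
      k = N ℕ.⊔ N′
    impossible : Fails r → r ≢ r
    impossible bad = squeeze (root bad) (r≤root bad) (proj₂ isξ (root bad) (root-isRoot bad))

-- From rational points to real intervals

module _ {m n : ℕ} (H : Graph (Fin m)) (G : Graph (Fin n)) where
  private
    module H = Polynomial H
    module G = Polynomial G

  -- The approximants of x may lie left of ξ or right of 0. Each is moved by at most δ to a rational
  -- point where the comparison applies, and the Lipschitz bounds absorb the displacement.
  ⪯-from-ℚ : (∀ r → r ≤ 0ℚ → Region.Positive-at G r → G.Z r (allFin n) [] ≤ H.Z r (allFin m) []) → H ⪯ G
  ⪯-from-ℚ compare ξ isξ x ξ≤x x≤0 ε 0<ε = N , λ k N≤k →
    subst₂ (λ a b → a ≤ b + ε) (sym (SubsetSum.seq-I G x k)) (sym (SubsetSum.seq-I H x k)) (estimate k N≤k)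
    where
    N₀ = proj₁ (cauchy x 1ℚ 0<1)
    -- One unit allows for the distance of later terms from `seq x N₀`, the other for a shift by δ ≤
    -- 1.
    B : ℚ
    B = ∣ seq x N₀ ∣ + 1ℚ + 1ℚ
    0≤B : 0ℚ ≤ B
    0≤B = <⇒≤-+ (<⇒≤-+ (ℚₚ.0≤∣p∣ (seq x N₀)) 0≤1) 0≤1
    Sᴳ = Lipschitz.slope G B (length (allFin n))
    Sᴴ = Lipschitz.slope H B (length (allFin m))
    C : ℚ
    C = Sᴳ + Sᴴ
    0≤C : 0ℚ ≤ C
    0≤C = 0≤-+ (Lipschitz.slope-nonNeg G 0≤B (length (allFin n))) (Lipschitz.slope-nonNeg H 0≤B (length (allFin m)))
    -- With δ = ε / D, the summand C gives C * δ ≤ ε and the summand ε gives δ ≤ 1.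
    D : ℚ
    D = C + ε + 1ℚ
    0<D : 0ℚ < D
    0<D = ℚₚ.<-≤-trans 0<1 (by-difference (C + ε) (0≤-+ 0≤C (ℚₚ.<⇒≤ 0<ε))
      (solve 2 (λ c e → c :+ e := c :+ e :+ con 1ℚ :- con 1ℚ) refl C ε))
    δ = proj₁ (divide ε D 0<ε 0<D)
    0<δ = proj₁ (proj₂ (divide ε D 0<ε 0<D))
    Dδ≡ε : D * δ ≡ ε
    Dδ≡ε = proj₂ (proj₂ (divide ε D 0<ε 0<D))
    0≤δ = ℚₚ.<⇒≤ 0<δ
    δ≤1 : δ ≤ 1ℚ
    δ≤1 = *-cancelˡ-≤ 0<D (ℚₚ.≤-trans (ℚₚ.≤-reflexive Dδ≡ε) (by-difference (C + 1ℚ)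
      (0≤-+ 0≤C 0≤1) (solve 2 (λ c e → c :+ con 1ℚ := (c :+ e :+ con 1ℚ) :* con 1ℚ :- e) refl C ε)))
    Cδ≤ε : C * δ ≤ ε
    Cδ≤ε = subst (C * δ ≤_) Dδ≡ε (by-difference ((ε + 1ℚ) * δ) (0≤-* (<⇒≤-+ (ℚₚ.<⇒≤ 0<ε) 0≤1) 0≤δ)
      (solve 3 (λ c e d → (e :+ con 1ℚ) :* d := (c :+ e :+ con 1ℚ) :* d :- c :* d) refl C ε δ))
    -- A quarter of δ goes to ξ ≤ x, one to the Cauchy estimate for x, and one is the margin
    -- required above ξ.
    δ/4 = δ * ½ * ½
    0<δ/4 : 0ℚ < δ/4
    0<δ/4 = 0<½* (0<½* 0<δ)
    ξ≤ = ξ≤x δ/4 0<δ/4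
    x≤ = x≤0 δ 0<δ
    xc = cauchy x δ/4 0<δ/4
    N₁ = proj₁ ξ≤
    N₂ = proj₁ x≤
    N₃ = proj₁ xc
    N = (N₀ ℕ.⊔ N₁) ℕ.⊔ (N₂ ℕ.⊔ N₃)

    estimate : ∀ k → N ℕ.≤ k → G.Z (seq x k) (allFin n) [] ≤ H.Z (seq x k) (allFin m) [] + ε
    -- If a + δ ≥ 0, then a is within δ of 0, and 0 is used as the comparison point instead of a +
    -- δ.
    estimate k N≤k = by-cases (ℚₚ.≤-total (a + δ) 0ℚ)
      where
      a = seq x k
      le₀ : N₀ ℕ.≤ k
      le₀ = ℕₚ.≤-trans (ℕₚ.≤-trans (ℕₚ.m≤m⊔n N₀ N₁) (ℕₚ.m≤m⊔n _ (N₂ ℕ.⊔ N₃))) N≤k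
      le₂ : N₂ ℕ.≤ k
      le₂ = ℕₚ.≤-trans (ℕₚ.≤-trans (ℕₚ.m≤m⊔n N₂ N₃) (ℕₚ.m≤n⊔m (N₀ ℕ.⊔ N₁) _)) N≤k
      le₃ : N₃ ℕ.≤ k
      le₃ = ℕₚ.≤-trans (ℕₚ.≤-trans (ℕₚ.m≤n⊔m N₂ N₃) (ℕₚ.m≤n⊔m (N₀ ℕ.⊔ N₁) _)) N≤k

      ∣a∣≤ : ∣ a ∣ ≤ ∣ seq x N₀ ∣ + 1ℚ
      ∣a∣≤ = ℚₚ.≤-trans (ℚₚ.≤-reflexive (cong ∣_∣ (solve 2 (λ a b → a := b :+ (a :- b)) refl a (seq x N₀))))
        (ℚₚ.≤-trans (ℚₚ.∣p+q∣≤∣p∣+∣q∣ (seq x N₀) (a - seq x N₀)) (ℚₚ.+-monoʳ-≤ ∣ seq x N₀ ∣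
          (ℚₚ.<⇒≤ (proj₂ (cauchy x 1ℚ 0<1) k N₀ le₀ ℕₚ.≤-refl))))

      a-near : ∣ a ∣ ≤ B
      a-near = <⇒≤-+ ∣a∣≤ 0≤1

      move : ∀ r → ∣ r ∣ ≤ B → ∣ a - r ∣ ≤ δ → r ≤ 0ℚ → Region.Positive-at G r → G.Z a (allFin n) [] ≤ H.Z a (allFin m) [] + ε
      move r r-near a-r r≤0 pos = ℚₚ.≤-trans
        (by-difference ((Sᴳ * δ - (ga - gr)) + (hr - gr) + (ha - hr - - (Sᴴ * δ)))
          (0≤-+ (0≤-+ (≤⇒0≤ gdiff) (≤⇒0≤ (compare r r≤0 pos))) (≤⇒0≤ hdiff))
          (solve 7 (λ sg sh d ga gr ha hr → (sg :* d :- (ga :- gr)) :+ (hr :- gr) :+ (ha :- hr :- (:- (sh :* d)))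
                      := (ha :+ (sg :+ sh) :* d) :- ga) refl Sᴳ Sᴴ δ ga gr ha hr))
        (ℚₚ.+-monoʳ-≤ ha Cδ≤ε)
        where
        ga = G.Z a (allFin n) []
        gr = G.Z r (allFin n) []
        ha = H.Z a (allFin m) []
        hr = H.Z r (allFin m) []
        gdiff : ga - gr ≤ Sᴳ * δ
        gdiff = proj₁ (∣p∣≤⇒ (ℚₚ.≤-trans (Lipschitz.Z-lipschitz G 0≤B a-near r-near (allFin n) [])
          (*-monoˡ-≤ (Lipschitz.slope-nonNeg G 0≤B (length (allFin n))) a-r)))
        hdiff : - (Sᴴ * δ) ≤ ha - hr
        hdiff = proj₂ (∣p∣≤⇒ (ℚₚ.≤-trans (Lipschitz.Z-lipschitz H 0≤B a-near r-near (allFin m) [])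
          (*-monoˡ-≤ (Lipschitz.slope-nonNeg H 0≤B (length (allFin m))) a-r)))

      by-cases : (a + δ ≤ 0ℚ) ⊎ (0ℚ ≤ a + δ) → G.Z a (allFin n) [] ≤ H.Z a (allFin m) [] + ε
      by-cases (inj₁ h) = move (a + δ)
        (ℚₚ.≤-trans (ℚₚ.∣p+q∣≤∣p∣+∣q∣ a δ) (ℚₚ.+-mono-≤ ∣a∣≤ (subst (_≤ 1ℚ) (sym (ℚₚ.0≤p⇒∣p∣≡p 0≤δ)) δ≤1)))
        (ℚₚ.≤-reflexive (trans (cong ∣_∣ (solve 2 (λ a d → a :- (a :+ d) := :- d) refl a δ))
          (trans (ℚₚ.∣-p∣≡∣p∣ δ) (ℚₚ.0≤p⇒∣p∣≡p 0≤δ))))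
        h
        (positive-above-ξ G isξ (a + δ) δ/4 h 0<δ/4 (N₁ ℕ.⊔ N₃ , λ j N≤j →
          by-difference ((seq x j + δ/4 - seq ξ j) + (δ/4 - (seq x j - a)) + δ/4)
            (0≤-+ (0≤-+ (≤⇒0≤ (proj₂ ξ≤ j (ℕₚ.≤-trans (ℕₚ.m≤m⊔n N₁ N₃) N≤j)))
                        (≤⇒0≤ (proj₁ (∣p∣≤⇒ (ℚₚ.<⇒≤ (proj₂ xc j k (ℕₚ.≤-trans (ℕₚ.m≤n⊔m N₁ N₃) N≤j) le₃))))))
                  (ℚₚ.<⇒≤ 0<δ/4))
            (solve 4 (λ xj xi a d → (xj :+ d :* con ½ :* con ½ :- xi) :+ (d :* con ½ :* con ½ :- (xj :- a)) :+ d :* con ½ :* con ½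
                        := a :+ d :- (xi :+ d :* con ½ :* con ½)) refl (seq x j) (seq ξ j) a δ)))
      by-cases (inj₂ h) = move 0ℚ 0≤B
        (⇒∣p∣≤ (ℚₚ.≤-trans (ℚₚ.≤-reflexive (solve 1 (λ a → a :- con 0ℚ := a) refl a))
                 (subst (a ≤_) (ℚₚ.+-identityˡ δ) (proj₂ x≤ k le₂)))
               (by-difference (a + δ) h (solve 2 (λ a d → a :+ d := a :- con 0ℚ :- (:- d)) refl a δ)))
        ℚₚ.≤-refl (Region.positive-at-0 G)

-- Exchanging independent sets in well-covered graphs

unique-∷ : ∀ {A : Set} {a : A} {L} → a ∉ L → Unique L → Unique (a ∷ L)
unique-∷ a∉L L! = All.tabulate (λ { i refl → a∉L i }) ∷ L!

unique-∉ : ∀ {A : Set} {a : A} {L} → Unique (a ∷ L) → a ∉ L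
unique-∉ (p ∷ _) i = All.lookup p i refl

unique-++ : ∀ {A : Set} {L M : List A} → Unique L → Unique M → (∀ {a} → a ∈ L → a ∉ M) → Unique (L ++ M)
unique-++ L! M! h = Uniqueₚ.++⁺ L! M! (λ (i , j) → h i j)

unique-++⁻ : ∀ {A : Set} (L : List A) {M} → Unique (L ++ M) → Unique M × (∀ {a} → a ∈ L → a ∉ M)
unique-++⁻ []      M! = M! , λ ()
unique-++⁻ (b ∷ L) (p ∷ u) = proj₁ (unique-++⁻ L u) ,
  λ { (here refl) j → unique-∉ (p ∷ u) (∈-++⁺ʳ L j) ; (there i) → proj₂ (unique-++⁻ L u) i }

length-elements : ∀ {k} {V : Set} (φ : Fin k → V) S → length (elements φ S) ≡ ∣ S ∣ˢ
length-elements φ []            = refl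
length-elements φ (outside ∷ S) = length-elements (φ ∘ suc) S
length-elements φ (inside ∷ S)  = cong suc (length-elements (φ ∘ suc) S)

elements-unique : ∀ {k} {V : Set} (φ : Fin k → V) → (∀ {i j} → φ i ≡ φ j → i ≡ j) → ∀ S → Unique (elements φ S)
elements-unique φ inj []            = []
elements-unique φ inj (outside ∷ S) = elements-unique (φ ∘ suc) (Finₚ.suc-injective ∘ inj) S
elements-unique φ inj (inside ∷ S)  = unique-∷ fresh (elements-unique (φ ∘ suc) (Finₚ.suc-injective ∘ inj) S)
  where
  fresh : φ zero ∉ elements (φ ∘ suc) S
  fresh h with elements⁻ (φ ∘ suc) S h
  ... | i , _ , e with inj e
  ... | ()

module IndependentLists {n : ℕ} (G : Graph (Fin n)) where
  open Graph G
  open import Data.List.Membership.DecPropositional (Finₚ._≟_ {n}) using (_∈?_) public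

  V : Set
  V = Fin n

  IndependentList : List V → Set
  IndependentList J = ∀ {u v} → u ∈ J → v ∈ J → ¬ (u ~ v)

  Covers : List V → V → Set
  Covers J u = ∃[ j ] (j ∈ J × (u ≡ j ⊎ u ~ j))

  covers-self : ∀ {J u} → u ∈ J → Covers J u
  covers-self i = _ , i , inj₁ refl

  covers-⊆ : ∀ {J J′ u} → (∀ {v} → v ∈ J → v ∈ J′) → Covers J u → Covers J′ u
  covers-⊆ h (j , i , p) = j , h i , p

  covers? : ∀ J u → Dec (Covers J u)
  covers? J u = map′ find (λ (j , i , q) → lose i q) (Any.any? (λ j → (u Finₚ.≟ j) ⊎-dec (u ~? j)) J)

  independent-++ : ∀ {L M} → IndependentList L → IndependentList M → (∀ {a b} → a ∈ L → b ∈ M → ¬ (a ~ b)) →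
    IndependentList (L ++ M)
  independent-++ {L} {M} iL iM h i j with ∈-++⁻ L i | ∈-++⁻ L j
  ... | inj₁ i | inj₁ j = iL i j
  ... | inj₁ i | inj₂ j = h i j
  ... | inj₂ i | inj₁ j = λ p → h j i (~-sym p)
  ... | inj₂ i | inj₂ j = iM i j

  independent-∷ : ∀ {v L} → IndependentList L → (∀ {a} → a ∈ L → ¬ (a ~ v)) → IndependentList (v ∷ L)
  independent-∷ iL h (here refl) (here refl) = ~-irrefl
  independent-∷ iL h (here refl) (there j)   = λ p → h j (~-sym p)
  independent-∷ iL h (there i)   (here refl) = h i
  independent-∷ iL h (there i)   (there j)   = iL i j

  record Extension (L J : List V) : Set where
    field
      K           : List V
      unique      : Unique (K ++ J)
      independent : IndependentList (K ++ J)
      covers      : ∀ {u} → u ∈ L → Covers (K ++ J) u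

  extend : ∀ L J → Unique J → IndependentList J → Extension L J
  extend []      J J! iJ = record { K = [] ; unique = J! ; independent = iJ ; covers = λ () }
  extend (v ∷ L) J J! iJ with extend L J J! iJ
  ... | E with covers? (Extension.K E ++ J) v
  ... | yes c = record { Extension E ; covers = λ { (here refl) → c ; (there i) → Extension.covers E i } }
  ... | no ¬c = record
    { K           = v ∷ K
    ; unique      = unique-∷ (λ i → ¬c (covers-self i)) unique
    ; independent = independent-∷ independent (λ i p → ¬c (_ , i , inj₂ (~-sym p)))
    ; covers      = λ { (here refl) → covers-self (here refl) ; (there i) → covers-⊆ there (covers i) } }
    where open Extension E

  toSubset : List V → Subset n
  toSubset J = tabulateᵛ (λ v → does (v ∈? J))

  ∈-toSubset⁺ : ∀ {J v} → v ∈ J → v ∈ˢ toSubset J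
  ∈-toSubset⁺ {J} {v} i = Vecₚ.lookup⇒[]= v (toSubset J) (trans (Vecₚ.lookup∘tabulate _ v) (dec-true (v ∈? J) i))

  ∈-toSubset⁻ : ∀ {J v} → v ∈ˢ toSubset J → v ∈ J
  ∈-toSubset⁻ {J} {v} h with v ∈? J | trans (sym (Vecₚ.lookup∘tabulate (λ v → does (v ∈? J)) v)) (Vecₚ.[]=⇒lookup h)
  ... | yes i | _ = i
  ... | no _  | ()

  ∣toSubset∣ : ∀ {J} → Unique J → ∣ toSubset J ∣ˢ ≡ length J
  ∣toSubset∣ {J} J! = trans (sym (length-elements id (toSubset J)))
    (↭-length (unique-↭ (elements-unique id id (toSubset J)) J!
      (λ i → let v , v∈ , e = elements⁻ id (toSubset J) i in subst (_∈ J) (sym e) (∈-toSubset⁻ v∈))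
      (λ i → elements⁺ id (∈-toSubset⁺ i))))

  toSubset-maximal : ∀ {J} → IndependentList J → (∀ u → Covers J u) → MaximalIndependent G (toSubset J)
  toSubset-maximal {J} iJ cJ = (λ u v i j → iJ (∈-toSubset⁻ i) (∈-toSubset⁻ j)) , λ T iT J⊆T {u} u∈T → inJ T iT J⊆T u∈T (cJ u)
    where
    inJ : ∀ T → Independent G T → (∀ {v} → v ∈ˢ toSubset J → v ∈ˢ T) → ∀ {u} → u ∈ˢ T → Covers J u → u ∈ˢ toSubset J
    inJ T iT J⊆T u∈T (j , i , inj₁ refl) = ∈-toSubset⁺ i
    inJ T iT J⊆T u∈T (j , i , inj₂ u~j) = contradiction u~j (iT _ j u∈T (J⊆T (∈-toSubset⁺ i)))

  module _ (wc : WellCovered G) where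

    -- If K ∪ J₂ is maximal independent, then K ∪ J₁ is still independent.
    covered-length-≤ : ∀ {J₁ J₂} → Unique J₁ → IndependentList J₁ → Unique J₂ → IndependentList J₂ →
      (∀ {u} → Covers J₁ u → Covers J₂ u) → length J₁ ℕ.≤ length J₂
    covered-length-≤ {J₁} {J₂} J₁! i₁ J₂! i₂ c = ℕₚ.+-cancelˡ-≤ (length K) (length J₁) (length J₂) (begin
      length K ℕ.+ length J₁                 ≡⟨ sym (Listₚ.length-++ K) ⟩
      length (K ++ J₁)                       ≤⟨ ℕₚ.m≤n+m _ (length K′) ⟩
      length K′ ℕ.+ length (K ++ J₁)         ≡⟨ sym (Listₚ.length-++ K′) ⟩
      length (K′ ++ K ++ J₁)                 ≡⟨ sym (∣toSubset∣ E′.unique) ⟩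
      ∣ toSubset (K′ ++ K ++ J₁) ∣ˢ           ≡⟨ wc _ _ (toSubset-maximal E′.independent (λ u → E′.covers (∈-allFin u)))
                                                    (toSubset-maximal E.independent (λ u → E.covers (∈-allFin u))) ⟩
      ∣ toSubset (K ++ J₂) ∣ˢ                 ≡⟨ ∣toSubset∣ E.unique ⟩
      length (K ++ J₂)                       ≡⟨ Listₚ.length-++ K ⟩
      length K ℕ.+ length J₂                 ∎)
      where
      open ℕₚ.≤-Reasoning
      module E = Extension (extend (allFin n) J₂ J₂! i₂)
      K = E.K
      uncovered : ∀ {k} → k ∈ K → ¬ Covers J₁ k
      uncovered i c₁ with c c₁
      ... | j , j∈ , inj₁ refl = proj₂ (unique-++⁻ K E.unique) i j∈
      ... | j , j∈ , inj₂ k~j = E.independent (∈-++⁺ˡ i) (∈-++⁺ʳ K j∈) k~j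
      K! : ∀ L {M} → Unique (L ++ M) → Unique L
      K! []      _ = []
      K! (l ∷ L) (p ∷ u) = Allₚ.++⁻ˡ L p ∷ K! L u
      module E′ = Extension (extend (allFin n) (K ++ J₁)
        (unique-++ (K! K E.unique) J₁! (λ i j → uncovered i (covers-self j)))
        (independent-++ (λ i j → E.independent (∈-++⁺ˡ i) (∈-++⁺ˡ j)) i₁
          (λ i j p → uncovered i (_ , j , inj₂ p))))
      K′ = E′.K

  -- own v is the root of the hanging tree that contains v.
  record Ownership (R : List V) (own : V → V) : Set where
    field
      own∈     : ∀ x → own x ∈ R
      own-root : ∀ {r} → r ∈ R → own r ≡ r
      own-adj  : ∀ {x y} → x ~ y → own x ≡ own y ⊎ (x ∈ R × y ∈ R)

    adj-root : ∀ {x y} → x ~ y → own x ≢ own y → x ≡ own x × y ≡ own y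
    adj-root p ≢ with own-adj p
    ... | inj₁ e = contradiction e ≢
    ... | inj₂ (x∈ , y∈) = sym (own-root x∈) , sym (own-root y∈)

  -- The trace of an independent set on one hanging tree. The root is exempt from `covers` because a
  -- neighbouring root may dominate it.
  record Part (own : V → V) : Set where
    field
      root        : V
      set         : List V
      unique      : Unique set
      independent : IndependentList set
      owned       : ∀ {v} → v ∈ set → own v ≡ root
      covers      : ∀ {v} → own v ≡ root → v ≢ root → Covers set v

  open Part using (root; set)

  union : ∀ {own} → List (Part own) → List V
  union []       = []
  union (P ∷ Ps) = set P ++ union Ps

  Compatible : ∀ {own} → Part own → Part own → Set
  Compatible P Q = root P ≢ root Q × (root P ∈ set P → root Q ∈ set Q → ¬ (root P ~ root Q))

  union⁺ : ∀ {own} {Ps : List (Part own)} {P v} → P ∈ Ps → v ∈ set P → v ∈ union Ps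
  union⁺ (here refl)         j = ∈-++⁺ˡ j
  union⁺ {Ps = Q ∷ _} (there i) j = ∈-++⁺ʳ (set Q) (union⁺ i j)

  union⁻ : ∀ {own} (Ps : List (Part own)) {v} → v ∈ union Ps → ∃[ P ] (P ∈ Ps × v ∈ set P)
  union⁻ (P ∷ Ps) i with ∈-++⁻ (set P) i
  ... | inj₁ j = P , here refl , j
  ... | inj₂ j = let Q , k , l = union⁻ Ps j in Q , there k , l

  module _ {R : List V} {own : V → V} (O : Ownership R own) where
    open Ownership O

    private
      union-separate : ∀ {P : Part own} {Ps} → All (Compatible P) Ps → ∀ {a b} → a ∈ set P → b ∈ union Ps → a ≢ b × ¬ (a ~ b)
      union-separate {P} {Ps} cs {a} {b} i j with union⁻ Ps j
      ... | Q , k , l = (λ { refl → r≢ (trans (sym ownP) ownQ) }) , λ p →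
              let a≡ , b≡ = adj-root p (λ e → r≢ (trans (sym ownP) (trans e ownQ)))
                  a≡P = trans a≡ ownP
                  b≡Q = trans b≡ ownQ
              in sep (subst (_∈ set P) a≡P i) (subst (_∈ set Q) b≡Q l) (subst₂ _~_ a≡P b≡Q p)
        where
        r≢ = proj₁ (All.lookup cs k)
        sep = proj₂ (All.lookup cs k)
        ownP = Part.owned P i
        ownQ = Part.owned Q l

      union-unique : ∀ {Ps : List (Part own)} → AllPairs Compatible Ps → Unique (union Ps)
      union-unique [] = []
      union-unique {P ∷ Ps} (c ∷ cs) = unique-++ (Part.unique P) (union-unique cs) (λ i j → proj₁ (union-separate {P} {Ps} c i j) refl)

      union-independent : ∀ {Ps : List (Part own)} → AllPairs Compatible Ps → IndependentList (union Ps)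
      union-independent [] ()
      union-independent {P ∷ Ps} (c ∷ cs) = independent-++ (Part.independent P) (union-independent cs)
        (λ i j → proj₂ (union-separate {P} {Ps} c i j))

    -- The non-root vertices of a tree are dominated by whichever part the second family has there.
    -- Inclusion of closed neighbourhoods thus reduces to the roots: each root itself and, if it is
    -- used, the roots next to it.
    parts-length-≤ : WellCovered G → ∀ {Ps Qs : List (Part own)} → AllPairs Compatible Ps → AllPairs Compatible Qs →
      All (λ P → (∃[ Q ] (Q ∈ Qs × root Q ≡ root P)) × Covers (union Qs) (root P)
               × (root P ∈ set P → ∀ {s} → s ∈ R → s ~ root P → Covers (union Qs) s)) Ps →
      length (union Ps) ℕ.≤ length (union Qs)
    parts-length-≤ wc {Ps} {Qs} cP cQ h = covered-length-≤ wc (union-unique cP) (union-independent cP)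
      (union-unique cQ) (union-independent cQ) covered
      where
      same-owner : ∀ {P u} → P ∈ Ps → own u ≡ root P → Covers (union Qs) u
      same-owner {P} {u} i e with All.lookup h i | u Finₚ.≟ root P
      ... | _ , c , _ | yes refl = c
      ... | (Q , k , eq) , _ | no u≢ = covers-⊆ (union⁺ k)
              (Part.covers Q (trans e (sym eq)) (λ u≡ → u≢ (trans u≡ eq)))
      covered : ∀ {u} → Covers (union Ps) u → Covers (union Qs) u
      covered {u} (j , i , near) with union⁻ Ps i
      ... | P , k , l with near
      ... | inj₁ refl = same-owner k (Part.owned P l)
      ... | inj₂ u~j with own-adj u~j
      ... | inj₁ e = same-owner k (trans e (Part.owned P l))
      ... | inj₂ (u∈R , j∈R) = let j≡ = trans (sym (own-root j∈R)) (Part.owned P l) in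
              proj₂ (proj₂ (All.lookup h k)) (subst (_∈ set P) j≡ l) u∈R (subst (u ~_) j≡ u~j)

-- Hanging trees

pow-+ : ∀ s j k → pow s (j ℕ.+ k) ≡ pow s j * pow s k
pow-+ s zero    k = sym (ℚₚ.*-identityˡ _)
pow-+ s (suc j) k = trans (cong (s *_) (pow-+ s j k)) (sym (ℚₚ.*-assoc s _ _))

pow-pos : ∀ {s} k → 0ℚ < s → 0ℚ < pow s k
pow-pos zero    h = 0<1
pow-pos (suc k) h = 0<-* h (pow-pos k h)

module Homogeneous {x y : ℚ} (sy≡x : (1ℚ + x) * y ≡ x) where
  private
    s : ℚ
    s = 1ℚ + x

  stem-value : ∀ p a b → s * (p * a) + x * (p * b) ≡ s * p * (a + y * b)
  stem-value p a b = trans (cong (λ t → s * (p * a) + t * (p * b)) (sym sy≡x))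
    (solve 5 (λ s y p a b → s :* (p :* a) :+ s :* y :* (p :* b) := s :* p :* (a :+ y :* b)) refl s y p a b)

  -- The last factor is the value at y of the two trees with their roots joined by an edge; the
  -- corner of degree 2 supplies only a factor 1 + x.
  triangle-value : ∀ j k a b c d → let p = pow s j ; r = pow s k in
    s * (p * a * (r * c)) + x * (p * a * (r * d) + p * b * (r * c)) ≡ pow s (suc (j ℕ.+ k)) * (a * (c + y * d) + y * (b * c))
  triangle-value j k a b c d = trans (cong (λ t → s * (p * a * (r * c)) + t * (p * a * (r * d) + p * b * (r * c))) (sym sy≡x))
    (trans (solve 8 (λ s y p r a b c d →
       s :* (p :* a :* (r :* c)) :+ s :* y :* (p :* a :* (r :* d) :+ p :* b :* (r :* c))
       := s :* (p :* r) :* (a :* (c :+ y :* d) :+ y :* (b :* c))) refl s y p r a b c d)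
      (cong (λ e → s * e * (a * (c + y * d) + y * (b * c))) (sym (pow-+ s j k))))
    where
    p = pow s j
    r = pow s k

  -- The last factor is the value at y of a new root whose children are the roots of the two trees.
  -- The factors `1ℚ *` match two applications of `bounded-graft` to `bounded-point`.
  pentagon-value : ∀ j k a b c d → let p = pow s j ; r = pow s k in
    s * ((s + x) * (p * a * (r * c))) + x * (s * (p * a * (r * d) + p * b * (r * c)) + x * (p * b * (r * d)))
      ≡ pow s (2 ℕ.+ (j ℕ.+ k)) * (1ℚ * (a + y * b) * (c + y * d) + y * (1ℚ * a * c))
  pentagon-value j k a b c d = trans
    (cong (λ t → s * ((s + t) * (p * a * (r * c))) + t * (s * (p * a * (r * d) + p * b * (r * c)) + t * (p * b * (r * d)))) (sym sy≡x))
    (trans (solve 8 (λ s y p r a b c d →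
       s :* ((s :+ s :* y) :* (p :* a :* (r :* c)))
         :+ s :* y :* (s :* (p :* a :* (r :* d) :+ p :* b :* (r :* c)) :+ s :* y :* (p :* b :* (r :* d)))
       := s :* (s :* (p :* r)) :* (con 1ℚ :* (a :+ y :* b) :* (c :+ y :* d) :+ y :* (con 1ℚ :* a :* c))) refl s y p r a b c d)
      (cong (λ e → s * (s * e) * (1ℚ * (a + y * b) * (c + y * d) + y * (1ℚ * a * c))) (sym (pow-+ s j k))))
    where
    p = pow s j
    r = pow s k

module Trees {n : ℕ} (G : Graph (Fin n)) (wc : WellCovered G) (x y : ℚ) (y≤0 : y ≤ 0ℚ)
             (0<1+x : 0ℚ < 1ℚ + x) (sy≡x : (1ℚ + x) * y ≡ x)
             (Z-pos : ∀ {L} → Unique L → ∀ F → 0ℚ < Polynomial.Z G x L F) where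
  open Graph G
  open Polynomial G
  open IndependentLists G
  open PathBounds y y≤0
  open Homogeneous sy≡x

  s : ℚ
  s = 1ℚ + x

  -- The independent sets out and free witness the two ways of completing a
  -- maximal independent set inside a hanging tree without using its root r:
  -- out dominates r, free leaves it undominated.
  data Kind (r : V) (A : List V) (m : ℕ) : Set where
    light : A ≡ [] → Kind r A m
    heavy : ∀ out → (∀ {v} → v ∈ out → v ∈ A) → Unique out → IndependentList out →
            (∀ {v} → v ∈ A → Covers out v) → Covers out r → length out ≡ m → Kind r A m
    stem  : ∀ l → l ∉ A → l ≢ r → l ~ r → (∀ {v} → l ~ v → v ≡ r) → Kind r A m

  leaves : ∀ {r A m} → Kind r A m → List V
  leaves (light _)           = []
  leaves (heavy _ _ _ _ _ _ _) = []
  leaves (stem l _ _ _ _)    = l ∷ []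

  -- As built by `graft`, A consists of m stems with their leaves, without r and a possible leaf of
  -- r. Summing over the leaves of A gives `pow s m`, and α and β are values at y for the tree on r
  -- and the m stems.
  record Tree (r : V) : Set where
    field
      m        : ℕ
      A        : List V
      kind     : Kind r A m
      A-unique : Unique A
      r∉A      : r ∉ A
      ∣A∣      : length A ≡ m ℕ.+ m
      free     : List V
      free⊆A   : ∀ {v} → v ∈ free → v ∈ A
      free-unique      : Unique free
      free-independent : IndependentList free
      free-covers      : ∀ {v} → v ∈ A → Covers free v
      free≁r   : ∀ {v} → v ∈ free → ¬ (v ~ r)
      ∣free∣   : length free ≡ m
      α β      : ℚ
      bounded  : Bounded m α β
      Z-α      : Z x A [] ≡ pow s m * α
      Z-β      : Z x A (r ∷ []) ≡ pow s m * β

    vertices : List V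
    vertices = r ∷ leaves kind ++ A

    vertices-unique : Unique vertices
    vertices-unique with kind
    ... | light _                 = unique-∷ r∉A A-unique
    ... | heavy _ _ _ _ _ _ _     = unique-∷ r∉A A-unique
    ... | stem l l∉A l≢r _ _ = unique-∷ (λ { (here e) → l≢r (sym e) ; (there i) → r∉A i }) (unique-∷ l∉A A-unique)

    A⊆ : ∀ {v} → v ∈ A → v ∈ vertices
    A⊆ i = there (∈-++⁺ʳ (leaves kind) i)

    r∉free : r ∉ free
    r∉free i = r∉A (free⊆A i)

  open Tree using (vertices)

  point : ∀ r → Tree r
  point r = record
    { m = 0 ; A = [] ; kind = light refl ; A-unique = [] ; r∉A = λ () ; ∣A∣ = refl
    ; free = [] ; free⊆A = λ () ; free-unique = [] ; free-independent = λ () ; free-covers = λ ()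
    ; free≁r = λ () ; ∣free∣ = refl ; α = 1ℚ ; β = 1ℚ ; bounded = bounded-point ; Z-α = refl ; Z-β = refl }

  module _ {w v : V} (v~w : v ~ w) (T : Tree w) where
    private
      module T = Tree T

    -- The vertex v becomes the leaf of w. As A omits that leaf, only the kind of the tree changes.
    sprout : (∀ {u} → v ~ u → u ≡ w) → v ∉ T.A → Tree w
    sprout only v∉A = record { Tree T ; kind = stem v v∉A (λ { refl → ~-irrefl v~w }) v~w only }

    module Graft (U : Tree v) {l : V} (l∉A : l ∉ Tree.A U) (l≢v : l ≢ v) (l~v : l ~ v) (only : ∀ {u} → l ~ u → u ≡ v)
             (sep : ∀ {a b} → a ∈ vertices T → b ∈ v ∷ l ∷ Tree.A U → a ≢ b × (a ~ b → a ≡ w × b ≡ v)) where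
      private
        module U = Tree U

        B : List V
        B = v ∷ l ∷ U.A

        A′ : List V
        A′ = T.A ++ B

        v∉lA : v ∉ l ∷ U.A
        v∉lA (here e)  = l≢v (sym e)
        v∉lA (there i) = U.r∉A i

        l≁A : l ≁* U.A
        l≁A i p = U.r∉A (subst (_∈ U.A) (only (~-sym p)) i)

        w≁lA : w ≁* (l ∷ U.A)
        w≁lA i p = v∉lA (subst (_∈ l ∷ U.A) (proj₂ (proj₂ (sep (here refl) (there i)) (~-sym p))) i)

        A≁B : ∀ {a b} → a ∈ T.A → b ∈ B → ¬ (a ~ b)
        A≁B i j p = T.r∉A (subst (_∈ T.A) (proj₁ (proj₂ (sep (T.A⊆ i) j) p)) i)

        B-unique : Unique B
        B-unique = unique-∷ v∉lA (unique-∷ l∉A U.A-unique)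

        mono-free : ∀ {u} → u ∈ U.free → u ∈ B
        mono-free i = there (there (U.free⊆A i))

        γ+yδ : ℚ
        γ+yδ = U.α + y * U.β

        Z-B : Z x B [] ≡ pow s (suc U.m) * γ+yδ
        Z-B = trans (Z-stem x v l U.A l~v l≁A) (trans (cong₂ (λ a b → s * a + x * b) U.Z-α U.Z-β)
          (stem-value (pow s U.m) U.α U.β))

        Z-Bw : Z x B (w ∷ []) ≡ pow s (suc U.m) * U.α
        Z-Bw = trans (Z-stem-blocked x w v l U.A v~w l≁A w≁lA)
          (trans (cong (s *_) U.Z-α) (sym (ℚₚ.*-assoc s (pow s U.m) U.α)))

        -- The two sets for the new tree differ in one vertex: c = v dominates w, and c = l leaves w
        -- undominated.
        module Child (c : V) (c∈ : c ∈ B) (c≁w-or : IndependentList (c ∷ U.free)) (c∉ : c ∉ U.free)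
                     (cov : ∀ {u} → u ∈ B → Covers (c ∷ U.free) u) where
          list : List V
          list = T.free ++ c ∷ U.free

          in-B : ∀ {u} → u ∈ c ∷ U.free → u ∈ B
          in-B (here refl) = c∈
          in-B (there i)   = mono-free i

          ⊆A′ : ∀ {u} → u ∈ list → u ∈ A′
          ⊆A′ i with ∈-++⁻ T.free i
          ... | inj₁ j = ∈-++⁺ˡ (T.free⊆A j)
          ... | inj₂ j = ∈-++⁺ʳ T.A (in-B j)

          unique : Unique list
          unique = unique-++ T.free-unique (unique-∷ c∉ U.free-unique)
            (λ i j → proj₁ (sep (T.A⊆ (T.free⊆A i)) (in-B j)) refl)

          independent : IndependentList list
          independent = independent-++ T.free-independent c≁w-or (λ i j → A≁B (T.free⊆A i) (in-B j))

          covers : ∀ {u} → u ∈ A′ → Covers list u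
          covers i with ∈-++⁻ T.A i
          ... | inj₁ j = covers-⊆ ∈-++⁺ˡ (T.free-covers j)
          ... | inj₂ j = covers-⊆ (∈-++⁺ʳ T.free) (cov j)

          len : length list ≡ suc (T.m ℕ.+ U.m)
          len = trans (Listₚ.length-++ T.free) (trans (cong₂ (λ a b → a ℕ.+ suc b) T.∣free∣ U.∣free∣) (ℕₚ.+-suc T.m U.m))

        cov-v : ∀ {u} → u ∈ B → Covers (v ∷ U.free) u
        cov-v (here refl)         = covers-self (here refl)
        cov-v (there (here refl)) = v , here refl , inj₂ l~v
        cov-v (there (there i))   = covers-⊆ there (U.free-covers i)

        cov-l : ∀ {u} → u ∈ B → Covers (l ∷ U.free) u
        cov-l (here refl)         = l , here refl , inj₂ (~-sym l~v)
        cov-l (there (here refl)) = covers-self (here refl)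
        cov-l (there (there i))   = covers-⊆ there (U.free-covers i)

        module Out = Child v (here refl) (independent-∷ U.free-independent U.free≁r) U.r∉free cov-v
        module Free = Child l (there (here refl)) (independent-∷ U.free-independent (λ i → l≁A (U.free⊆A i)))
                        (λ i → l∉A (U.free⊆A i)) cov-l

        out-heavy : Kind w A′ (suc (T.m ℕ.+ U.m))
        out-heavy = heavy Out.list Out.⊆A′ Out.unique Out.independent Out.covers
          (v , ∈-++⁺ʳ T.free (here refl) , inj₂ (~-sym v~w)) Out.len

        kind′ : (K : Kind w T.A T.m) → (∀ {a b} → a ∈ leaves K → b ∈ B → a ≢ b) →
                Σ[ K′ ∈ Kind w A′ (suc (T.m ℕ.+ U.m)) ] leaves K′ ≡ leaves K
        kind′ (light _)             _ = out-heavy , refl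
        kind′ (heavy _ _ _ _ _ _ _) _ = out-heavy , refl
        kind′ (stem k k∉A k≢w k~w only-w) h = stem k k∉A′ k≢w k~w only-w , refl
          where
          k∉A′ : k ∉ A′
          k∉A′ i with ∈-++⁻ T.A i
          ... | inj₁ j = k∉A j
          ... | inj₂ j = h (here refl) j refl

        new-kind : Σ[ K′ ∈ Kind w A′ (suc (T.m ℕ.+ U.m)) ] leaves K′ ≡ leaves T.kind
        new-kind = kind′ T.kind (λ i j → proj₁ (sep (there (∈-++⁺ˡ i)) j))

        w∉A′ : w ∉ A′
        w∉A′ i with ∈-++⁻ T.A i
        ... | inj₁ j = T.r∉A j
        ... | inj₂ j = proj₁ (sep (here refl) j) refl

        ∣A′∣ : length A′ ≡ suc (T.m ℕ.+ U.m) ℕ.+ suc (T.m ℕ.+ U.m)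
        ∣A′∣ = trans (Listₚ.length-++ T.A) (trans (cong₂ (λ a b → a ℕ.+ (2 ℕ.+ b)) T.∣A∣ U.∣A∣)
          (arith T.m U.m))
          where
          arith : ∀ a b → a ℕ.+ a ℕ.+ (2 ℕ.+ (b ℕ.+ b)) ≡ suc (a ℕ.+ b) ℕ.+ suc (a ℕ.+ b)
          arith = solve-∀

        free≁w : ∀ {u} → u ∈ Free.list → ¬ (u ~ w)
        free≁w i with ∈-++⁻ T.free i
        ... | inj₁ j           = T.free≁r j
        ... | inj₂ (here refl) = w≁lA (here refl)
        ... | inj₂ (there j)   = w≁lA (there (U.free⊆A j))

      graft : Tree w
      graft = record
        { m = suc (T.m ℕ.+ U.m) ; A = A′ ; kind = proj₁ new-kind
        ; A-unique = unique-++ T.A-unique B-unique (λ i j → proj₁ (sep (T.A⊆ i) j) refl)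
        ; r∉A = w∉A′
        ; ∣A∣ = ∣A′∣
        ; free = Free.list ; free⊆A = Free.⊆A′ ; free-unique = Free.unique ; free-independent = Free.independent
        ; free-covers = Free.covers ; free≁r = free≁w ; ∣free∣ = Free.len
        ; α = T.α * γ+yδ ; β = T.β * U.α
        -- The leaf l makes the value of U at y, up to a power of 1 + x, the polynomial of an
        -- induced subgraph, so it is positive.
        ; bounded = bounded-graft T.bounded U.bounded
            (0<-*-cancelˡ (pow-pos (suc U.m) 0<1+x) (subst (0ℚ <_) Z-B (Z-pos B-unique [])))
        ; Z-α = trans (Z-++ x T.A B [] (λ i j p → A≁B i j (~-sym p))) (trans (cong₂ _*_ T.Z-α Z-B) (combine T.α γ+yδ))
        ; Z-β = trans (Z-++ x T.A B (w ∷ []) (λ i j p → A≁B i j (~-sym p))) (trans (cong₂ _*_ T.Z-β Z-Bw) (combine T.β U.α)) }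
        where
        combine : ∀ a b → pow s T.m * a * (pow s (suc U.m) * b) ≡ pow s (suc (T.m ℕ.+ U.m)) * (a * b)
        combine a b = trans (solve 5 (λ s p q a b → p :* a :* (s :* q :* b) := s :* (p :* q) :* (a :* b)) refl
            s (pow s T.m) (pow s U.m) a b)
          (cong (λ p → s * p * (a * b)) (sym (pow-+ s T.m U.m)))

      vertices-graft⁻ : ∀ {u} → u ∈ vertices graft → u ∈ vertices T ⊎ u ∈ B
      vertices-graft⁻ (here refl) = inj₁ (here refl)
      vertices-graft⁻ (there i) with ∈-++⁻ (leaves (proj₁ new-kind)) i
      ... | inj₁ j = inj₁ (there (∈-++⁺ˡ (subst (_ ∈_) (proj₂ new-kind) j)))
      ... | inj₂ j with ∈-++⁻ T.A j
      ... | inj₁ k = inj₁ (T.A⊆ k)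
      ... | inj₂ k = inj₂ k

      vertices-graft⁺ : ∀ {u} → u ∈ vertices T ⊎ u ∈ B → u ∈ vertices graft
      vertices-graft⁺ (inj₁ (here refl)) = here refl
      vertices-graft⁺ (inj₁ (there i)) with ∈-++⁻ (leaves T.kind) i
      ... | inj₁ j = there (∈-++⁺ˡ (subst (_ ∈_) (sym (proj₂ new-kind)) j))
      ... | inj₂ j = there (∈-++⁺ʳ (leaves (proj₁ new-kind)) (∈-++⁺ˡ j))
      vertices-graft⁺ (inj₂ i) = there (∈-++⁺ʳ (leaves (proj₁ new-kind)) (∈-++⁺ʳ T.A i))

  record Off {r : V} (T : Tree r) : Set where
    field
      set         : List V
      ⊆vertices   : ∀ {v} → v ∈ set → v ∈ vertices T
      unique      : Unique set
      independent : IndependentList set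
      covers      : ∀ {v} → v ∈ vertices T → Covers set v
      r∉set       : r ∉ set

  -- A part using the root has m + 1 vertices, and one leaving it undominated has m. Dominating the
  -- root without using it takes m vertices in the heavy case and m + 1 in the stem case; every
  -- exchange lives on these differences.
  data Shape {r : V} (T : Tree r) : Set where
    is-light : leaves (Tree.kind T) ≡ [] → Tree.A T ≡ [] → Shape T
    is-heavy : leaves (Tree.kind T) ≡ [] → (O : Off T) → length (Off.set O) ≡ Tree.m T → Shape T
    is-stem  : ∀ l → leaves (Tree.kind T) ≡ l ∷ [] → l ∉ Tree.A T → l ≢ r → l ~ r → (∀ {v} → l ~ v → v ≡ r) →
               (O : Off T) → length (Off.set O) ≡ suc (Tree.m T) → Shape T

  shape : ∀ {r} (T : Tree r) → Shape T
  shape {r} T = go (Tree.kind T) refl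
    where
    module T = Tree T
    go : ∀ K → T.kind ≡ K → Shape T
    go (light e) eq = is-light (cong leaves eq) e
    go (heavy out ⊆A out! out-ind cov cov-r len) eq = is-heavy (cong leaves eq) (record
      { set = out ; ⊆vertices = λ i → T.A⊆ (⊆A i) ; unique = out! ; independent = out-ind
      ; covers = λ { (here refl) → cov-r ; (there i) → cov (subst (λ L → _ ∈ L ++ T.A) (cong leaves eq) i) }
      ; r∉set = λ i → T.r∉A (⊆A i) }) len
    go (stem l l∉A l≢r l~r only) eq = is-stem l (cong leaves eq) l∉A l≢r l~r only (record
      { set = l ∷ T.free
      ; ⊆vertices = λ { (here refl) → there (subst (λ L → l ∈ L ++ T.A) (sym (cong leaves eq)) (here refl))
                      ; (there i) → T.A⊆ (T.free⊆A i) }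
      ; unique = unique-∷ (λ i → l∉A (T.free⊆A i)) T.free-unique
      ; independent = independent-∷ T.free-independent
          (λ i p → T.r∉A (subst (_∈ T.A) (only (~-sym p)) (T.free⊆A i)))
      ; covers = λ { (here refl) → l , here refl , inj₂ (~-sym l~r)
                   ; (there i) → cov (subst (λ L → _ ∈ L ++ T.A) (cong leaves eq) i) }
      ; r∉set = λ { (here e) → l≢r (sym e) ; (there i) → T.r∉free i } }) (cong suc T.∣free∣)
      where
      cov : ∀ {v} → v ∈ (l ∷ []) ++ T.A → Covers (l ∷ T.free) v
      cov (here refl) = covers-self (here refl)
      cov (there i)   = covers-⊆ there (T.free-covers i)

  record State (R : List V) : Set where
    field
      own       : V → V
      ownership : Ownership R own
      tree      : ∀ r → Tree r
      mem⁺      : ∀ {r} → r ∈ R → ∀ {v} → v ∈ vertices (tree r) → own v ≡ r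
      mem⁻      : ∀ {r} → r ∈ R → ∀ {v} → own v ≡ r → v ∈ vertices (tree r)
    open Ownership ownership public

    in-part : ∀ {r} → r ∈ R → Part own
    in-part {r} i = record
      { root = r ; set = r ∷ T.free ; unique = unique-∷ T.r∉free T.free-unique
      ; independent = independent-∷ T.free-independent T.free≁r
      ; owned = λ { (here refl) → own-root i ; (there j) → mem⁺ i (T.A⊆ (T.free⊆A j)) }
      ; covers = λ e v≢r → cov (mem⁻ i e) v≢r }
      where
      module T = Tree (tree r)
      leaf-adjacent : ∀ K → ∀ {v} → v ∈ leaves {r} {T.A} {T.m} K → v ~ r
      leaf-adjacent (stem _ _ _ l~r _) (here refl) = l~r
      cov : ∀ {v} → v ∈ vertices (tree r) → v ≢ r → Covers (r ∷ T.free) v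
      cov (here e) v≢r = contradiction e v≢r
      cov (there j) _ with ∈-++⁻ (leaves T.kind) j
      ... | inj₁ k = r , here refl , inj₂ (leaf-adjacent T.kind k)
      ... | inj₂ k = covers-⊆ there (T.free-covers k)

    -- The root must have no leaf of its own, since such a leaf would remain undominated.
    free-part : ∀ {r} → r ∈ R → leaves (Tree.kind (tree r)) ≡ [] → Part own
    free-part {r} i e = record
      { root = r ; set = T.free ; unique = T.free-unique ; independent = T.free-independent
      ; owned = λ j → mem⁺ i (T.A⊆ (T.free⊆A j))
      ; covers = λ o v≢r → cov (mem⁻ i o) v≢r }
      where
      module T = Tree (tree r)
      cov : ∀ {v} → v ∈ vertices (tree r) → v ≢ r → Covers T.free v
      cov (here e′) v≢r = contradiction e′ v≢r
      cov (there j) _ = T.free-covers (subst (λ L → _ ∈ L ++ T.A) e j)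

    off-part : ∀ {r} → r ∈ R → Off (tree r) → Part own
    off-part {r} i O = record
      { root = r ; set = O.set ; unique = O.unique ; independent = O.independent
      ; owned = λ j → mem⁺ i (O.⊆vertices j) ; covers = λ e _ → O.covers (mem⁻ i e) }
      where module O = Off O

    sizes : List (Part own) → ℕ
    sizes []       = 0
    sizes (P ∷ Ps) = length (Part.set P) ℕ.+ sizes Ps

    length-union : ∀ Ps → length (union Ps) ≡ sizes Ps
    length-union []       = refl
    length-union (P ∷ Ps) = trans (Listₚ.length-++ (Part.set P)) (cong (length (Part.set P) ℕ.+_) (length-union Ps))

    Dominated-by : List (Part own) → Part own → Set
    Dominated-by Qs P = (∃[ Q ] (Q ∈ Qs × Part.root Q ≡ Part.root P)) × Covers (union Qs) (Part.root P)
               × (Part.root P ∈ Part.set P → ∀ {u} → u ∈ R → u ~ Part.root P → Covers (union Qs) u)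

    swap-contradiction : ∀ {Ps Qs} → AllPairs Compatible Ps → AllPairs Compatible Qs → All (Dominated-by Qs) Ps →
      ¬ (sizes Ps ≡ suc (sizes Qs))
    swap-contradiction {Ps} {Qs} cP cQ h e = ℕₚ.<-irrefl refl (ℕₚ.≤-trans (ℕₚ.≤-reflexive (sym e))
      (subst₂ ℕ._≤_ (length-union Ps) (length-union Qs) (parts-length-≤ ownership wc cP cQ h)))

    ∣in∣ : ∀ {r} (i : r ∈ R) → length (Part.set (in-part i)) ≡ suc (Tree.m (tree r))
    ∣in∣ {r} i = cong suc (Tree.∣free∣ (tree r))

    covers-in-self : ∀ {r} Qs (i : r ∈ R) → in-part i ∈ Qs → Covers (union Qs) r
    covers-in-self Qs i k = covers-self (union⁺ k (here refl))

    covers-in-adj : ∀ {r u} Qs (i : r ∈ R) → in-part i ∈ Qs → u ~ r → Covers (union Qs) u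
    covers-in-adj {r} Qs i k p = r , union⁺ k (here refl) , inj₂ p

    covers-off : ∀ {r} Qs (i : r ∈ R) (O : Off (tree r)) → off-part i O ∈ Qs → Covers (union Qs) r
    covers-off Qs i O k = covers-⊆ (union⁺ k) (Off.covers O (here refl))

  initial : ∀ R → (∀ v → v ∈ R) → State R
  initial R all = record
    { own = λ v → v
    ; ownership = record { own∈ = all ; own-root = λ _ → refl ; own-adj = λ {u} {v} _ → inj₂ (all u , all v) }
    ; tree = point
    ; mem⁺ = λ { _ (here e) → e }
    ; mem⁻ = λ _ e → here e }

  module Peel {v : V} {R : List V} (S : State (v ∷ R)) (v∉R : v ∉ R) {w : V} (w∈R : w ∈ R) (v~w : v ~ w)
              (only : ∀ {u} → u ∈ R → v ~ u → u ≡ w) {z : V} (z∈R : z ∈ R) (z~w : z ~ w) where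
    open State S

    private
      U : Tree v
      U = tree v

      T : Tree w
      T = tree w

      i-v : v ∈ v ∷ R
      i-v = here refl

      i-w : w ∈ v ∷ R
      i-w = there w∈R

      i-z : z ∈ v ∷ R
      i-z = there z∈R

      ≢v : ∀ {r} → r ∈ R → r ≢ v
      ≢v i refl = v∉R i

      sep : ∀ {a b} → a ∈ vertices T → b ∈ vertices U → a ≢ b × (a ~ b → a ≡ w × b ≡ v)
      sep {a} {b} i j = (λ { refl → ≢v w∈R (trans (sym own-a) own-b) }) ,
        λ p → let ea , eb = adj-root p (λ e → ≢v w∈R (trans (sym own-a) (trans e own-b))) in
              trans ea own-a , trans eb own-b
        where
        own-a = mem⁺ i-w i
        own-b = mem⁺ i-v j

      neighbours : ∀ {u} → u ∈ v ∷ R → u ~ v → u ≡ w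
      neighbours (here refl) p = contradiction p ~-irrefl
      neighbours (there i)   p = only i (~-sym p)

      exchange-size : ∀ a b → suc a ℕ.+ (suc b ℕ.+ 0) ≡ suc (suc a ℕ.+ (b ℕ.+ 0))
      exchange-size = solve-∀

      -- Trading v for a set that dominates it from within loses one vertex. The only other root
      -- next to v is w, which z keeps dominated.
      not-heavy : (O : Off U) → ¬ (length (Off.set O) ≡ Tree.m U)
      not-heavy O len = swap-contradiction {Ps} {Qs}
        (((≢v z∈R , λ _ _ → z≁v) ∷ []) ∷ [] ∷ [])
        (((≢v z∈R , λ _ _ → z≁v) ∷ []) ∷ [] ∷ [])
        ( ((in-part i-z , here refl , refl) , covers-in-self Qs i-z (here refl) , λ _ _ p → covers-in-adj Qs i-z (here refl) p)
        ∷ ((off-part i-v O , there (here refl) , refl) , covers-off Qs i-v O (there (here refl)) ,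
           λ _ j p → subst (Covers (union Qs)) (sym (neighbours j p)) (covers-in-adj Qs i-z (here refl) (~-sym z~w)))
        ∷ [])
        (trans (cong₂ (λ a b → a ℕ.+ (b ℕ.+ 0)) (∣in∣ i-z) (∣in∣ i-v))
          (trans (exchange-size (Tree.m (tree z)) (Tree.m U))
            (cong suc (cong₂ (λ a b → a ℕ.+ (b ℕ.+ 0)) (sym (∣in∣ i-z)) (sym len)))))
        where
        Ps Qs : List (Part own)
        Ps = in-part i-z ∷ in-part i-v ∷ []
        Qs = in-part i-z ∷ off-part i-v O ∷ []
        z≁v : ¬ (z ~ v)
        z≁v p = ~-irrefl (subst (_~ w) (neighbours i-z p) z~w)

      -- If w has a leaf and v has none, using w costs the same as avoiding it. Trading v for w
      -- therefore loses one vertex, and v is dominated by w.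
      not-two-leaves : leaves (Tree.kind U) ≡ [] → (O : Off T) → ¬ (length (Off.set O) ≡ suc (Tree.m T))
      not-two-leaves bare O len = swap-contradiction {Ps} {Qs}
        (((≢v w∈R , λ j _ _ → Off.r∉set O j) ∷ []) ∷ [] ∷ [])
        (((≢v w∈R , λ _ j _ → Tree.r∉free U j) ∷ []) ∷ [] ∷ [])
        ( ((in-part i-w , here refl , refl) , covers-in-self Qs i-w (here refl) , λ j _ _ → contradiction j (Off.r∉set O))
        ∷ ((free-part i-v bare , there (here refl) , refl) , covers-in-adj Qs i-w (here refl) v~w ,
           λ _ j p → subst (Covers (union Qs)) (sym (neighbours j p)) (covers-in-self Qs i-w (here refl)))
        ∷ [])
        (trans (cong₂ (λ a b → a ℕ.+ (b ℕ.+ 0)) len (∣in∣ i-v))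
          (trans (exchange-size (Tree.m T) (Tree.m U))
            (cong suc (cong₂ (λ a b → a ℕ.+ (b ℕ.+ 0)) (sym (∣in∣ i-w)) (sym (Tree.∣free∣ U))))))
        where
        Ps Qs : List (Part own)
        Ps = off-part i-w O ∷ in-part i-v ∷ []
        Qs = in-part i-w ∷ free-part i-v bare ∷ []

      record Merged : Set where
        field
          tree′ : Tree w
          mem⁺′ : ∀ {u} → u ∈ vertices tree′ → own u ≡ w ⊎ own u ≡ v
          mem⁻′ : ∀ {u} → own u ≡ w ⊎ own u ≡ v → u ∈ vertices tree′

      sprouted : leaves (Tree.kind U) ≡ [] → Tree.A U ≡ [] → leaves (Tree.kind T) ≡ [] → Merged
      sprouted bare A≡[] bare-w = record { tree′ = sprout v~w T only-w v∉A ; mem⁺′ = to ; mem⁻′ = from }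
        where
        alone : ∀ {u} → u ∈ vertices U → u ≡ v
        alone (here e) = e
        alone (there i) with subst₂ (λ L A → _ ∈ L ++ A) bare A≡[] i
        ... | ()
        only-w : ∀ {u} → v ~ u → u ≡ w
        only-w p with own-adj p
        ... | inj₁ e = contradiction (subst (v ~_) (alone (mem⁻ i-v (trans (sym e) (own-root i-v)))) p) ~-irrefl
        ... | inj₂ (_ , j) = neighbours j (~-sym p)
        v∉A : v ∉ Tree.A T
        v∉A i = ≢v w∈R (trans (sym (mem⁺ i-w (Tree.A⊆ T i))) (own-root i-v))
        to : ∀ {u} → u ∈ w ∷ v ∷ Tree.A T → own u ≡ w ⊎ own u ≡ v
        to (here refl)         = inj₁ (own-root i-w)
        to (there (here refl)) = inj₂ (own-root i-v)
        to (there (there i))   = inj₁ (mem⁺ i-w (Tree.A⊆ T i))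
        from : ∀ {u} → own u ≡ w ⊎ own u ≡ v → u ∈ w ∷ v ∷ Tree.A T
        from (inj₁ e) with mem⁻ i-w e
        ... | here e′ = here e′
        ... | there i = there (there (subst (λ L → _ ∈ L ++ Tree.A T) bare-w i))
        from (inj₂ e) = there (here (alone (mem⁻ i-v e)))

      grafted : ∀ {l} → leaves (Tree.kind U) ≡ l ∷ [] → l ∉ Tree.A U → l ≢ v → l ~ v → (∀ {u} → l ~ u → u ≡ v) → Merged
      grafted {l} stemmed l∉A l≢v l~v only-v = record
        { tree′ = graft
        ; mem⁺′ = λ i → to (vertices-graft⁻ i)
        ; mem⁻′ = λ { (inj₁ e) → vertices-graft⁺ (inj₁ (mem⁻ i-w e))
                    ; {u} (inj₂ e) → vertices-graft⁺ (inj₂ (subst (u ∈_) B≡ (mem⁻ i-v e))) } }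
        where
        B≡ : vertices U ≡ v ∷ l ∷ Tree.A U
        B≡ = cong (λ L → v ∷ L ++ Tree.A U) stemmed
        sep′ : ∀ {a b} → a ∈ vertices T → b ∈ v ∷ l ∷ Tree.A U → a ≢ b × (a ~ b → a ≡ w × b ≡ v)
        sep′ {b = b} i j = sep i (subst (b ∈_) (sym B≡) j)
        open Graft v~w T U l∉A l≢v l~v only-v sep′
        to : ∀ {u} → u ∈ vertices T ⊎ u ∈ v ∷ l ∷ Tree.A U → own u ≡ w ⊎ own u ≡ v
        to (inj₁ i) = inj₁ (mem⁺ i-w i)
        to {u} (inj₂ i) = inj₂ (mem⁺ i-v (subst (u ∈_) (sym B≡) i))

      merged : Merged
      merged with shape U
      ... | is-heavy _ O len = contradiction len (not-heavy O)
      ... | is-stem l stemmed l∉A l≢v l~v only-v _ _ = grafted stemmed l∉A l≢v l~v only-v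
      ... | is-light bare A≡[] with shape T
      ...   | is-light bare-w _   = sprouted bare A≡[] bare-w
      ...   | is-heavy bare-w _ _ = sprouted bare A≡[] bare-w
      ...   | is-stem _ _ _ _ _ _ O len = contradiction len (not-two-leaves bare O)

      module M = Merged merged

      redirect : V → V
      redirect u with u Finₚ.≟ v
      ... | yes _ = w
      ... | no _  = u

      redirect-≢ : ∀ {u} → u ≢ v → redirect u ≡ u
      redirect-≢ {u} h with u Finₚ.≟ v
      ... | yes e = contradiction e h
      ... | no _  = refl

      redirect-v : ∀ {u} → u ≡ v → redirect u ≡ w
      redirect-v {u} h with u Finₚ.≟ v
      ... | yes _ = refl
      ... | no ≢  = contradiction h ≢

      redirect⁻ : ∀ {u r} → redirect u ≡ r → (u ≡ v × r ≡ w) ⊎ u ≡ r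
      redirect⁻ {u} e with u Finₚ.≟ v
      ... | yes u≡ = inj₁ (u≡ , sym e)
      ... | no _   = inj₂ e

      redirect∈ : ∀ {u} → u ∈ v ∷ R → redirect u ∈ R
      redirect∈ {u} i with u Finₚ.≟ v
      redirect∈ i         | yes _ = w∈R
      redirect∈ (here e)  | no ≢  = contradiction e ≢
      redirect∈ (there i) | no _  = i

      redirect-eq : ∀ {u} → u ≡ w ⊎ u ≡ v → redirect u ≡ w
      redirect-eq (inj₁ refl) = redirect-≢ (≢v w∈R)
      redirect-eq (inj₂ e)    = redirect-v e

      own-adj′ : ∀ {a b} → a ~ b → redirect (own a) ≡ redirect (own b) ⊎ (a ∈ R × b ∈ R)
      own-adj′ p with own-adj p
      ... | inj₁ e = inj₁ (cong redirect e)
      ... | inj₂ (here refl , here refl) = contradiction p ~-irrefl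
      ... | inj₂ (here refl , there j) = inj₁ (trans (redirect-v (own-root i-v))
              (sym (redirect-eq (inj₁ (trans (own-root (there j)) (only j p))))))
      ... | inj₂ (there i , here refl) = inj₁ (trans (redirect-eq (inj₁ (trans (own-root (there i)) (only i (~-sym p)))))
              (sym (redirect-v (own-root i-v))))
      ... | inj₂ (there i , there j) = inj₂ (i , j)

      new-tree : ∀ r → Tree r
      new-tree r with r Finₚ.≟ w
      ... | yes refl = M.tree′
      ... | no _     = tree r

      new-mem⁺ : ∀ {r} → r ∈ R → ∀ {u} → u ∈ vertices (new-tree r) → redirect (own u) ≡ r
      new-mem⁺ {r} i j with r Finₚ.≟ w
      ... | yes refl = redirect-eq (M.mem⁺′ j)
      ... | no _     = trans (redirect-≢ (λ e → ≢v i (trans (sym (mem⁺ (there i) j)) e))) (mem⁺ (there i) j)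

      new-mem⁻ : ∀ {r} → r ∈ R → ∀ {u} → redirect (own u) ≡ r → u ∈ vertices (new-tree r)
      new-mem⁻ {r} i {u} e with redirect⁻ {own u} e | r Finₚ.≟ w
      ... | inj₁ (o≡v , _) | yes refl = M.mem⁻′ (inj₂ o≡v)
      ... | inj₂ o≡r       | yes refl = M.mem⁻′ (inj₁ o≡r)
      ... | inj₁ (_ , r≡w) | no ≢     = contradiction r≡w ≢
      ... | inj₂ o≡r       | no _     = mem⁻ (there i) o≡r

    peel : State R
    peel = record
      { own = λ u → redirect (own u)
      ; ownership = record
        { own∈ = λ u → redirect∈ (own∈ u)
        ; own-root = λ i → trans (redirect-≢ (λ e → ≢v i (trans (sym (own-root (there i))) e))) (own-root (there i))
        ; own-adj = own-adj′ }
      ; tree = new-tree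
      ; mem⁺ = new-mem⁺
      ; mem⁻ = new-mem⁻ }

-- The cycle of a unicyclic graph

unique-lookup : ∀ {A : Set} {L : List A} → Unique L → ∀ i j → lookup L i ≡ lookup L j → i ≡ j
unique-lookup (p ∷ u) zero    zero    _ = refl
unique-lookup (p ∷ u) zero    (suc j) e = contradiction e (All.lookup p (∈-lookup j))
unique-lookup (p ∷ u) (suc i) zero    e = contradiction (sym e) (All.lookup p (∈-lookup i))
unique-lookup (p ∷ u) (suc i) (suc j) e = cong suc (unique-lookup u i j e)

module SimplePaths {n : ℕ} (E : Fin n → Fin n → Set) where
  private
    V : Set
    V = Fin n

  open import Data.List.Membership.DecPropositional (Finₚ._≟_ {n}) using (_∈?_)

  data Path (a : V) : V → List V → Set where
    end  : Path a a (a ∷ [])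
    step : ∀ {u v p} → E u v → Path a v p → u ∉ p → Path a u (u ∷ p)

  private
    suffix : ∀ {a u v p} → Path a v p → u ∈ p → ∃[ p′ ] Path a u p′
    suffix end            (here refl) = _ , end
    suffix (step e P v∉p) (here refl) = _ , step e P v∉p
    suffix (step e P v∉p) (there i)   = suffix P i

  -- Loop erasure: if u already lies on the path found, the suffix from u is taken.
  simple-path : ∀ {u a} → Star E u a → ∃[ p ] Path a u p
  simple-path done = _ , end
  simple-path {u} (e ◅ es) with simple-path es
  ... | p , P with u ∈? p
  ... | yes i = suffix P i
  ... | no u∉ = _ , step e P u∉

  path-unique : ∀ {a u p} → Path a u p → Unique p
  path-unique end            = unique-∷ (λ ()) []
  path-unique (step e P u∉p) = unique-∷ u∉p (path-unique P)

  first : ∀ {a u p} → Path a u p → (i : Fin (length p)) → toℕ i ≡ 0 → lookup p i ≡ u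
  first end          zero _ = refl
  first (step _ _ _) zero _ = refl

  last : ∀ {a u p} → Path a u p → (i : Fin (length p)) → suc (toℕ i) ≡ length p → lookup p i ≡ a
  last end          zero    _ = refl
  last (step _ end _) zero ()
  last (step _ (step _ _ _) _) zero ()
  last (step _ P _) (suc i) e = last P i (ℕₚ.suc-injective e)

  last-index : ∀ {a u p} → Path a u p → Σ[ i ∈ Fin (length p) ] suc (toℕ i) ≡ length p
  last-index end          = zero , refl
  last-index (step _ P _) = let i , e = last-index P in suc i , cong suc e

  first-index : ∀ {a u p} → Path a u p → Σ[ i ∈ Fin (length p) ] toℕ i ≡ 0
  first-index end          = zero , refl
  first-index (step _ _ _) = zero , refl

  consecutive : ∀ {a u p} → Path a u p → (i j : Fin (length p)) → suc (toℕ i) ≡ toℕ j → E (lookup p i) (lookup p j)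
  consecutive end          zero    zero    ()
  consecutive (step e P _) zero    (suc j) h = subst (E _) (sym (first P j (sym (ℕₚ.suc-injective h)))) e
  consecutive (step e P _) (suc i) (suc j) h = consecutive P i j (ℕₚ.suc-injective h)

module CycleStructure {n : ℕ} (G : Graph (Fin n)) (C : Cycle G) (same : ∀ D → SameCycle C D) where
  open Graph G
  open Cycle C using (vertex; injective; adjacent; Edge) renaming (len to g; 3≤len to 3≤g)

  private
    V : Set
    V = Fin n

  Avoids : V → V → V → V → Set
  Avoids a b u v = u ~ v × ¬ (u ≡ a × v ≡ b) × ¬ (u ≡ b × v ≡ a)

  -- A path avoiding the edge ab closes up to a cycle through ab.
  bridge : ∀ {a b} → a ~ b → ¬ Edge a b → ¬ Star (Avoids a b) b a
  bridge {a} {b} a~b ¬e p = ¬e (Equivalence.from (same D a b) edge)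
    where
    open SimplePaths (Avoids a b)
    P = proj₂ (simple-path p)
    list = proj₁ (simple-path p)
    long : ∀ {l} → Path a b l → 3 ℕ.≤ length l
    long end = contradiction a~b ~-irrefl
    long (step (_ , _ , h) end _) = contradiction (refl , refl) h
    long (step _ (step _ end _) _) = s≤s (s≤s (s≤s z≤n))
    long (step _ (step _ (step _ _ _) _) _) = s≤s (s≤s (s≤s z≤n))
    next : ∀ i j → (suc (toℕ i) ≡ toℕ j ⊎ (suc (toℕ i) ≡ length list × toℕ j ≡ 0)) → lookup list i ~ lookup list j
    next i j (inj₁ h)        = proj₁ (consecutive P i j h)
    next i j (inj₂ (h , h′)) = subst₂ _~_ (sym (last P i h)) (sym (first P j h′)) a~b
    D : Cycle G
    D = record
      { len = length list ; 3≤len = long P ; vertex = lookup list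
      ; injective = λ {i} {j} → unique-lookup (path-unique P) i j
      ; adjacent = λ { {i} {j} (inj₁ h) → next i j h ; {i} {j} (inj₂ h) → ~-sym (next j i h) } }
    edge : Cycle.Edge D a b
    edge = let i , hi = last-index P ; j , hj = first-index P in
      i , j , inj₁ (inj₂ (hi , hj)) , last P i hi , first P j hj

  instance
    g-nonZero : ℕ.NonZero g
    g-nonZero = ℕ.>-nonZero (ℕₚ.≤-trans (s≤s z≤n) 3≤g)

  -- Indices range over ℕ so that arcs and rotations read `c (d + i)`; going once round is
  -- `c-period`.
  c : ℕ → V
  c i = vertex (i mod g)

  private
    toℕ-mod : ∀ i → toℕ (i mod g) ≡ i % g
    toℕ-mod i = Finₚ.toℕ-fromℕ< (m%n<n i g)

    c-≡ : ∀ {i j} → i % g ≡ j % g → c i ≡ c j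
    c-≡ {i} {j} e = cong vertex (Finₚ.toℕ-injective (trans (toℕ-mod i) (trans e (sym (toℕ-mod j)))))

    c-inj : ∀ {i j} → c i ≡ c j → i % g ≡ j % g
    c-inj {i} {j} e = trans (sym (toℕ-mod i)) (trans (cong toℕ (injective e)) (toℕ-mod j))

    shift-% : ∀ i d → (d ℕ.+ i) % g ≡ (d ℕ.+ i % g) % g
    shift-% i d = trans (cong (λ t → (d ℕ.+ t) % g) (m≡m%n+[m/n]*n i g))
      (trans (cong (_% g) (sym (ℕₚ.+-assoc d (i % g) (i ℕ./ g ℕ.* g)))) ([m+kn]%n≡m%n (d ℕ.+ i % g) (i ℕ./ g) g))

    suc-% : ∀ i → suc (i % g) ≡ suc i % g ⊎ (suc (i % g) ≡ g × suc i % g ≡ 0)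
    suc-% i with ℕₚ.m≤n⇒m<n∨m≡n (m%n<n i g)
    ... | inj₁ lt = inj₁ (sym (trans (shift-% i 1) (m<n⇒m%n≡m lt)))
    ... | inj₂ eq = inj₂ (eq , trans (shift-% i 1) (trans (cong (_% g) eq) (n%n≡0 g)))

  c-period : ∀ i → c (g ℕ.+ i) ≡ c i
  c-period i = c-≡ (trans (cong (_% g) (ℕₚ.+-comm g i)) ([m+n]%n≡m%n i g))

  c-edge : ∀ i → Edge (c i) (c (suc i))
  c-edge i = i mod g , suc i mod g , near , refl , refl
    where
    near : Graph._~_ (cycle g 3≤g) (i mod g) (suc i mod g)
    near with suc-% i
    ... | inj₁ e        = inj₁ (inj₁ (trans (cong suc (toℕ-mod i)) (trans e (sym (toℕ-mod (suc i))))))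
    ... | inj₂ (e , e′) = inj₁ (inj₂ (trans (cong suc (toℕ-mod i)) e , trans (toℕ-mod (suc i)) e′))

  edge-sym : ∀ {u v} → Edge u v → Edge v u
  edge-sym (i , j , inj₁ h , e , e′) = j , i , inj₂ h , e′ , e
  edge-sym (i , j , inj₂ h , e , e′) = j , i , inj₁ h , e′ , e

  edge-adj : ∀ {u v} → Edge u v → u ~ v
  edge-adj (i , j , h , refl , refl) = adjacent h

  c-adj : ∀ i → c i ~ c (suc i)
  c-adj i = edge-adj (c-edge i)

  c-distinct : ∀ i d → 0 ℕ.< d → d ℕ.< g → c i ≢ c (d ℕ.+ i)
  c-distinct i d 0<d d<g e = impossible (ℕₚ.<-≤-connex (d ℕ.+ r) g)
    where
    r = i % g
    r≡ : r ≡ (d ℕ.+ r) % g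
    r≡ = trans (c-inj {i} {d ℕ.+ i} e) (shift-% i d)
    impossible : d ℕ.+ r ℕ.< g ⊎ g ℕ.≤ d ℕ.+ r → _
    impossible (inj₁ lt) = ℕₚ.<⇒≢ (ℕₚ.m<n+m r 0<d) (trans r≡ (m<n⇒m%n≡m lt))
    impossible (inj₂ ge) = ℕₚ.<⇒≢ d<g (ℕₚ.+-cancelʳ-≡ r d g (trans (sym (ℕₚ.m+[n∸m]≡n ge)) (cong (g ℕ.+_) (sym t≡))))
      where
      t = d ℕ.+ r ℕ.∸ g
      t<g : t ℕ.< g
      t<g = ℕₚ.+-cancelˡ-< g t g (subst (ℕ._< g ℕ.+ g) (sym (ℕₚ.m+[n∸m]≡n ge)) (ℕₚ.+-mono-< d<g (m%n<n i g)))
      t≡ : r ≡ t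
      t≡ = trans r≡ (trans (cong (_% g) (trans (sym (ℕₚ.m+[n∸m]≡n ge)) (ℕₚ.+-comm g t)))
             (trans ([m+n]%n≡m%n t g) (m<n⇒m%n≡m t<g)))

  private
    next-≡ : ∀ i j → suc (toℕ (i mod g)) ≡ toℕ (j mod g) ⊎ (suc (toℕ (i mod g)) ≡ g × toℕ (j mod g) ≡ 0) → c (suc i) ≡ c j
    next-≡ i j h with suc-% i | h
    ... | inj₁ e | inj₁ p = c-≡ (trans (sym e) (trans (cong suc (sym (toℕ-mod i))) (trans p (toℕ-mod j))))
    ... | inj₁ e | inj₂ (p , q) = contradiction (trans (sym e) (trans (cong suc (sym (toℕ-mod i))) p)) (ℕₚ.<⇒≢ (m%n<n (suc i) g))
    ... | inj₂ (e , e′) | inj₁ p = contradiction (trans (sym p) (trans (cong suc (toℕ-mod i)) e))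
            (ℕₚ.<⇒≢ (subst (ℕ._< g) (sym (toℕ-mod j)) (m%n<n j g)))
    ... | inj₂ (e , e′) | inj₂ (p , q) = c-≡ (trans e′ (trans (sym q) (toℕ-mod j)))

  -- The cycle joins the ends of a chord without using it, so by `bridge` the chord would be an edge
  -- of the cycle.
  c-chordless : ∀ i d → 1 ℕ.< d → suc d ℕ.< g → ¬ (c i ~ c (d ℕ.+ i))
  c-chordless i (suc d) (s≤s 0<d) lt chord = bridge chord no-edge (subst (Star (Avoids a b) b) c-g (walk (g ℕ.∸ suc d)))
    where
    a = c i
    b = c (suc d ℕ.+ i)
    no-edge : ¬ Edge a b
    no-edge (i′ , j′ , h , e , e′) with injective {i′} {i mod g} e | injective {j′} {(suc d ℕ.+ i) mod g} e′
    no-edge (i′ , j′ , inj₁ h , e , e′) | refl | refl = c-distinct (suc i) d 0<d (ℕₚ.<-trans (ℕₚ.n<1+n d) (ℕₚ.<-trans (ℕₚ.n<1+n _) lt))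
      (trans (next-≡ i (suc d ℕ.+ i) h) (cong c (sym (ℕₚ.+-suc d i))))
    no-edge (i′ , j′ , inj₂ h , e , e′) | refl | refl =
      c-distinct i (suc (suc d)) (s≤s z≤n) lt (sym (next-≡ (suc d ℕ.+ i) i h))
    along : ∀ j → Avoids a b (c j) (c (suc j))
    along j = c-adj j , (λ (e , e′) → no-edge (subst₂ Edge e e′ (c-edge j)))
                      , (λ (e , e′) → no-edge (edge-sym (subst₂ Edge e e′ (c-edge j))))
    walk : ∀ k → Star (Avoids a b) b (c (k ℕ.+ (suc d ℕ.+ i)))
    walk zero    = done
    walk (suc k) = walk k ◅◅ (along _ ◅ done)
    c-g : c (g ℕ.∸ suc d ℕ.+ (suc d ℕ.+ i)) ≡ a
    c-g = trans (cong c (trans (sym (ℕₚ.+-assoc (g ℕ.∸ suc d) (suc d) i))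
      (cong (ℕ._+ i) (ℕₚ.m∸n+n≡m (ℕₚ.<⇒≤ (ℕₚ.<-trans (ℕₚ.n<1+n _) lt)))))) (c-period i)

  cycle-vertices : List V
  cycle-vertices = tabulate vertex

  c∈ : ∀ i → c i ∈ cycle-vertices
  c∈ i = ∈-tabulate⁺ (i mod g)

  ∈⇒c : ∀ {v} → v ∈ cycle-vertices → ∃[ i ] v ≡ c i
  ∈⇒c i = let j , e = ∈-tabulate⁻ i in toℕ j , trans e (cong vertex (Finₚ.toℕ-injective
    (sym (trans (toℕ-mod (toℕ j)) (m<n⇒m%n≡m (Finₚ.toℕ<n j))))))

  c-offset : ∀ i j → ∃[ d ] (d ℕ.< g × c j ≡ c (d ℕ.+ i))
  c-offset i j = d₀ % g , m%n<n d₀ g , c-≡ (begin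
    j % g                 ≡⟨ sym ([m+kn]%n≡m%n j i g) ⟩
    (j ℕ.+ i ℕ.* g) % g   ≡⟨ cong (_% g) (sym (ℕₚ.m+[n∸m]≡n i≤)) ⟩
    (i ℕ.+ d₀) % g        ≡⟨ shift-% d₀ i ⟩
    (i ℕ.+ d₀ % g) % g    ≡⟨ cong (_% g) (ℕₚ.+-comm i (d₀ % g)) ⟩
    (d₀ % g ℕ.+ i) % g    ∎)
    where
    open ≡-Reasoning
    -- Adding i * g preserves the residue and makes the subtraction of i exact.
    d₀ = j ℕ.+ i ℕ.* g ℕ.∸ i
    i≤ : i ℕ.≤ j ℕ.+ i ℕ.* g
    i≤ = ℕₚ.≤-trans (ℕₚ.m≤m*n i g) (ℕₚ.m≤n+m (i ℕ.* g) j)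

  c-neighbour : ∀ {u} j → u ∈ cycle-vertices → u ~ c (suc j) → u ≡ c (2 ℕ.+ j) ⊎ u ≡ c j
  c-neighbour j u∈ p with ∈⇒c u∈
  ... | k , refl with c-offset (suc j) k
  ... | zero , _ , e = contradiction (subst (_~ c (suc j)) e p) ~-irrefl
  ... | suc zero , _ , e = inj₁ e
  ... | suc (suc d) , d<g , e with ℕₚ.m≤n⇒m<n∨m≡n d<g
  ... | inj₁ lt = contradiction (~-sym (subst (_~ c (suc j)) e p)) (c-chordless (suc j) (suc (suc d)) (s≤s (s≤s z≤n)) lt)
  ... | inj₂ eq = inj₂ (trans e (trans (cong c (trans (ℕₚ.+-suc (2 ℕ.+ d) j) (cong (ℕ._+ j) eq))) (c-period j)))

  c-suc : ∀ i → ∃[ j ] c i ≡ c (suc j)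
  c-suc i = ℕ.pred g ℕ.+ i , trans (sym (c-period i)) (cong (λ t → c (t ℕ.+ i)) (sym (ℕₚ.suc-pred g)))

  adj-edge : ∀ {u v} → u ∈ cycle-vertices → v ∈ cycle-vertices → u ~ v → Edge u v
  adj-edge {u} {v} u∈ v∈ p with ∈⇒c v∈
  ... | i , refl with c-suc i
  ... | j , e with c-neighbour j u∈ (subst (u ~_) e p)
  ... | inj₁ e′ = subst₂ Edge (sym e′) (sym e) (edge-sym (c-edge (suc j)))
  ... | inj₂ e′ = subst₂ Edge (sym e′) (sym e) (c-edge j)

  edge∈ : ∀ {u v} → Edge u v → v ∈ cycle-vertices
  edge∈ (i , j , _ , _ , refl) = ∈-tabulate⁺ j

  -- Read backwards, this is an order in which the vertices off the cycle can be
  -- peeled off as leaves.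
  data Grown : List V → Set where
    base : Grown cycle-vertices
    grow : ∀ {R v w} → Grown R → v ∉ R → w ∈ R → v ~ w → (∀ {u} → u ∈ R → v ~ u → u ≡ w) → Grown (v ∷ R)

  Within : List V → V → V → Set
  Within R u v = u ~ v × u ∈ R × v ∈ R

  cycle⊆ : ∀ {R} → Grown R → ∀ {v} → v ∈ cycle-vertices → v ∈ R
  cycle⊆ base i = i
  cycle⊆ (grow γ _ _ _ _) i = there (cycle⊆ γ i)

  -- Supplies the root z that keeps w dominated when a leaf at w is peeled off.
  grown-neighbour : ∀ {R} → Grown R → ∀ {r} → r ∈ R → ∃[ z ] (z ∈ R × z ~ r)
  grown-neighbour base i = let j , e = ∈⇒c i in c (suc j) , c∈ (suc j) , subst (c (suc j) ~_) (sym e) (~-sym (c-adj j))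
  grown-neighbour (grow γ _ w∈ v~w _) (here refl) = _ , there w∈ , ~-sym v~w
  grown-neighbour (grow γ _ _ _ _) (there i) = let z , z∈ , p = grown-neighbour γ i in z , there z∈ , p

  private
    reach : ∀ {R} → Grown R → ∀ {r} → r ∈ R → Star (Within R) (c 0) r
    reach base i = let j , e = ∈⇒c i in subst (Star (Within cycle-vertices) (c 0)) (sym e) (along j)
      where
      along : ∀ j → Star (Within cycle-vertices) (c 0) (c j)
      along zero    = done
      along (suc j) = along j ◅◅ ((c-adj j , c∈ j , c∈ (suc j)) ◅ done)
    reach (grow γ _ w∈ v~w _) (here refl) =
      gmap (λ u → u) (λ (p , i , j) → p , there i , there j) (reach γ w∈) ◅◅ ((~-sym v~w , there w∈ , here refl) ◅ done)
    reach (grow γ _ _ _ _) (there i) = gmap (λ u → u) (λ (p , i , j) → p , there i , there j) (reach γ i)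

  within-connected : ∀ {R} → Grown R → ∀ {u v} → u ∈ R → v ∈ R → Star (Within R) u v
  within-connected γ i j = reverse (λ (p , i , j) → ~-sym p , j , i) (reach γ i) ◅◅ reach γ j

  module _ (connected : Connected G) where
    open import Data.List.Membership.DecPropositional (Finₚ._≟_ {n}) using (_∈?_)

    private
      crossing : ∀ {R u v} → Star _~_ u v → u ∈ R → v ∉ R → ∃[ w ] ∃[ t ] (w ∈ R × t ∉ R × w ~ t)
      crossing done i v∉ = contradiction i v∉
      crossing {R} {u} (_◅_ {j = t} p ps) i v∉ with t ∈? R
      ... | yes j = crossing ps j v∉
      ... | no t∉ = u , t , i , t∉ , p

      -- A second neighbour u of t in R would give a path from t through u to w that avoids the edge
      -- from w to t. By `bridge` this edge would lie on the cycle, and t would be in R.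
      grow-step : ∀ {R} → Grown R → ∀ {v} → v ∉ R → ∃[ t ] (t ∉ R × Grown (t ∷ R))
      grow-step {R} γ {v} v∉ with crossing (connected (c 0) v) (cycle⊆ γ (c∈ 0)) v∉
      ... | w , t , w∈ , t∉ , w~t = t , t∉ , grow γ t∉ w∈ (~-sym w~t) only
        where
        only : ∀ {u} → u ∈ R → t ~ u → u ≡ w
        only {u} u∈ t~u with u Finₚ.≟ w
        ... | yes e = e
        ... | no u≢ = contradiction
              ((t~u , (λ (e , _) → t∉ (subst (_∈ R) (sym e) w∈)) , (λ (_ , e) → u≢ e))
                ◅ gmap (λ s → s) (λ (p , i , j) → p , (λ (_ , e) → t∉ (subst (_∈ R) e j)) , (λ (e , _) → t∉ (subst (_∈ R) e i)))
                    (within-connected γ u∈ w∈))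
              (bridge w~t (λ e → t∉ (cycle⊆ γ (edge∈ e))))

      -- O contains all vertices still outside R, and k bounds its length for the sake of
      -- termination.
      saturate : ∀ k O {R} → length O ℕ.≤ k → (∀ v → v ∈ R ⊎ v ∈ O) → Grown R → ∃[ R′ ] (Grown R′ × ∀ v → v ∈ R′)
      saturate k [] len split γ = _ , γ , λ v → [ (λ i → i) , (λ ()) ]′ (split v)
      saturate (suc k) (o ∷ O) {R} (s≤s len) split γ with o ∈? R
      ... | yes o∈ = saturate k O len
              (λ v → [ inj₁ , (λ { (here refl) → inj₁ o∈ ; (there i) → inj₂ i }) ]′ (split v)) γ
      ... | no o∉ with grow-step γ o∉
      ... | t , t∉ , γ′ = saturate k (filter ≢t? (o ∷ O)) (ℕₚ.≤-pred (ℕₚ.≤-trans (Listₚ.filter-notAll ≢t? (o ∷ O) t∈O) (s≤s len)))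
              split′ γ′
        where
        ≢t? = λ v → ¬? (v Finₚ.≟ t)
        t∈O : Any.Any (λ v → ¬ (v ≢ t)) (o ∷ O)
        t∈O with split t
        ... | inj₁ i = contradiction i t∉
        ... | inj₂ i = lose i (λ ≢ → ≢ refl)
        split′ : ∀ v → v ∈ t ∷ R ⊎ v ∈ filter ≢t? (o ∷ O)
        split′ v with v Finₚ.≟ t | split v
        ... | yes e | _      = inj₁ (here e)
        ... | no _  | inj₁ i = inj₁ (there i)
        ... | no ≢  | inj₂ i = inj₂ (∈-filter⁺ ≢t? i ≢)

    spanning : ∃[ R ] (Grown R × ∀ v → v ∈ R)
    spanning = saturate (length (allFin n)) (allFin n) ℕₚ.≤-refl (λ v → inj₂ (∈-allFin v)) base

-- The trees that the cycle can carry, and the resulting bound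

double≢suc-double : ∀ a b → a ℕ.+ a ≢ suc (b ℕ.+ b)
double≢suc-double (suc a) zero e with trans (sym (ℕₚ.+-suc a a)) (ℕₚ.suc-injective e)
... | ()
double≢suc-double (suc a) (suc b) e = double≢suc-double a b (ℕₚ.suc-injective (trans (sym (ℕₚ.+-suc a a))
  (trans (ℕₚ.suc-injective e) (ℕₚ.+-suc (suc b) b))))

double-injective : ∀ a b → a ℕ.+ a ≡ b ℕ.+ b → a ≡ b
double-injective zero    zero    e = refl
double-injective (suc a) (suc b) e = cong suc (double-injective a b (ℕₚ.suc-injective
  (trans (sym (ℕₚ.+-suc a a)) (trans (ℕₚ.suc-injective e) (ℕₚ.+-suc b b)))))

module Cases {n : ℕ} (G : Graph (Fin n)) (wc : WellCovered G) (x y : ℚ) (y≤0 : y ≤ 0ℚ)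
             (0<1+x : 0ℚ < 1ℚ + x) (sy≡x : (1ℚ + x) * y ≡ x)
             (Z-pos : ∀ {L} → Unique L → ∀ F → 0ℚ < Polynomial.Z G x L F)
             (C : Cycle G) (same : ∀ D → SameCycle C D) where
  open Graph G
  open Polynomial G
  open IndependentLists G
  open PathBounds y y≤0
  open Homogeneous sy≡x
  open Trees G wc x y y≤0 0<1+x sy≡x Z-pos
  open CycleStructure G C same
  open Cycle C using () renaming (len to g; 3≤len to 3≤g)
  open Tree using (vertices)

  peel-to-cycle : ∀ {R} → Grown R → State R → State cycle-vertices
  peel-to-cycle base S = S
  peel-to-cycle (grow γ v∉ w∈ v~w only) S = let z , z∈ , z~w = grown-neighbour γ w∈ in
    peel-to-cycle γ (Peel.peel S v∉ w∈ v~w only z∈ z~w)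

  module _ (S : State cycle-vertices) {half : ℕ} (n-odd : n ≡ suc (half ℕ.+ half)) where
    open State S

    t : ∀ i → Tree (c i)
    t i = tree (c i)

    m : ℕ → ℕ
    m i = Tree.m (tree (c i))

    Bare Heavy Light Stem : V → Set
    Bare r  = leaves (Tree.kind (tree r)) ≡ []
    Heavy r = Bare r × Σ[ O ∈ Off (tree r) ] length (Off.set O) ≡ Tree.m (tree r)
    Light r = Bare r × Tree.A (tree r) ≡ []
    Stem r  = (∃[ l ] leaves (Tree.kind (tree r)) ≡ l ∷ []) × Σ[ O ∈ Off (tree r) ] length (Off.set O) ≡ suc (Tree.m (tree r))

    stem-or-bare : ∀ r → Stem r ⊎ Bare r
    stem-or-bare r with shape (tree r)
    ... | is-light b _   = inj₂ b
    ... | is-heavy b _ _ = inj₂ b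
    ... | is-stem l e _ _ _ _ O len = inj₁ ((l , e) , O , len)

    light-or-heavy : ∀ r → Bare r → Light r ⊎ Heavy r
    light-or-heavy r b with shape (tree r)
    ... | is-light _ e   = inj₁ (b , e)
    ... | is-heavy _ O e = inj₂ (b , O , e)
    ... | is-stem l e _ _ _ _ _ _ = contradiction (trans (sym e) b) λ ()

    -- inn i uses the vertex c i itself, fre i leaves it undominated, and off i
    -- dominates it from within its tree.
    data Sel : Set where
      inn : ℕ → Sel
      fre : ∀ i → Bare (c i) → Sel
      off : ∀ i (O : Off (t i)) k → length (Off.set O) ≡ k → Sel

    position : Sel → ℕ
    position (inn i)       = i
    position (fre i _)     = i
    position (off i _ _ _) = i

    part : Sel → Part own
    part (inn i)       = in-part (c∈ i)
    part (fre i b)     = free-part (c∈ i) b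
    part (off i O _ _) = off-part (c∈ i) O

    size : Sel → ℕ
    size (inn i)       = suc (m i)
    size (fre i _)     = m i
    size (off _ _ k _) = k

    total : List Sel → ℕ
    total []       = 0
    total (s ∷ Ss) = size s ℕ.+ total Ss

    Clash-free : Sel → Sel → Set
    Clash-free (inn i) (inn j) = ¬ (c i ~ c j)
    Clash-free _       _       = ⊤

    Separate : Sel → Sel → Set
    Separate s s′ = c (position s) ≢ c (position s′) × Clash-free s s′

    -- Certificates that the selection Qs dominates c i, so that an exchange is given by data.
    -- `again` identifies indices that name the same cycle vertex.
    data Cov (Qs : List Sel) : ℕ → Set where
      self  : ∀ {i} → inn i ∈ Qs → Cov Qs i
      right : ∀ {i} → inn i ∈ Qs → Cov Qs (suc i)
      left  : ∀ {i} → inn (suc i) ∈ Qs → Cov Qs i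
      inner : ∀ {i O k e} → off i O k e ∈ Qs → Cov Qs i
      again : ∀ {i j} → c i ≡ c j → Cov Qs i → Cov Qs j

    -- Each old part needs a new part at its position and a dominated root. A discarded `inn` was
    -- also dominating its two neighbours on the cycle, hence the three certificates around `suc j`.
    data Replaced (Qs : List Sel) : Sel → Set where
      kept-inn : ∀ {i} → inn i ∈ Qs → Replaced Qs (inn i)
      kept-off : ∀ {i O k e} → off i O k e ∈ Qs → Replaced Qs (off i O k e)
      from-fre : ∀ {i b s} → s ∈ Qs → position s ≡ i → Cov Qs i → Replaced Qs (fre i b)
      from-off : ∀ {i O k e s} → s ∈ Qs → position s ≡ i → Cov Qs i → Replaced Qs (off i O k e)
      from-inn : ∀ {j s} → s ∈ Qs → position s ≡ suc j → Cov Qs j → Cov Qs (suc j) → Cov Qs (2 ℕ.+ j) →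
                 Replaced Qs (inn (suc j))

    private
      root-part : ∀ s → Part.root (part s) ≡ c (position s)
      root-part (inn i)       = refl
      root-part (fre i _)     = refl
      root-part (off i _ _ _) = refl

      separate⇒compatible : ∀ {s s′} → Separate s s′ → Compatible (part s) (part s′)
      separate⇒compatible {inn i}       {inn j}       (≢ , h) = ≢ , λ _ _ → h
      separate⇒compatible {inn i}       {fre j b}     (≢ , _) = ≢ , λ _ k _ → Tree.r∉free (t j) k
      separate⇒compatible {inn i}       {off j O _ _} (≢ , _) = ≢ , λ _ k _ → Off.r∉set O k
      separate⇒compatible {fre i b}     {s}           (≢ , _) = (λ e → ≢ (trans e (root-part s))) , λ k _ _ → Tree.r∉free (t i) k
      separate⇒compatible {off i O _ _} {s}           (≢ , _) = (λ e → ≢ (trans e (root-part s))) , λ k _ _ → Off.r∉set O k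

      compatible : ∀ {Ss} → AllPairs Separate Ss → AllPairs Compatible (map part Ss)
      compatible h = AllPairsₚ.map⁺ (AllPairs.map (λ {s} {s′} → separate⇒compatible {s} {s′}) h)

      part∈ : ∀ {s Ss} → s ∈ Ss → part s ∈ map part Ss
      part∈ = ∈-map⁺ part

      covers-cov : ∀ {Qs i} → Cov Qs i → Covers (union (map part Qs)) (c i)
      covers-cov {Qs} (self {i} k)  = covers-in-self (map part Qs) (c∈ i) (part∈ k)
      covers-cov {Qs} (right {i} k) = covers-in-adj (map part Qs) (c∈ i) (part∈ k) (~-sym (c-adj i))
      covers-cov {Qs} (left {i} k)  = covers-in-adj (map part Qs) (c∈ (suc i)) (part∈ k) (c-adj i)
      covers-cov {Qs} (inner {i} {O} k) = covers-off (map part Qs) (c∈ i) O (part∈ k)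
      covers-cov {Qs} (again e p)   = subst (Covers (union (map part Qs))) e (covers-cov p)

      dominated-by : ∀ {Qs s} → Replaced Qs s → Dominated-by (map part Qs) (part s)
      dominated-by {Qs} (kept-inn {i} k) = (_ , part∈ k , refl) , covers-cov (self k) ,
        λ _ _ p → covers-in-adj (map part Qs) (c∈ i) (part∈ k) p
      dominated-by (kept-off {O = O} k) = (_ , part∈ k , refl) , covers-cov (inner k) , λ j → contradiction j (Off.r∉set O)
      dominated-by (from-fre {i} {s = s} k e p) = (_ , part∈ k , trans (root-part s) (cong c e)) , covers-cov p ,
        λ j → contradiction j (Tree.r∉free (t i))
      dominated-by (from-off {O = O} {s = s} k e p) = (_ , part∈ k , trans (root-part s) (cong c e)) , covers-cov p ,
        λ j → contradiction j (Off.r∉set O)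
      dominated-by {Qs} (from-inn {j} {s} k e p₀ p₁ p₂) = (_ , part∈ k , trans (root-part s) (cong c e)) , covers-cov p₁ ,
        λ _ → neighbour
        where
        neighbour : ∀ {u} → u ∈ cycle-vertices → u ~ c (suc j) → Covers (union (map part Qs)) u
        neighbour u∈ u~ with c-neighbour j u∈ u~
        ... | inj₁ e = subst (Covers (union (map part Qs))) (sym e) (covers-cov p₂)
        ... | inj₂ e = subst (Covers (union (map part Qs))) (sym e) (covers-cov p₀)

      sizes-total : ∀ Ss → sizes (map part Ss) ≡ total Ss
      sizes-total []       = refl
      sizes-total (s ∷ Ss) = cong₂ ℕ._+_ (size-part s) (sizes-total Ss)
        where
        size-part : ∀ s → length (Part.set (part s)) ≡ size s
        size-part (inn i)       = ∣in∣ (c∈ i)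
        size-part (fre i b)     = Tree.∣free∣ (t i)
        size-part (off i O k e) = e

    exchange : ∀ Ps Qs → AllPairs Separate Ps → AllPairs Separate Qs → All (Replaced Qs) Ps → ¬ (total Ps ≡ suc (total Qs))
    exchange Ps Qs sP sQ h e = swap-contradiction (compatible sP) (compatible sQ)
      (Allₚ.map⁺ (All.map dominated-by h))
      (trans (sizes-total Ps) (trans e (cong suc (sym (sizes-total Qs)))))

    private
      le : ∀ {k j} → j ℕ.≤ g → {_ : True (k ℕₚ.≤? j)} → k ℕ.≤ g
      le h {w} = ℕₚ.≤-trans (toWitness w) h

      dist : ∀ {j} i d → j ℕ.≤ g → {_ : True (suc d ℕₚ.≤? j)} → {_ : True (1 ℕₚ.≤? d)} → c i ≢ c (d ℕ.+ i)
      dist i d h {u} {v} = c-distinct i d (toWitness v) (le h {u})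

      apart : ∀ {j} i d → j ℕ.≤ g → {_ : True (2 ℕ.+ d ℕₚ.≤? j)} → {_ : True (2 ℕₚ.≤? d)} →
              c i ≢ c (d ℕ.+ i) × ¬ (c i ~ c (d ℕ.+ i))
      apart i d h {u} {v} = c-distinct i d (ℕₚ.≤-trans (s≤s z≤n) (toWitness v)) (ℕₚ.≤-trans (ℕₚ.n≤1+n _) (le h {u})) ,
        c-chordless i d (toWitness v) (le h {u})

      away : ∀ {j} i d → j ℕ.≤ g → {_ : True (suc d ℕₚ.≤? j)} → {_ : True (1 ℕₚ.≤? d)} → c i ≢ c (d ℕ.+ i) × ⊤
      away i d h {u} {v} = dist i d h {u} {v} , tt

      pattern 0# = here refl
      pattern 1# = there 0#
      pattern 2# = there 1#
      pattern 3# = there 2#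
      pattern 4# = there 3#

    module StemThenBare (b : ℕ) (stem : Stem (c b)) (bare : Bare (c (suc b))) where
      private
        b₁ b₂ b₃ : ℕ
        b₁ = 1 ℕ.+ b
        b₂ = 2 ℕ.+ b
        b₃ = 3 ℕ.+ b

        out : Sel
        out = off b (proj₁ (proj₂ stem)) (suc (m b)) (proj₂ (proj₂ stem))

      -- A stem costs the same used or avoided, so moving from the bare c (b + 1) to c b loses one
      -- vertex. The vertex c (b + 3) keeps c (b + 2) dominated and is nonadjacent to c b once g ≥
      -- 5.
      g≤4 : ¬ (5 ℕ.≤ g)
      g≤4 h = exchange
        (out ∷ inn b₁ ∷ inn b₃ ∷ [])
        (inn b ∷ fre b₁ bare ∷ inn b₃ ∷ [])
        ((away b 1 h ∷ away b 3 h ∷ []) ∷ (apart b₁ 2 h ∷ []) ∷ [] ∷ [])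
        ((away b 1 h ∷ apart b 3 h ∷ []) ∷ (away b₁ 2 h ∷ []) ∷ [] ∷ [])
        (from-off 0# refl (self 0#) ∷ from-inn 1# refl (self 0#) (right 0#) (left 2#) ∷ kept-inn 2# ∷ [])
        (count (m b) (m b₁) (m b₃))
        where
        count : ∀ a b c → suc a ℕ.+ (suc b ℕ.+ (suc c ℕ.+ 0)) ≡ suc (suc a ℕ.+ (b ℕ.+ (suc c ℕ.+ 0)))
        count = solve-∀

      -- The same move, with c (b + 2) dominated from within its own tree; it works for a triangle
      -- as well.
      not-stem : ¬ Stem (c b₂)
      not-stem (_ , O₂ , e₂) = exchange
        (out ∷ inn b₁ ∷ out₂ ∷ [])
        (inn b ∷ fre b₁ bare ∷ out₂ ∷ [])
        ((away b 1 3≤g ∷ away b 2 3≤g ∷ []) ∷ (away b₁ 1 3≤g ∷ []) ∷ [] ∷ [])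
        ((away b 1 3≤g ∷ away b 2 3≤g ∷ []) ∷ (away b₁ 1 3≤g ∷ []) ∷ [] ∷ [])
        (from-off 0# refl (self 0#) ∷ from-inn 1# refl (self 0#) (right 0#) (inner 2#) ∷ kept-off 2# ∷ [])
        (count (m b) (m b₁) (m b₂))
        where
        out₂ : Sel
        out₂ = off b₂ O₂ (suc (m b₂)) e₂
        count : ∀ a b c → suc a ℕ.+ (suc b ℕ.+ (suc c ℕ.+ 0)) ≡ suc (suc a ℕ.+ (b ℕ.+ (suc c ℕ.+ 0)))
        count = solve-∀

      -- The opposite pairs of a 4-cycle are interchanged. The stem c b counts the same either way,
      -- so two bare vertices are traded for one.
      not-three-bare : g ≡ 4 → Bare (c b₂) → ¬ Bare (c b₃)
      not-three-bare g≡4 bare₂ bare₃ = exchange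
        (out ∷ inn b₁ ∷ fre b₂ bare₂ ∷ inn b₃ ∷ [])
        (inn b ∷ fre b₁ bare ∷ inn b₂ ∷ fre b₃ bare₃ ∷ [])
        ((away b 1 h ∷ away b 2 h ∷ away b 3 h ∷ []) ∷ (away b₁ 1 h ∷ apart b₁ 2 h ∷ [])
          ∷ (away b₂ 1 h ∷ []) ∷ [] ∷ [])
        ((away b 1 h ∷ apart b 2 h ∷ away b 3 h ∷ []) ∷ (away b₁ 1 h ∷ away b₁ 2 h ∷ [])
          ∷ (away b₂ 1 h ∷ []) ∷ [] ∷ [])
        (from-off 0# refl (self 0#) ∷ from-inn 1# refl (self 0#) (right 0#) (self 2#) ∷ from-fre 2# refl (self 2#)
          ∷ from-inn 3# refl (self 2#) (right 2#) (again (sym c4) (self 0#)) ∷ [])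
        (count (m b) (m b₁) (m b₂) (m b₃))
        where
        h : 4 ℕ.≤ g
        h = ℕₚ.≤-reflexive (sym g≡4)
        c4 : c (4 ℕ.+ b) ≡ c b
        c4 = trans (cong (λ k → c (k ℕ.+ b)) (sym g≡4)) (c-period b)
        count : ∀ a b c d → suc a ℕ.+ (suc b ℕ.+ (c ℕ.+ (suc d ℕ.+ 0))) ≡ suc (suc a ℕ.+ (b ℕ.+ (suc c ℕ.+ (d ℕ.+ 0))))
        count = solve-∀

    module AllBare (bare : ∀ i → Bare (c i)) where

      private
        free : ℕ → Sel
        free i = fre i (bare i)

        out : ∀ i → Heavy (c i) → Sel
        out i (_ , O , e) = off i O (m i) e

      -- The basic exchange: 2 and 4 are traded for 3, which dominates both. Their outer neighbours
      -- 1 and 5 stay dominated by 0 and 6, which are nonadjacent once g ≥ 8.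
      g≤7 : ¬ (8 ℕ.≤ g)
      g≤7 h = exchange
        (inn 0 ∷ inn 2 ∷ free 3 ∷ inn 4 ∷ inn 6 ∷ [])
        (inn 0 ∷ free 2 ∷ inn 3 ∷ free 4 ∷ inn 6 ∷ [])
        ((apart 0 2 h ∷ away 0 3 h ∷ apart 0 4 h ∷ apart 0 6 h ∷ []) ∷ (away 2 1 h ∷ apart 2 2 h ∷ apart 2 4 h ∷ [])
          ∷ (away 3 1 h ∷ away 3 3 h ∷ []) ∷ (apart 4 2 h ∷ []) ∷ [] ∷ [])
        ((away 0 2 h ∷ apart 0 3 h ∷ away 0 4 h ∷ apart 0 6 h ∷ []) ∷ (away 2 1 h ∷ away 2 2 h ∷ away 2 4 h ∷ [])
          ∷ (away 3 1 h ∷ apart 3 3 h ∷ []) ∷ (away 4 2 h ∷ []) ∷ [] ∷ [])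
        (kept-inn 0# ∷ from-inn 1# refl (right 0#) (left 2#) (self 2#) ∷ from-fre 2# refl (self 2#)
          ∷ from-inn 3# refl (self 2#) (right 2#) (left 4#) ∷ kept-inn 4# ∷ [])
        (count (m 0) (m 2) (m 3) (m 4) (m 6))
        where
        count : ∀ a b c d e → suc a ℕ.+ (suc b ℕ.+ (c ℕ.+ (suc d ℕ.+ (suc e ℕ.+ 0))))
                            ≡ suc (suc a ℕ.+ (b ℕ.+ (suc c ℕ.+ (d ℕ.+ (suc e ℕ.+ 0)))))
        count = solve-∀

      -- Here b + 1 and b + 3 are traded for b + 2. The outer neighbour b is dominated from within
      -- its tree, the other one, b + 4, by b + 5.
      not-heavy-7 : g ≡ 7 → ∀ b → ¬ Heavy (c b)
      not-heavy-7 g≡7 b hv = exchange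
        (out b hv ∷ inn b₁ ∷ free b₂ ∷ inn b₃ ∷ inn b₅ ∷ [])
        (out b hv ∷ free b₁ ∷ inn b₂ ∷ free b₃ ∷ inn b₅ ∷ [])
        ((away b 1 h ∷ away b 2 h ∷ away b 3 h ∷ away b 5 h ∷ [])
          ∷ (away b₁ 1 h ∷ apart b₁ 2 h ∷ apart b₁ 4 h ∷ [])
          ∷ (away b₂ 1 h ∷ away b₂ 3 h ∷ []) ∷ (apart b₃ 2 h ∷ []) ∷ [] ∷ [])
        ((away b 1 h ∷ away b 2 h ∷ away b 3 h ∷ away b 5 h ∷ [])
          ∷ (away b₁ 1 h ∷ away b₁ 2 h ∷ away b₁ 4 h ∷ [])
          ∷ (away b₂ 1 h ∷ apart b₂ 3 h ∷ []) ∷ (away b₃ 2 h ∷ []) ∷ [] ∷ [])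
        (kept-off 0# ∷ from-inn 1# refl (inner 0#) (left 2#) (self 2#) ∷ from-fre 2# refl (self 2#)
          ∷ from-inn 3# refl (self 2#) (right 2#) (left 4#) ∷ kept-inn 4# ∷ [])
        (count (m b) (m b₁) (m b₂) (m b₃) (m b₅))
        where
        b₁ = 1 ℕ.+ b
        b₂ = 2 ℕ.+ b
        b₃ = 3 ℕ.+ b
        b₅ = 5 ℕ.+ b
        h : 7 ℕ.≤ g
        h = ℕₚ.≤-reflexive (sym g≡7)
        count : ∀ a b c d e → a ℕ.+ (suc b ℕ.+ (c ℕ.+ (suc d ℕ.+ (suc e ℕ.+ 0))))
                            ≡ suc (a ℕ.+ (b ℕ.+ (suc c ℕ.+ (d ℕ.+ (suc e ℕ.+ 0)))))
        count = solve-∀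

      -- Here b + 2 and b + 4 are traded for b + 3. Both outer neighbours, b + 1 and b, are
      -- dominated from within their trees.
      not-adjacent-heavy-5 : g ≡ 5 → ∀ b → Heavy (c b) → ¬ Heavy (c (1 ℕ.+ b))
      not-adjacent-heavy-5 g≡5 b hv hv₁ = exchange
        (out b hv ∷ out b₁ hv₁ ∷ inn b₂ ∷ free b₃ ∷ inn b₄ ∷ [])
        (out b hv ∷ out b₁ hv₁ ∷ free b₂ ∷ inn b₃ ∷ free b₄ ∷ [])
        ((away b 1 h ∷ away b 2 h ∷ away b 3 h ∷ away b 4 h ∷ [])
          ∷ (away b₁ 1 h ∷ away b₁ 2 h ∷ away b₁ 3 h ∷ [])
          ∷ (away b₂ 1 h ∷ apart b₂ 2 h ∷ []) ∷ (away b₃ 1 h ∷ []) ∷ [] ∷ [])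
        ((away b 1 h ∷ away b 2 h ∷ away b 3 h ∷ away b 4 h ∷ [])
          ∷ (away b₁ 1 h ∷ away b₁ 2 h ∷ away b₁ 3 h ∷ [])
          ∷ (away b₂ 1 h ∷ away b₂ 2 h ∷ []) ∷ (away b₃ 1 h ∷ []) ∷ [] ∷ [])
        (kept-off 0# ∷ kept-off 1# ∷ from-inn 2# refl (inner 1#) (left 3#) (self 3#) ∷ from-fre 3# refl (self 3#)
          ∷ from-inn 4# refl (self 3#) (right 3#) (again (sym c5) (inner 0#)) ∷ [])
        (count (m b) (m b₁) (m b₂) (m b₃) (m b₄))
        where
        b₁ = 1 ℕ.+ b
        b₂ = 2 ℕ.+ b
        b₃ = 3 ℕ.+ b
        b₄ = 4 ℕ.+ b
        h : 5 ℕ.≤ g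
        h = ℕₚ.≤-reflexive (sym g≡5)
        c5 : c (5 ℕ.+ b) ≡ c b
        c5 = trans (cong (λ k → c (k ℕ.+ b)) (sym g≡5)) (c-period b)
        count : ∀ a b c d e → a ℕ.+ (b ℕ.+ (suc c ℕ.+ (d ℕ.+ (suc e ℕ.+ 0))))
                            ≡ suc (a ℕ.+ (b ℕ.+ (c ℕ.+ (suc d ℕ.+ (e ℕ.+ 0)))))
        count = solve-∀

      -- When the other two corners are dominated from within, a heavy corner can be used or avoided
      -- with the same vertices dominated, but avoiding it loses one.
      not-three-heavy-3 : g ≡ 3 → Heavy (c 0) → Heavy (c 1) → ¬ Heavy (c 2)
      not-three-heavy-3 g≡3 hv₀ hv₁ hv₂ = exchange
        (out 0 hv₀ ∷ inn 1 ∷ out 2 hv₂ ∷ [])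
        (out 0 hv₀ ∷ out 1 hv₁ ∷ out 2 hv₂ ∷ [])
        ((away 0 1 3≤g ∷ away 0 2 3≤g ∷ []) ∷ (away 1 1 3≤g ∷ []) ∷ [] ∷ [])
        ((away 0 1 3≤g ∷ away 0 2 3≤g ∷ []) ∷ (away 1 1 3≤g ∷ []) ∷ [] ∷ [])
        (kept-off 0# ∷ from-inn 1# refl (inner 0#) (inner 1#) (inner 2#) ∷ kept-off 2# ∷ [])
        (count (m 0) (m 1) (m 2))
        where
        count : ∀ a b c → a ℕ.+ (suc b ℕ.+ (c ℕ.+ 0)) ≡ suc (a ℕ.+ (b ℕ.+ (c ℕ.+ 0)))
        count = solve-∀

    forest : ℕ → ℕ → List V
    forest b zero    = []
    forest b (suc k) = vertices (t b) ++ forest (suc b) k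

    private
      mem-t⁺ : ∀ i {v} → v ∈ vertices (t i) → own v ≡ c i
      mem-t⁺ i = mem⁺ (c∈ i)

      forest⁻ : ∀ b k {v} → v ∈ forest b k → ∃[ i ] (i ℕ.< k × own v ≡ c (i ℕ.+ b))
      forest⁻ b (suc k) i with ∈-++⁻ (vertices (t b)) i
      ... | inj₁ j = 0 , s≤s z≤n , mem-t⁺ b j
      ... | inj₂ j = let d , d<k , e = forest⁻ (suc b) k j in suc d , s≤s d<k , trans e (cong c (ℕₚ.+-suc d b))

      forest⁺ : ∀ b k d → d ℕ.< k → ∀ {v} → own v ≡ c (d ℕ.+ b) → v ∈ forest b k
      forest⁺ b (suc k) zero    _         e = ∈-++⁺ˡ (mem⁻ (c∈ b) e)
      forest⁺ b (suc k) (suc d) (s≤s d<k) e = ∈-++⁺ʳ (vertices (t b))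
        (forest⁺ (suc b) k d d<k (trans e (cong c (sym (ℕₚ.+-suc d b)))))

      forest-unique : ∀ b k → k ℕ.≤ g → Unique (forest b k)
      forest-unique b zero    _   = []
      forest-unique b (suc k) k<g = unique-++ (Tree.vertices-unique (t b)) (forest-unique (suc b) k (ℕₚ.<⇒≤ k<g)) disjoint
        where
        disjoint : ∀ {v} → v ∈ vertices (t b) → v ∉ forest (suc b) k
        disjoint i j with forest⁻ (suc b) k j
        ... | d , d<k , e = c-distinct b (suc d) (s≤s z≤n) (ℕₚ.≤-trans (s≤s d<k) k<g)
                (trans (sym (mem-t⁺ b i)) (trans e (cong c (ℕₚ.+-suc d b))))

      forest-↭ : ∀ b → allFin n ↭ forest b g
      forest-↭ b = unique-↭ (Uniqueₚ.allFin⁺ n) (forest-unique b g ℕₚ.≤-refl) (λ {v} _ → complete v) (λ _ → ∈-allFin _)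
        where
        complete : ∀ v → v ∈ forest b g
        complete v with ∈⇒c (own∈ v)
        ... | j , e with c-offset b j
        ... | d , d<g , e′ = forest⁺ b g d d<g (trans e e′)

      n-forest : ∀ b {k} → g ≡ k → n ≡ length (forest b k)
      n-forest b refl = trans (sym (Listₚ.length-tabulate _)) (↭-length (forest-↭ b))

      length-∷ : ∀ b k → length (forest b (suc k)) ≡ length (vertices (t b)) ℕ.+ length (forest (suc b) k)
      length-∷ b k = Listₚ.length-++ (vertices (t b))

      length-leaves : ∀ i {L} → leaves (Tree.kind (t i)) ≡ L → length (vertices (t i)) ≡ suc (length L ℕ.+ (m i ℕ.+ m i))
      length-leaves i e = cong suc (trans (Listₚ.length-++ (leaves (Tree.kind (t i)))) (cong₂ ℕ._+_ (cong length e) (Tree.∣A∣ (t i))))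

      length-bare : ∀ i → Bare (c i) → length (vertices (t i)) ≡ suc (m i ℕ.+ m i)
      length-bare i e = length-leaves i e

      length-stem : ∀ i → Stem (c i) → length (vertices (t i)) ≡ 2 ℕ.+ (m i ℕ.+ m i)
      length-stem i ((l , e) , _) = length-leaves i e

      not-even : ∀ e → n ≢ e ℕ.+ e
      not-even e p = double≢suc-double e half (trans (sym p) n-odd)

      stems-even : ∀ b k → (∀ i → i ℕ.< k → Stem (c (i ℕ.+ b))) → ∃[ e ] length (forest b k) ≡ e ℕ.+ e
      stems-even b zero    _ = 0 , refl
      stems-even b (suc k) h =
        let e , p = stems-even (suc b) k (λ i i<k → subst (λ j → Stem (c j)) (sym (ℕₚ.+-suc i b)) (h (suc i) (s≤s i<k))) in
        suc (m b ℕ.+ e) , trans (length-∷ b k) (trans (cong₂ ℕ._+_ (length-stem b (h 0 (s≤s z≤n))) p) (arith (m b) e))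
        where
        arith : ∀ a e → 2 ℕ.+ (a ℕ.+ a) ℕ.+ (e ℕ.+ e) ≡ suc (a ℕ.+ e) ℕ.+ suc (a ℕ.+ e)
        arith = solve-∀

      bares : (∀ i → Bare (c i)) → ∀ b k → ∃[ e ] length (forest b k) ≡ k ℕ.+ (e ℕ.+ e)
      bares h b zero    = 0 , refl
      bares h b (suc k) = let e , p = bares h (suc b) k in
        m b ℕ.+ e , trans (length-∷ b k) (trans (cong₂ ℕ._+_ (length-bare b (h b)) p) (arith (m b) k e))
        where
        arith : ∀ a k e → suc (a ℕ.+ a) ℕ.+ (k ℕ.+ (e ℕ.+ e)) ≡ suc k ℕ.+ (a ℕ.+ e ℕ.+ (a ℕ.+ e))
        arith = solve-∀

      -- Going round from a stem, either only stems are met or some stem is directly followed by a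
      -- bare vertex, as `StemThenBare` requires.
      stem-run : ∀ b → Stem (c b) → ∀ k → (∀ i → i ℕ.< k → Stem (c (i ℕ.+ b))) ⊎ ∃[ i ] (Stem (c (i ℕ.+ b)) × Bare (c (suc i ℕ.+ b)))
      stem-run b st zero = inj₁ λ _ ()
      stem-run b st (suc zero) = inj₁ λ { zero _ → st ; (suc i) (s≤s ()) }
      stem-run b st (suc (suc k)) = next (stem-run b st (suc k)) (stem-or-bare (c (suc k ℕ.+ b)))
        where
        Run : ℕ → Set
        Run k = ∀ i → i ℕ.< k → Stem (c (i ℕ.+ b))
        extend-run : Run (suc k) → Stem (c (suc k ℕ.+ b)) → ∀ i → i ℕ.< suc k ⊎ i ≡ suc k → Stem (c (i ℕ.+ b))
        extend-run all st′ i (inj₁ lt)   = all i lt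
        extend-run all st′ i (inj₂ refl) = st′
        Change : Set
        Change = ∃[ i ] (Stem (c (i ℕ.+ b)) × Bare (c (suc i ℕ.+ b)))
        next : Run (suc k) ⊎ Change → Stem (c (suc k ℕ.+ b)) ⊎ Bare (c (suc k ℕ.+ b)) → Run (2 ℕ.+ k) ⊎ Change
        next (inj₂ found) _           = inj₂ found
        next (inj₁ all)   (inj₁ st′)  = inj₁ λ i i≤ → extend-run all st′ i (ℕₚ.m≤n⇒m<n∨m≡n (ℕₚ.≤-pred i≤))
        next (inj₁ all)   (inj₂ ba)   = inj₂ (k , all k ℕₚ.≤-refl , ba)

      3or4 : ¬ (5 ℕ.≤ g) → g ≡ 3 ⊎ g ≡ 4
      3or4 h with ℕₚ.m≤n⇒m<n∨m≡n 3≤g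
      ... | inj₂ e  = inj₁ (sym e)
      ... | inj₁ lt with ℕₚ.m≤n⇒m<n∨m≡n lt
      ... | inj₂ e  = inj₂ (sym e)
      ... | inj₁ ge = contradiction ge h

      stem-bare-bare : ∀ b → Stem (c b) → Bare (c (1 ℕ.+ b)) → Bare (c (2 ℕ.+ b)) → g ≢ 3
      stem-bare-bare b st ba ba₂ g≡3 = not-even (2 ℕ.+ (m b ℕ.+ (m (1 ℕ.+ b) ℕ.+ m (2 ℕ.+ b)))) (trans (n-forest b g≡3)
        (trans (trans (length-∷ b 2) (cong₂ ℕ._+_ (length-stem b st) (trans (length-∷ (1 ℕ.+ b) 1)
                 (cong₂ ℕ._+_ (length-bare (1 ℕ.+ b) ba) (trans (length-∷ (2 ℕ.+ b) 0)
                   (cong (ℕ._+ 0) (length-bare (2 ℕ.+ b) ba₂)))))))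
          (arith (m b) (m (1 ℕ.+ b)) (m (2 ℕ.+ b)))))
        where
        arith : ∀ a b c → 2 ℕ.+ (a ℕ.+ a) ℕ.+ (suc (b ℕ.+ b) ℕ.+ (suc (c ℕ.+ c) ℕ.+ 0)) ≡ 2 ℕ.+ (a ℕ.+ (b ℕ.+ c)) ℕ.+ (2 ℕ.+ (a ℕ.+ (b ℕ.+ c)))
        arith = solve-∀

      stem-bare-bare-stem : ∀ b → Stem (c b) → Bare (c (1 ℕ.+ b)) → Bare (c (2 ℕ.+ b)) → Stem (c (3 ℕ.+ b)) → g ≢ 4
      stem-bare-bare-stem b st ba ba₂ st₃ g≡4 =
        not-even (3 ℕ.+ (m b ℕ.+ (m (1 ℕ.+ b) ℕ.+ (m (2 ℕ.+ b) ℕ.+ m (3 ℕ.+ b))))) (trans (n-forest b g≡4)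
        (trans (trans (length-∷ b 3) (cong₂ ℕ._+_ (length-stem b st) (trans (length-∷ (1 ℕ.+ b) 2)
                 (cong₂ ℕ._+_ (length-bare (1 ℕ.+ b) ba) (trans (length-∷ (2 ℕ.+ b) 1)
                   (cong₂ ℕ._+_ (length-bare (2 ℕ.+ b) ba₂) (trans (length-∷ (3 ℕ.+ b) 0)
                     (cong (ℕ._+ 0) (length-stem (3 ℕ.+ b) st₃)))))))))
          (arith (m b) (m (1 ℕ.+ b)) (m (2 ℕ.+ b)) (m (3 ℕ.+ b)))))
        where
        arith : ∀ a b c d → 2 ℕ.+ (a ℕ.+ a) ℕ.+ (suc (b ℕ.+ b) ℕ.+ (suc (c ℕ.+ c) ℕ.+ (2 ℕ.+ (d ℕ.+ d) ℕ.+ 0)))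
                ≡ 3 ℕ.+ (a ℕ.+ (b ℕ.+ (c ℕ.+ d))) ℕ.+ (3 ℕ.+ (a ℕ.+ (b ℕ.+ (c ℕ.+ d))))
        arith = solve-∀

      stem-bare : ∀ b → Stem (c b) → Bare (c (1 ℕ.+ b)) → Stem (c (2 ℕ.+ b)) ⊎ Bare (c (2 ℕ.+ b)) →
                  g ≡ 3 ⊎ g ≡ 4 → Stem (c (3 ℕ.+ b)) ⊎ Bare (c (3 ℕ.+ b)) → ⊥
      stem-bare b st ba (inj₁ st₂) _ _ = StemThenBare.not-stem b st ba st₂
      stem-bare b st ba (inj₂ ba₂) (inj₁ g≡3) _ = stem-bare-bare b st ba ba₂ g≡3
      stem-bare b st ba (inj₂ ba₂) (inj₂ g≡4) (inj₁ st₃) = stem-bare-bare-stem b st ba ba₂ st₃ g≡4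
      stem-bare b st ba (inj₂ ba₂) (inj₂ g≡4) (inj₂ ba₃) = StemThenBare.not-three-bare b st ba g≡4 ba₂ ba₃

      -- All stems would make n even. Otherwise a bare vertex follows a stem and g is 3 or 4; each
      -- remaining pattern falls to an exchange or has an even number of vertices.
      no-stem : ∀ b → ¬ Stem (c b)
      no-stem b₀ st₀ = [ all-stems , (λ (i , st , ba) → change (i ℕ.+ b₀) st ba) ]′ (stem-run b₀ st₀ g)
        where
        all-stems : ¬ (∀ i → i ℕ.< g → Stem (c (i ℕ.+ b₀)))
        all-stems all = not-even (proj₁ (stems-even b₀ g all)) (trans (n-forest b₀ refl) (proj₂ (stems-even b₀ g all)))
        change : ∀ b → Stem (c b) → ¬ Bare (c (1 ℕ.+ b))
        change b st ba = stem-bare b st ba (stem-or-bare _) (3or4 (StemThenBare.g≤4 b st ba)) (stem-or-bare _)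

      bare : ∀ i → Bare (c i)
      bare i = [ (λ st → contradiction st (no-stem i)) , (λ ba → ba) ]′ (stem-or-bare (c i))

      open AllBare bare

      module T (i : ℕ) = Tree (t i)

      Z-all : ℚ
      Z-all = Z x (allFin n) []

      vertices-bare : ∀ i → vertices (t i) ≡ c i ∷ T.A i
      vertices-bare i = cong (λ L → c i ∷ L ++ T.A i) (bare i)

      vertices-light : ∀ i → Light (c i) → vertices (t i) ≡ c i ∷ []
      vertices-light i (_ , e) = trans (vertices-bare i) (cong (c i ∷_) e)

      hang-≁ : ∀ {i j} → c i ≢ c j → ∀ {u v} → u ∈ T.A i → v ∈ vertices (t j) → ¬ (u ~ v)
      hang-≁ {i} {j} i≢j u∈ v∈ p = T.r∉A i (subst (_∈ T.A i) (trans (proj₁ (adj-root p owners)) (mem-t⁺ i (T.A⊆ i u∈))) u∈)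
        where owners = λ e → i≢j (trans (sym (mem-t⁺ i (T.A⊆ i u∈))) (trans e (mem-t⁺ j v∈)))

      root∈ : ∀ j → c j ∈ vertices (t j)
      root∈ j = here refl

      -- The cycle neighbour c l, stripped of its own tree, acts as a leaf of c i. The value at y is
      -- thereby, up to a power of 1 + x, the polynomial of an induced subgraph.
      tree-positive : ∀ i l → c l ~ c i → c i ≢ c l → 0ℚ < T.α i + y * T.β i
      tree-positive i l l~i i≢l = 0<-*-cancelˡ (pow-pos (suc (m i)) 0<1+x) (subst (0ℚ <_) value
        (Z-pos (unique-∷ (λ { (here e) → i≢l e ; (there k) → T.r∉A i k }) (unique-∷ l∉A (T.A-unique i))) []))
        where
        l∉A : c l ∉ T.A i
        l∉A k = i≢l (trans (sym (mem-t⁺ i (T.A⊆ i k))) (mem-t⁺ l (root∈ l)))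
        value : Z x (c i ∷ c l ∷ T.A i) [] ≡ pow s (suc (m i)) * (T.α i + y * T.β i)
        value = trans (Z-stem x (c i) (c l) (T.A i) l~i (λ k → hang-≁ i≢l k (root∈ l)))
          (trans (cong₂ (λ a b → s * a + x * b) (T.Z-α i) (T.Z-β i))
            (stem-value (pow s (m i)) (T.α i) (T.β i)))

      Bound : Set
      Bound = Z-all ≤ pow s half * q y (2 ℕ.+ half)

      conclude : ∀ {N α β} → Bounded N α β → n ≡ suc (N ℕ.+ N) → Z-all ≡ pow s N * (α + y * β) → Bound
      conclude {N} {α} {β} B n≡ Z≡ = subst (λ k → Z-all ≤ pow s k * q y (2 ℕ.+ k)) N≡half
        (ℚₚ.≤-trans (ℚₚ.≤-reflexive Z≡) (*-monoˡ-≤ (ℚₚ.<⇒≤ (pow-pos N 0<1+x))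
          (Dominated.total (Bounded.dominated B (0<-*-cancelˡ (pow-pos N 0<1+x)
            (subst (0ℚ <_) Z≡ (Z-pos (Uniqueₚ.allFin⁺ n) [])))))))
        where
        N≡half : N ≡ half
        N≡half = double-injective N half (ℕₚ.suc-injective (trans (sym n≡) n-odd))

      triangle-bound : g ≡ 3 → ∀ b → Light (c b) → Bound
      triangle-bound g≡3 b li = conclude
        (bounded-graft (T.bounded b₁) (T.bounded b₂) (tree-positive b₂ b (subst (_~ c b₂) c3 (~-sym (c-adj b₂))) (λ e → dist b 2 3≤g (sym e))))
        (trans (n-forest b g≡3) (trans (trans (length-∷ b 2) (cong₂ ℕ._+_ (cong length (vertices-light b li))
            (trans (length-∷ b₁ 1) (cong₂ ℕ._+_ (length-bare b₁ (bare b₁)) (trans (length-∷ b₂ 0) (cong (ℕ._+ 0) (length-bare b₂ (bare b₂))))))))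
          (arith (m b₁) (m b₂))))
        (trans (Z-↭ x [] perm) (trans (Z-triangle x b≁C c≁B B≁C (c-adj b₁) (~-sym (c-adj b)) (subst (c b₂ ~_) c3 (c-adj b₂)) a≁R)
          (trans (cong₂ (λ f f′ → s * f + x * f′) (cong₂ _*_ (T.Z-α b₁) (T.Z-α b₂))
                   (cong₂ _+_ (cong₂ _*_ (T.Z-α b₁) (T.Z-β b₂)) (cong₂ _*_ (T.Z-β b₁) (T.Z-α b₂))))
            (triangle-value (m b₁) (m b₂) (T.α b₁) (T.β b₁) (T.α b₂) (T.β b₂)))))
        where
        b₁ = 1 ℕ.+ b
        b₂ = 2 ℕ.+ b
        c3 : c (3 ℕ.+ b) ≡ c b
        c3 = trans (cong (λ k → c (k ℕ.+ b)) (sym g≡3)) (c-period b)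
        b≁C : c b₁ ≁* T.A b₂
        b≁C k = hang-≁ (λ e → dist b₁ 1 3≤g (sym e)) k (root∈ b₁)
        c≁B : c b₂ ≁* T.A b₁
        c≁B k = hang-≁ (dist b₁ 1 3≤g) k (root∈ b₂)
        B≁C : ∀ {u v} → u ∈ T.A b₁ → v ∈ T.A b₂ → ¬ (v ~ u)
        B≁C k k′ = hang-≁ (λ e → dist b₁ 1 3≤g (sym e)) k′ (T.A⊆ b₁ k)
        a≁R : c b ≁* (T.A b₁ ++ T.A b₂)
        a≁R k with ∈-++⁻ (T.A b₁) k
        ... | inj₁ k′ = hang-≁ (λ e → dist b 1 3≤g (sym e)) k′ (root∈ b)
        ... | inj₂ k′ = hang-≁ (λ e → dist b 2 3≤g (sym e)) k′ (root∈ b)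
        perm : allFin n ↭ c b ∷ c b₁ ∷ c b₂ ∷ T.A b₁ ++ T.A b₂
        perm = ↭-trans (subst (λ k → allFin n ↭ forest b k) g≡3 (forest-↭ b)) (↭-trans
          (↭-reflexive (cong₂ _++_ (vertices-light b li) (cong₂ _++_ (vertices-bare b₁) (cong (_++ []) (vertices-bare b₂)))))
          (↭-prep (c b) (↭-prep (c b₁) (↭-trans (shift (c b₂) (T.A b₁) (T.A b₂ ++ []))
            (↭-prep (c b₂) (↭-reflexive (cong (T.A b₁ ++_) (Listₚ.++-identityʳ (T.A b₂)))))))))
        arith : ∀ a b → 1 ℕ.+ (suc (a ℕ.+ a) ℕ.+ (suc (b ℕ.+ b) ℕ.+ 0)) ≡ suc (suc (a ℕ.+ b) ℕ.+ suc (a ℕ.+ b))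
        arith = solve-∀

      -- The three light corners act like one vertex joined to both tree roots, hence the graft onto
      -- `bounded-point`. As substitute leaves, b + 4 serves b and b + 3 serves b + 2.
      pentagon-bound : g ≡ 5 → ∀ b → Light (c (1 ℕ.+ b)) → Light (c (3 ℕ.+ b)) → Light (c (4 ℕ.+ b)) → Bound
      pentagon-bound g≡5 b l₁ l₃ l₄ = conclude
        (bounded-graft (bounded-graft bounded-point (T.bounded b)
            (tree-positive b b₄ f~b (dist b 4 h)))
          (T.bounded b₂) (tree-positive b₂ b₃ (~-sym (c-adj b₂)) (dist b₂ 1 h)))
        (trans (n-forest b g≡5) (trans (trans (length-∷ b 4) (cong₂ ℕ._+_ (length-bare b (bare b))
            (trans (length-∷ b₁ 3) (cong₂ ℕ._+_ (cong length (vertices-light b₁ l₁))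
              (trans (length-∷ b₂ 2) (cong₂ ℕ._+_ (length-bare b₂ (bare b₂))
                (trans (length-∷ b₃ 1) (cong₂ ℕ._+_ (cong length (vertices-light b₃ l₃))
                  (trans (length-∷ b₄ 0) (cong (ℕ._+ 0) (cong length (vertices-light b₄ l₄))))))))))))
          (arith (m b) (m b₂))))
        (trans (Z-↭ x [] perm) (trans (Z-pentagon x b≁C c≁B B≁C (λ p → proj₂ (apart b 2 h) (~-sym p)) (~-sym (c-adj b)) (c-adj b₁)
              (~-sym (c-adj b₂)) (~-sym (c-adj b₃)) f~b d≁ (λ p → proj₂ (apart b 3 h) (~-sym p))
              (λ p → proj₂ (apart b₂ 2 h) (~-sym p)) (outer b₃ (dist b 3 h) (dist b₂ 1 h))
              (outer b₄ (dist b 4 h) (dist b₂ 2 h)))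
          (trans (cong₂ (λ f f′ → s * ((s + x) * f) + x * f′) (cong₂ _*_ (T.Z-α b) (T.Z-α b₂))
                   (cong₂ (λ f f′ → s * f + x * f′)
                     (cong₂ _+_ (cong₂ _*_ (T.Z-α b) (T.Z-β b₂)) (cong₂ _*_ (T.Z-β b) (T.Z-α b₂)))
                     (cong₂ _*_ (T.Z-β b) (T.Z-β b₂))))
            (pentagon-value (m b) (m b₂) (T.α b) (T.β b) (T.α b₂) (T.β b₂)))))
        where
        b₁ = 1 ℕ.+ b
        b₂ = 2 ℕ.+ b
        b₃ = 3 ℕ.+ b
        b₄ = 4 ℕ.+ b
        h : 5 ℕ.≤ g
        h = ℕₚ.≤-reflexive (sym g≡5)
        f~b : c b₄ ~ c b
        f~b = subst (c b₄ ~_) (trans (cong (λ k → c (k ℕ.+ b)) (sym g≡5)) (c-period b)) (c-adj b₄)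
        b≁C : c b ≁* T.A b₂
        b≁C k = hang-≁ (λ e → dist b 2 h (sym e)) k (root∈ b)
        c≁B : c b₂ ≁* T.A b
        c≁B k = hang-≁ (dist b 2 h) k (root∈ b₂)
        B≁C : ∀ {u v} → u ∈ T.A b → v ∈ T.A b₂ → ¬ (v ~ u)
        B≁C k k′ = hang-≁ (λ e → dist b 2 h (sym e)) k′ (T.A⊆ b k)
        outer : ∀ j → c b ≢ c j → c b₂ ≢ c j → c j ≁* (T.A b ++ T.A b₂)
        outer j e e₂ k with ∈-++⁻ (T.A b) k
        ... | inj₁ k′ = hang-≁ e k′ (root∈ j)
        ... | inj₂ k′ = hang-≁ e₂ k′ (root∈ j)
        d≁ : c b₁ ≁* (c b₃ ∷ c b₄ ∷ T.A b ++ T.A b₂)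
        d≁ 0# p = proj₂ (apart b₁ 2 h) (~-sym p)
        d≁ 1# p = proj₂ (apart b₁ 3 h) (~-sym p)
        d≁ (there (there k)) p = outer b₁ (dist b 1 h) (λ e → dist b₁ 1 h (sym e)) k p
        perm : allFin n ↭ c b ∷ c b₂ ∷ c b₁ ∷ c b₃ ∷ c b₄ ∷ T.A b ++ T.A b₂
        perm = ↭-trans (subst (λ k → allFin n ↭ forest b k) g≡5 (forest-↭ b)) (↭-trans
          (↭-reflexive (cong₂ _++_ (vertices-bare b) (cong₂ _++_ (vertices-light b₁ l₁) (cong₂ _++_ (vertices-bare b₂)
            (cong₂ _++_ (vertices-light b₃ l₃) (cong (_++ []) (vertices-light b₄ l₄)))))))
          (↭-prep (c b) (↭-trans (shift (c b₁) (T.A b) _) (↭-trans (↭-prep (c b₁) (↭-trans (shift (c b₂) (T.A b) _)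
            (↭-prep (c b₂) (↭-trans (↭-reflexive (sym (Listₚ.++-assoc (T.A b) (T.A b₂) _)))
              (++-comm (T.A b ++ T.A b₂) (c b₃ ∷ c b₄ ∷ []))))))
            (↭-swap (c b₁) (c b₂) ↭-refl)))))
        arith : ∀ a b → suc (a ℕ.+ a) ℕ.+ (1 ℕ.+ (suc (b ℕ.+ b) ℕ.+ (1 ℕ.+ (1 ℕ.+ 0)))) ≡ suc (suc (suc a ℕ.+ b) ℕ.+ suc (suc a ℕ.+ b))
        arith = solve-∀

      LightOrHeavy : ℕ → Set
      LightOrHeavy i = Light (c i) ⊎ Heavy (c i)

      light-heavy : ∀ i → LightOrHeavy i
      light-heavy i = light-or-heavy (c i) (bare i)

      bound-3 : g ≡ 3 → LightOrHeavy 0 → LightOrHeavy 1 → LightOrHeavy 2 → Bound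
      bound-3 e (inj₁ l) _ _ = triangle-bound e 0 l
      bound-3 e _ (inj₁ l) _ = triangle-bound e 1 l
      bound-3 e _ _ (inj₁ l) = triangle-bound e 2 l
      bound-3 e (inj₂ h₀) (inj₂ h₁) (inj₂ h₂) = contradiction h₂ (not-three-heavy-3 e h₀ h₁)

      -- No two adjacent corners are heavy, and a set of pairwise nonadjacent corners of a pentagon
      -- lies in {b, b + 2} for some b, which the table selects.
      bound-5 : g ≡ 5 → LightOrHeavy 0 → LightOrHeavy 1 → LightOrHeavy 2 → LightOrHeavy 3 → LightOrHeavy 4 → Bound
      bound-5 e = choose
        where
        turn : ∀ {P : V → Set} i → P (c i) → P (c (5 ℕ.+ i))
        turn {P} i = subst P (sym (trans (cong (λ k → c (k ℕ.+ i)) (sym e)) (c-period i)))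
        excl : ∀ i → Heavy (c i) → ¬ Heavy (c (1 ℕ.+ i))
        excl = not-adjacent-heavy-5 e
        pent : ∀ b → Light (c (1 ℕ.+ b)) → Light (c (3 ℕ.+ b)) → Light (c (4 ℕ.+ b)) → Bound
        pent = pentagon-bound e
        choose : LightOrHeavy 0 → LightOrHeavy 1 → LightOrHeavy 2 → LightOrHeavy 3 → LightOrHeavy 4 → Bound
        choose (inj₁ l₀) (inj₁ l₁) _         (inj₁ l₃) _         = pent 2 l₃ (turn {Light} 0 l₀) (turn {Light} 1 l₁)
        choose (inj₁ l₀) (inj₁ l₁) (inj₁ l₂) (inj₂ h₃) (inj₁ l₄) = pent 3 l₄ (turn {Light} 1 l₁) (turn {Light} 2 l₂)
        choose (inj₁ l₀) (inj₁ l₁) (inj₂ h₂) (inj₂ h₃) _         = contradiction h₃ (excl 2 h₂)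
        choose (inj₁ l₀) (inj₁ l₁) _         (inj₂ h₃) (inj₂ h₄) = contradiction h₄ (excl 3 h₃)
        choose (inj₁ l₀) (inj₂ h₁) (inj₂ h₂) _         _         = contradiction h₂ (excl 1 h₁)
        choose (inj₁ l₀) (inj₂ h₁) (inj₁ l₂) _         (inj₁ l₄) = pent 1 l₂ l₄ (turn {Light} 0 l₀)
        choose (inj₁ l₀) (inj₂ h₁) (inj₁ l₂) (inj₁ l₃) (inj₂ h₄) = pent 4 (turn {Light} 0 l₀) (turn {Light} 2 l₂) (turn {Light} 3 l₃)
        choose (inj₁ l₀) (inj₂ h₁) (inj₁ l₂) (inj₂ h₃) (inj₂ h₄) = contradiction h₄ (excl 3 h₃)
        choose (inj₂ h₀) (inj₂ h₁) _         _         _         = contradiction h₁ (excl 0 h₀)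
        choose (inj₂ h₀) (inj₁ l₁) _         _         (inj₂ h₄) = contradiction (turn {Heavy} 0 h₀) (excl 4 h₄)
        choose (inj₂ h₀) (inj₁ l₁) _         (inj₁ l₃) (inj₁ l₄) = pent 0 l₁ l₃ l₄
        choose (inj₂ h₀) (inj₁ l₁) (inj₁ l₂) (inj₂ h₃) (inj₁ l₄) = pent 3 l₄ (turn {Light} 1 l₁) (turn {Light} 2 l₂)
        choose (inj₂ h₀) (inj₁ l₁) (inj₂ h₂) (inj₂ h₃) (inj₁ l₄) = contradiction h₃ (excl 2 h₂)

      IsCycle : Set
      IsCycle = n ≡ 7 × (∀ 3≤n → Z-all ≡ Polynomial.Z (cycle n 3≤n) x (allFin n) [])

      -- By `not-heavy-7` nothing hangs on the cycle. It then contains all vertices and has no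
      -- chord, so its traversal preserves and reflects adjacency.
      cycle-7 : g ≡ 7 → IsCycle
      cycle-7 g≡7 = trans n≡g g≡7 , λ 3≤n → trans (Z-↭ x [] all-↭)
        (trans (cong (λ L → Z x L []) (sym (Listₚ.map-tabulate (λ i → i) (Cycle.vertex C))))
          (trans (Z-map (cycle g 3≤g) G (Cycle.vertex C) vertex-adj x (allFin g) []) (same-cycle (sym n≡g) 3≤g 3≤n)))
        where
        all-light : ∀ i → Light (c i)
        all-light i = [ (λ l → l) , (λ h → contradiction h (not-heavy-7 g≡7 i)) ]′ (light-heavy i)
        covered : ∀ v → v ∈ cycle-vertices
        covered v = let j , e = ∈⇒c (own∈ v) in
          only-root j (subst (v ∈_) (vertices-light j (all-light j)) (mem⁻ (c∈ j) e))
          where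
          only-root : ∀ j → v ∈ c j ∷ [] → v ∈ cycle-vertices
          only-root j (here v≡) = subst (_∈ cycle-vertices) (sym v≡) (c∈ j)
        all-↭ : allFin n ↭ cycle-vertices
        all-↭ = unique-↭ (Uniqueₚ.allFin⁺ n) (Uniqueₚ.tabulate⁺ (Cycle.injective C)) (λ {v} _ → covered v) (λ _ → ∈-allFin _)
        n≡g : n ≡ g
        n≡g = trans (sym (Listₚ.length-tabulate (λ i → i))) (trans (↭-length all-↭) (Listₚ.length-tabulate (Cycle.vertex C)))
        vertex-adj : ∀ u v → adj (Cycle.vertex C u) (Cycle.vertex C v) ≡ Polynomial.adj (cycle g 3≤g) u v
        vertex-adj u v = from-dec (Graph._~?_ (cycle g 3≤g) u v)
          where
          back : Cycle.vertex C u ~ Cycle.vertex C v → Graph._~_ (cycle g 3≤g) u v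
          back p = let i , j , q , e , e′ = adj-edge (covered (Cycle.vertex C u)) (covered (Cycle.vertex C v)) p in
            subst₂ (Graph._~_ (cycle g 3≤g)) (Cycle.injective C e) (Cycle.injective C e′) q
          from-dec : (d : Dec (Graph._~_ (cycle g 3≤g) u v)) → adj (Cycle.vertex C u) (Cycle.vertex C v) ≡ does d
          from-dec (yes p) = dec-true (Cycle.vertex C u ~? Cycle.vertex C v) (Cycle.adjacent C p)
          from-dec (no ¬p) = dec-false (Cycle.vertex C u ~? Cycle.vertex C v) (λ q → ¬p (back q))
        same-cycle : ∀ {k l} → k ≡ l → ∀ 3≤k 3≤l → Polynomial.Z (cycle k 3≤k) x (allFin k) [] ≡ Polynomial.Z (cycle l 3≤l) x (allFin l) []
        same-cycle {k} refl 3≤k 3≤l = cong (λ h → Polynomial.Z (cycle k h) x (allFin k) []) (ℕₚ.≤-irrelevant 3≤k 3≤l)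

      -- Each bare root and its tree have an odd number of vertices together, so n and g have the
      -- same parity.
      not-even-g : ∀ j → g ≢ j ℕ.+ j
      not-even-g j e = let f , p = bares bare 0 g in not-even (j ℕ.+ f)
        (trans (n-forest 0 refl) (trans p (trans (cong (ℕ._+ (f ℕ.+ f)) e) (arith j f))))
        where
        arith : ∀ j f → j ℕ.+ j ℕ.+ (f ℕ.+ f) ≡ j ℕ.+ f ℕ.+ (j ℕ.+ f)
        arith = solve-∀

    bound-or-cycle : Bound ⊎ IsCycle
    bound-or-cycle = by-girth g refl 3≤g g≤7
      where
      by-girth : ∀ k → g ≡ k → 3 ℕ.≤ k → ¬ (8 ℕ.≤ g) → Bound ⊎ IsCycle
      by-girth 3 e _ _ = inj₁ (bound-3 e (light-heavy 0) (light-heavy 1) (light-heavy 2))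
      by-girth 4 e _ _ = contradiction e (not-even-g 2)
      by-girth 5 e _ _ = inj₁ (bound-5 e (light-heavy 0) (light-heavy 1) (light-heavy 2) (light-heavy 3) (light-heavy 4))
      by-girth 6 e _ _ = contradiction e (not-even-g 3)
      by-girth 7 e _ _ = inj₂ (cycle-7 e)
      by-girth (suc (suc (suc (suc (suc (suc (suc (suc k)))))))) e _ h =
        contradiction (subst (8 ℕ.≤_) (sym e) (ℕₚ.m≤m+n 8 k)) h
      by-girth 0 _ () _
      by-girth 1 _ (s≤s ()) _
      by-girth 2 _ (s≤s (s≤s ())) _

-- The extremal graphs

module Coefficients {V : Set} (G : Graph V) where
  open Polynomial G

  add : List ℕ → List ℕ → List ℕ
  add []      p       = p
  add (a ∷ p) []      = a ∷ p
  add (a ∷ p) (b ∷ r) = a ℕ.+ b ∷ add p r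

  -- Natural coefficients evaluate by normalisation on a concrete graph, which reduces the cycles of
  -- order 3, 5 and 7 to ring identities.
  coefficients : List V → List V → List ℕ
  coefficients []      F = 1 ∷ []
  coefficients (v ∷ L) F = if open-to v F then add (coefficients L F) (0 ∷ coefficients L (v ∷ F)) else coefficients L F

  module _ (x : ℚ) where

    horner : List ℕ → ℚ
    horner []      = 0ℚ
    horner (a ∷ p) = fromℕᵠ a + x * horner p

    fromℕᵠ-+ : ∀ a b → fromℕᵠ (a ℕ.+ b) ≡ fromℕᵠ a + fromℕᵠ b
    fromℕᵠ-+ zero    b = sym (ℚₚ.+-identityˡ (fromℕᵠ b))
    fromℕᵠ-+ (suc a) b = trans (fromℕᵠ-suc (a ℕ.+ b)) (trans (cong (1ℚ +_) (fromℕᵠ-+ a b))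
      (trans (sym (ℚₚ.+-assoc 1ℚ (fromℕᵠ a) (fromℕᵠ b))) (cong (_+ fromℕᵠ b) (sym (fromℕᵠ-suc a)))))

    horner-add : ∀ p r → horner (add p r) ≡ horner p + horner r
    horner-add []      r       = sym (ℚₚ.+-identityˡ (horner r))
    horner-add (a ∷ p) []      = sym (ℚₚ.+-identityʳ (horner (a ∷ p)))
    horner-add (a ∷ p) (b ∷ r) = trans (cong₂ (λ f t → f + x * t) (fromℕᵠ-+ a b) (horner-add p r))
      (solve 5 (λ a b p r x → a :+ b :+ x :* (p :+ r) := a :+ x :* p :+ (b :+ x :* r)) refl
        (fromℕᵠ a) (fromℕᵠ b) (horner p) (horner r) x)

    Z-horner : ∀ L F → Z x L F ≡ horner (coefficients L F)
    Z-horner []      F = solve 1 (λ x → con 1ℚ := con 1ℚ :+ x :* con 0ℚ) refl x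
    Z-horner (v ∷ L) F with open-to v F
    ... | true  = trans (cong₂ (λ a b → a + x * b) (Z-horner L F) (Z-horner L (v ∷ F)))
                    (trans (cong (horner (coefficients L F) +_) (sym (ℚₚ.+-identityˡ _)))
                      (sym (horner-add (coefficients L F) (0 ∷ coefficients L (v ∷ F)))))
    ... | false = trans (solve 2 (λ a b → a :+ con 0ℚ :* b := a) refl (Z x L F) (Z x L (v ∷ F))) (Z-horner L F)

shiftˢ : ∀ {k} → Fin k ⊎ Fin k → Fin (suc k) ⊎ Fin (suc k)
shiftˢ (inj₁ i) = inj₁ (suc i)
shiftˢ (inj₂ i) = inj₂ (suc i)

-- Stems and leaves alternate from the attached end onwards, the order in which `Z-star-path`
-- removes them.
starList : ∀ k → List (Fin k ⊎ Fin k)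
starList zero    = []
starList (suc k) = inj₁ zero ∷ inj₂ zero ∷ map shiftˢ (starList k)

length-starList : ∀ k → length (starList k) ≡ k ℕ.+ k
length-starList zero    = refl
length-starList (suc k) = trans (cong (2 ℕ.+_) (trans (Listₚ.length-map shiftˢ (starList k)) (length-starList k)))
  (cong suc (sym (ℕₚ.+-suc k k)))

∈-starList : ∀ {k} (a : Fin k ⊎ Fin k) → a ∈ starList k
∈-starList {suc k} (inj₁ zero)    = here refl
∈-starList {suc k} (inj₂ zero)    = there (here refl)
∈-starList {suc k} (inj₁ (suc i)) = there (there (∈-map⁺ shiftˢ (∈-starList (inj₁ i))))
∈-starList {suc k} (inj₂ (suc i)) = there (there (∈-map⁺ shiftˢ (∈-starList (inj₂ i))))

starList-unique : ∀ k → Unique (starList k)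
starList-unique zero    = []
starList-unique (suc k) = unique-∷ (λ { (there i) → ¬zero (inj₁ refl) i })
  (unique-∷ (¬zero (inj₂ refl)) (Uniqueₚ.map⁺ shift-injective (starList-unique k)))
  where
  shift-injective : ∀ {a b : Fin k ⊎ Fin k} → shiftˢ a ≡ shiftˢ b → a ≡ b
  shift-injective {inj₁ a} {inj₁ b} refl = refl
  shift-injective {inj₂ a} {inj₂ b} refl = refl
  ¬zero : ∀ {v} → (v ≡ inj₁ zero ⊎ v ≡ inj₂ zero) → v ∉ map shiftˢ (starList k)
  ¬zero h i with ∈-map⁻ shiftˢ i
  ¬zero (inj₁ ()) i | inj₁ _ , _ , refl
  ¬zero (inj₂ ()) i | inj₁ _ , _ , refl
  ¬zero (inj₁ ()) i | inj₂ _ , _ , refl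
  ¬zero (inj₂ ()) i | inj₂ _ , _ , refl

module StarPath (x y : ℚ) (sy≡x : (1ℚ + x) * y ≡ x) {W : Set} (G : Graph W) where
  open Graph G
  open Polynomial G
  open Homogeneous sy≡x

  s : ℚ
  s = 1ℚ + x

  -- The vertex r stands in front of the path: a vertex of the cycle at the start, the stem just
  -- removed in the recursion.
  record Attached {k : ℕ} (φ : Fin k ⊎ Fin k → W) (r : W) : Set where
    field
      to     : ∀ {p} → toℕ p ≡ 0 → φ (inj₁ p) ~ r
      from₁  : ∀ {p} → φ (inj₁ p) ~ r → toℕ p ≡ 0
      from₂  : ∀ {p} → ¬ (φ (inj₂ p) ~ r)
      edge⁺  : ∀ {a b} → Graph._~_ (star (path k)) a b → φ a ~ φ b
      edge⁻  : ∀ {a b} → φ a ~ φ b → Graph._~_ (star (path k)) a b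

  Z-star-path : ∀ k {φ : Fin k ⊎ Fin k → W} {r} → Attached φ r →
    Z x (map φ (starList k)) [] ≡ pow s k * q y (suc k) × Z x (map φ (starList k)) (r ∷ []) ≡ pow s k * q y k
  Z-star-path zero    at = refl , refl
  Z-star-path (suc k) {φ} {r} at =
    trans (cong (λ L → Z x (w ∷ l ∷ L) []) (sym list≡)) (trans (Z-stem x w l rest (edge⁺ refl) l≁)
      (trans (cong₂ (λ a b → s * a + x * b) (proj₁ ih) (proj₂ ih))
        (stem-value (pow s k) (q y (suc k)) (q y k)))) ,
    trans (cong (λ L → Z x (w ∷ l ∷ L) (r ∷ [])) (sym list≡)) (trans (Z-stem-blocked x r w l rest (to refl) l≁ r≁)
      (trans (cong (s *_) (proj₁ ih)) (sym (ℚₚ.*-assoc s (pow s k) (q y (suc k))))))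
    where
    open Attached at
    w = φ (inj₁ zero)
    l = φ (inj₂ zero)
    φ′ : Fin k ⊎ Fin k → W
    φ′ a = φ (shiftˢ a)
    rest : List W
    rest = map φ′ (starList k)
    list≡ : rest ≡ map φ (map shiftˢ (starList k))
    list≡ = Listₚ.map-∘ (starList k)
    lift : ∀ {a b} → Graph._~_ (star (path k)) a b → Graph._~_ (star (path (suc k))) (shiftˢ a) (shiftˢ b)
    lift {inj₁ _} {inj₁ _} (inj₁ e) = inj₁ (cong suc e)
    lift {inj₁ _} {inj₁ _} (inj₂ e) = inj₂ (cong suc e)
    lift {inj₁ _} {inj₂ _} e = cong suc e
    lift {inj₂ _} {inj₁ _} e = cong suc e
    lower : ∀ {a b} → Graph._~_ (star (path (suc k))) (shiftˢ a) (shiftˢ b) → Graph._~_ (star (path k)) a b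
    lower {inj₁ _} {inj₁ _} (inj₁ e) = inj₁ (ℕₚ.suc-injective e)
    lower {inj₁ _} {inj₁ _} (inj₂ e) = inj₂ (ℕₚ.suc-injective e)
    lower {inj₁ _} {inj₂ _} e = Finₚ.suc-injective e
    lower {inj₂ _} {inj₁ _} e = Finₚ.suc-injective e
    next-to : ∀ {p : Fin k} → Graph._~_ (star (path (suc k))) (inj₁ (suc p)) (inj₁ zero) → toℕ p ≡ 0
    next-to (inj₂ e) = sym (ℕₚ.suc-injective e)
    next : Attached φ′ w
    next = record
      { to     = λ e → edge⁺ (inj₂ (cong suc (sym e)))
      ; from₁  = λ p → next-to (edge⁻ p)
      ; from₂  = λ p → contradiction (edge⁻ p) λ ()
      ; edge⁺ = λ {a} {b} p → edge⁺ (lift {a} {b} p)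
      ; edge⁻  = λ {a} {b} p → lower {a} {b} (edge⁻ p) }
    ih : Z x rest [] ≡ pow s k * q y (suc k) × Z x rest (w ∷ []) ≡ pow s k * q y k
    ih = Z-star-path k next
    l≁ : l ≁* rest
    l≁ i p with ∈-map⁻ φ′ i
    ... | inj₁ _ , _ , refl = contradiction (edge⁻ p) λ ()
    ... | inj₂ _ , _ , refl = edge⁻ p
    r≁ : r ≁* (l ∷ rest)
    r≁ (here refl) p = from₂ p
    r≁ (there i)   p with ∈-map⁻ φ′ i
    ... | inj₁ _ , _ , refl = contradiction (from₁ p) λ ()
    ... | inj₂ _ , _ , refl = from₂ p

-- The length 3 + j makes the attachment vertices `zero` and `suc (suc zero)` for the triangle and
-- the pentagon alike.
module GraphG (x y : ℚ) (y≤0 : y ≤ 0ℚ) (sy≡x : (1ℚ + x) * y ≡ x) (j : ℕ) (3≤g : 3 ℕ.≤ 3 ℕ.+ j) (k ℓ : ℕ) where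
  private
    g : ℕ
    g = 3 ℕ.+ j

    W : Set
    W = (Fin g ⊎ (Fin k ⊎ Fin k)) ⊎ (Fin ℓ ⊎ Fin ℓ)

    Γ : Graph W
    Γ = graphG g 3≤g k ℓ

  open Graph Γ
  open Polynomial Γ
  open StarPath x y sy≡x Γ
  open Homogeneous sy≡x
  open PathBounds y y≤0

  private
    on-cycle : Fin g → W
    on-cycle i = inj₁ (inj₁ i)

    in-first : Fin k ⊎ Fin k → W
    in-first a = inj₁ (inj₂ a)

    b c : W
    b = on-cycle zero
    c = on-cycle (suc (suc zero))

  B C : List W
  B = map in-first (starList k)
  C = map inj₂ (starList ℓ)

  vertex-list : List (Fin g) → List W
  vertex-list L = map on-cycle L ++ B ++ C

  ∈-vertex-list : ∀ {L} → (∀ i → i ∈ L) → ∀ w → w ∈ vertex-list L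
  ∈-vertex-list {L} all (inj₁ (inj₁ i)) = ∈-++⁺ˡ (∈-map⁺ on-cycle (all i))
  ∈-vertex-list {L} all (inj₁ (inj₂ a)) = ∈-++⁺ʳ (map on-cycle L) (∈-++⁺ˡ (∈-map⁺ in-first (∈-starList a)))
  ∈-vertex-list {L} all (inj₂ a)        = ∈-++⁺ʳ (map on-cycle L) (∈-++⁺ʳ B (∈-map⁺ inj₂ (∈-starList a)))

  vertex-list-unique : ∀ {L} → Unique L → Unique (vertex-list L)
  vertex-list-unique {L} L! = unique-++ (Uniqueₚ.map⁺ (λ { refl → refl }) L!)
    (unique-++ (Uniqueₚ.map⁺ (λ { refl → refl }) (starList-unique k)) (Uniqueₚ.map⁺ (λ { refl → refl }) (starList-unique ℓ)) B∌C)
    L∌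
    where
    B∌C : ∀ {w} → w ∈ B → w ∉ C
    B∌C i i′ with ∈-map⁻ in-first i | ∈-map⁻ inj₂ i′
    ... | _ , _ , refl | _ , _ , ()
    L∌ : ∀ {w} → w ∈ map on-cycle L → w ∉ B ++ C
    L∌ i i′ with ∈-map⁻ on-cycle i | ∈-++⁻ B i′
    ... | _ , _ , refl | inj₁ i″ with ∈-map⁻ in-first i″
    ...   | _ , _ , ()
    L∌ i i′ | _ , _ , refl | inj₂ i″ with ∈-map⁻ inj₂ i″
    ...   | _ , _ , ()

  length-vertex-list : ∀ L → length (vertex-list L) ≡ length L ℕ.+ ((k ℕ.+ k) ℕ.+ (ℓ ℕ.+ ℓ))
  length-vertex-list L = trans (Listₚ.length-++ (map on-cycle L)) (cong₂ ℕ._+_ (Listₚ.length-map on-cycle L)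
    (trans (Listₚ.length-++ B) (cong₂ ℕ._+_ (trans (Listₚ.length-map in-first (starList k)) (length-starList k))
      (trans (Listₚ.length-map inj₂ (starList ℓ)) (length-starList ℓ)))))

  private
    at-b : Attached in-first b
    at-b = record { to = λ e → refl , e ; from₁ = proj₂ ; from₂ = λ () ; edge⁺ = id ; edge⁻ = id }

    at-c : Attached inj₂ c
    at-c = record { to = λ e → refl , e ; from₁ = proj₂ ; from₂ = λ () ; edge⁺ = id ; edge⁻ = id }

    Bα : Z x B [] ≡ pow s k * q y (suc k)
    Bα = proj₁ (Z-star-path k at-b)
    Bβ : Z x B (b ∷ []) ≡ pow s k * q y k
    Bβ = proj₂ (Z-star-path k at-b)
    Cα : Z x C [] ≡ pow s ℓ * q y (suc ℓ)
    Cα = proj₁ (Z-star-path ℓ at-c)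
    Cβ : Z x C (c ∷ []) ≡ pow s ℓ * q y ℓ
    Cβ = proj₂ (Z-star-path ℓ at-c)

    other≁ : ∀ {i} → toℕ i ≢ 0 → toℕ i ≢ 2 → on-cycle i ≁* (B ++ C)
    other≁ i≢0 i≢2 m p with ∈-++⁻ B m
    ... | inj₁ m′ with ∈-map⁻ in-first m′
    ...   | inj₁ _ , _ , refl = i≢0 (proj₁ p)
    other≁ i≢0 i≢2 m p | inj₂ m′ with ∈-map⁻ inj₂ m′
    ...   | inj₁ _ , _ , refl = i≢2 (proj₁ p)

    b≁C : b ≁* C
    b≁C m p with ∈-map⁻ inj₂ m
    ... | inj₁ _ , _ , refl = contradiction (proj₁ p) λ ()

    c≁B : c ≁* B
    c≁B m p with ∈-map⁻ in-first m
    ... | inj₁ _ , _ , refl = contradiction (proj₁ p) λ ()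

    B≁C : ∀ {u v} → u ∈ B → v ∈ C → ¬ (v ~ u)
    B≁C m m′ p with ∈-map⁻ in-first m | ∈-map⁻ inj₂ m′
    B≁C m m′ () | _ , _ , refl | _ , _ , refl

    K₁ K₀ L₁ L₀ : ℚ
    K₁ = q y (suc k)
    K₀ = q y k
    L₁ = q y (suc ℓ)
    L₀ = q y ℓ

  -- `q-split` joins the paths, extended by c₁ and c₃, into a single path, so the value depends on k
  -- + ℓ only.
  Z-triangle-list : ∀ {a} → toℕ a ≢ 0 → toℕ a ≢ 2 → b ~ c → b ~ on-cycle a → c ~ on-cycle a →
    Z x (vertex-list (a ∷ zero ∷ suc (suc zero) ∷ [])) [] ≡ pow s (suc (k ℕ.+ ℓ)) * q y (2 ℕ.+ suc (k ℕ.+ ℓ))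
  Z-triangle-list a≢0 a≢2 b~c b~a c~a = trans (Z-triangle x b≁C c≁B B≁C b~c b~a c~a (other≁ a≢0 a≢2))
    (trans (cong₂ (λ f f′ → s * f + x * f′) (cong₂ _*_ Bα Cα) (cong₂ _+_ (cong₂ _*_ Bα Cβ) (cong₂ _*_ Bβ Cα)))
      (trans (triangle-value k ℓ K₁ K₀ L₁ L₀) (cong (pow s (suc (k ℕ.+ ℓ)) *_)
        (trans (sym (q-split k (suc ℓ))) (cong (λ e → q y (2 ℕ.+ e)) (ℕₚ.+-suc k ℓ))))))

  -- The vertex deleted by `q-split` is the one that stands for the three corners of degree 2. The
  -- paths on its sides have k + 1 and ℓ + 1 vertices, as they include c₁ and c₃.
  Z-pentagon-list : ∀ {d e f} → toℕ d ≢ 0 → toℕ d ≢ 2 → toℕ e ≢ 0 → toℕ e ≢ 2 → toℕ f ≢ 0 → toℕ f ≢ 2 →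
    ¬ (c ~ b) → on-cycle d ~ b → on-cycle d ~ c → on-cycle e ~ c → on-cycle f ~ on-cycle e → on-cycle f ~ b →
    ¬ (on-cycle e ~ on-cycle d) → ¬ (on-cycle f ~ on-cycle d) → ¬ (on-cycle e ~ b) → ¬ (on-cycle f ~ c) →
    Z x (vertex-list (zero ∷ suc (suc zero) ∷ d ∷ e ∷ f ∷ [])) [] ≡ pow s (2 ℕ.+ (k ℕ.+ ℓ)) * q y (2 ℕ.+ (2 ℕ.+ (k ℕ.+ ℓ)))
  Z-pentagon-list {d} {e} {f} d≢0 d≢2 e≢0 e≢2 f≢0 f≢2 c≁b d~b d~c e~c f~e f~b e≁d f≁d e≁b f≁c =
    trans (Z-pentagon x b≁C c≁B B≁C c≁b d~b d~c e~c f~e f~b d≁ e≁b f≁c (other≁ e≢0 e≢2) (other≁ f≢0 f≢2))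
    (trans (cong₂ (λ f f′ → s * ((s + x) * f) + x * f′) (cong₂ _*_ Bα Cα)
             (cong₂ (λ f f′ → s * f + x * f′) (cong₂ _+_ (cong₂ _*_ Bα Cβ) (cong₂ _*_ Bβ Cα)) (cong₂ _*_ Bβ Cβ)))
      (trans (pentagon-value k ℓ K₁ K₀ L₁ L₀) (cong (pow s (2 ℕ.+ (k ℕ.+ ℓ)) *_)
        (trans (cong₂ (λ u v → u * (L₁ + y * L₀) + y * (v * L₁)) (ℚₚ.*-identityˡ (K₁ + y * K₀)) (ℚₚ.*-identityˡ K₁))
          (trans (sym (q-split (suc k) (suc ℓ))) (cong (λ e → q y (3 ℕ.+ e)) (ℕₚ.+-suc k ℓ)))))))
    where
    d≁ : on-cycle d ≁* (on-cycle e ∷ on-cycle f ∷ B ++ C)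
    d≁ (here refl)         = e≁d
    d≁ (there (here refl)) = f≁d
    d≁ (there (there i))   = other≁ d≢0 d≢2 i

module _ {n : ℕ} {W : Set} {H : Graph (Fin n)} {Γ : Graph W} (iso : H ≅ Γ)
         {L : List W} (L! : Unique L) (all : ∀ w → w ∈ L) where
  private
    module H = Graph H
    module Γ = Graph Γ
    module F = Inverse (proj₁ iso)

    from-injective : ∀ {u v} → F.from u ≡ F.from v → u ≡ v
    from-injective {u} {v} e = trans (sym (F.strictlyInverseˡ u)) (trans (cong F.to e) (F.strictlyInverseˡ v))

    allFin-↭ : allFin n ↭ map F.from L
    allFin-↭ = unique-↭ (Uniqueₚ.allFin⁺ n) (Uniqueₚ.map⁺ from-injective L!)
      (λ {v} _ → subst (_∈ map F.from L) (F.strictlyInverseʳ v) (∈-map⁺ F.from (all (F.to v)))) (λ _ → ∈-allFin _)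

    from-adj : ∀ u v → Polynomial.adj H (F.from u) (F.from v) ≡ Polynomial.adj Γ u v
    from-adj u v = by-dec (u Γ.~? v)
      where
      by-dec : (d : Dec (u Γ.~ v)) → Polynomial.adj H (F.from u) (F.from v) ≡ does d
      by-dec (yes p) = dec-true (F.from u H.~? F.from v) (Equivalence.from (proj₂ iso (F.from u) (F.from v))
        (subst₂ Γ._~_ (sym (F.strictlyInverseˡ u)) (sym (F.strictlyInverseˡ v)) p))
      by-dec (no ¬p) = dec-false (F.from u H.~? F.from v) (λ p → ¬p (subst₂ Γ._~_ (F.strictlyInverseˡ u) (F.strictlyInverseˡ v)
        (Equivalence.to (proj₂ iso (F.from u) (F.from v)) p)))

  order-≅ : n ≡ length L
  order-≅ = trans (sym (Listₚ.length-tabulate (λ i → i))) (trans (↭-length allFin-↭) (Listₚ.length-map F.from L))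

  Z-≅ : ∀ x → Polynomial.Z H x (allFin n) [] ≡ Polynomial.Z Γ x L []
  Z-≅ x = trans (Polynomial.Z-↭ H x [] allFin-↭) (Z-map Γ H F.from from-adj x L [])

module Extremal (x y : ℚ) (y≤0 : y ≤ 0ℚ) (sy≡x : (1ℚ + x) * y ≡ x) where

  s : ℚ
  s = 1ℚ + x

  extremal-value : ℕ → ℚ
  extremal-value h = pow s h * q y (2 ℕ.+ h)

  private
    suc-double-injective : ∀ a b → suc (a ℕ.+ a) ≡ suc (b ℕ.+ b) → a ≡ b
    suc-double-injective a b e = double-injective a b (ℕₚ.suc-injective e)

  Z-𝒮P : ∀ {n} (H : Graph (Fin n)) → H ∈𝒮P → ∀ h → n ≡ suc (h ℕ.+ h) →
    Polynomial.Z H x (allFin n) [] ≡ extremal-value h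
  Z-𝒮P {n} H (_ , 3≤g , k , ℓ , inj₁ refl , _ , iso) h n≡ = trans (Z-≅ {H = H} {Γ = Γ} iso L! L-all x)
    (trans (Z-triangle-list (λ ()) (λ ()) (from-yes (Graph._~?_ Γ (inj₁ (inj₁ zero)) (inj₁ (inj₁ (suc (suc zero))))))
              (from-yes (Graph._~?_ Γ (inj₁ (inj₁ zero)) (inj₁ (inj₁ (suc zero)))))
              (from-yes (Graph._~?_ Γ (inj₁ (inj₁ (suc (suc zero)))) (inj₁ (inj₁ (suc zero))))))
      (cong extremal-value (suc-double-injective (suc (k ℕ.+ ℓ)) h (trans (sym size) n≡))))
    where
    Γ = graphG 3 3≤g k ℓ
    open GraphG x y y≤0 sy≡x 0 3≤g k ℓ
    order : List (Fin 3)
    order = suc zero ∷ zero ∷ suc (suc zero) ∷ []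
    L! = vertex-list-unique (from-yes (DecUnique.unique? Finₚ._≟_ order))
    L-all = ∈-vertex-list (from-yes (Finₚ.all? λ i → DecMembership._∈?_ Finₚ._≟_ i order))
    arith : ∀ k ℓ → 3 ℕ.+ ((k ℕ.+ k) ℕ.+ (ℓ ℕ.+ ℓ)) ≡ suc (suc (k ℕ.+ ℓ) ℕ.+ suc (k ℕ.+ ℓ))
    arith = solve-∀
    size : n ≡ suc (suc (k ℕ.+ ℓ) ℕ.+ suc (k ℕ.+ ℓ))
    size = trans (order-≅ {H = H} {Γ = Γ} iso L! L-all) (trans (length-vertex-list order) (arith k ℓ))
  Z-𝒮P {n} H (_ , 3≤g , k , ℓ , inj₂ refl , _ , iso) h n≡ = trans (Z-≅ {H = H} {Γ = Γ} iso L! L-all x)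
    (trans (Z-pentagon-list (λ ()) (λ ()) (λ ()) (λ ()) (λ ()) (λ ())
              (from-no (c₂ ~? c₀)) (from-yes (c₁ ~? c₀)) (from-yes (c₁ ~? c₂)) (from-yes (c₃ ~? c₂)) (from-yes (c₄ ~? c₃))
              (from-yes (c₄ ~? c₀)) (from-no (c₃ ~? c₁)) (from-no (c₄ ~? c₁)) (from-no (c₃ ~? c₀)) (from-no (c₄ ~? c₂)))
      (cong extremal-value (suc-double-injective (2 ℕ.+ (k ℕ.+ ℓ)) h (trans (sym size) n≡))))
    where
    Γ = graphG 5 3≤g k ℓ
    open Graph Γ using (_~?_)
    open GraphG x y y≤0 sy≡x 2 3≤g k ℓ
    c₀ c₁ c₂ c₃ c₄ : (Fin 5 ⊎ (Fin k ⊎ Fin k)) ⊎ (Fin ℓ ⊎ Fin ℓ)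
    c₀ = inj₁ (inj₁ zero)
    c₁ = inj₁ (inj₁ (suc zero))
    c₂ = inj₁ (inj₁ (suc (suc zero)))
    c₃ = inj₁ (inj₁ (suc (suc (suc zero))))
    c₄ = inj₁ (inj₁ (suc (suc (suc (suc zero)))))
    order : List (Fin 5)
    order = zero ∷ suc (suc zero) ∷ suc zero ∷ suc (suc (suc zero)) ∷ suc (suc (suc (suc zero))) ∷ []
    L! = vertex-list-unique (from-yes (DecUnique.unique? Finₚ._≟_ order))
    L-all = ∈-vertex-list (from-yes (Finₚ.all? λ i → DecMembership._∈?_ Finₚ._≟_ i order))
    arith : ∀ k ℓ → 5 ℕ.+ ((k ℕ.+ k) ℕ.+ (ℓ ℕ.+ ℓ)) ≡ suc (suc (suc (k ℕ.+ ℓ)) ℕ.+ suc (suc (k ℕ.+ ℓ)))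
    arith = solve-∀
    size : n ≡ suc (suc (suc (k ℕ.+ ℓ)) ℕ.+ suc (suc (k ℕ.+ ℓ)))
    size = trans (order-≅ {H = H} {Γ = Γ} iso L! L-all) (trans (length-vertex-list order) (arith k ℓ))

  -- For n = 3 and n = 5 the two sides coincide: 1 + 3x and 1 + 5x + 5x². For n = 7 they are 1 + 7x
  -- + 14x² + 8x³ and 1 + 7x + 14x² + 7x³, which differ by -x³ ≥ 0.
  extremal≤cycle : x ≤ 0ℚ → ∀ {n} 3≤n → n ≤ⁿ 7 → ∀ h → n ≡ suc (h ℕ.+ h) →
    extremal-value h ≤ Polynomial.Z (cycle n 3≤n) x (allFin n) []
  extremal≤cycle x≤0 (s≤s ()) _ 0 refl
  extremal≤cycle x≤0 3≤3 _ 1 refl = ℚₚ.≤-reflexive (trans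
    (solve 2 (λ s y → s :* con 1ℚ :* (con 1ℚ :+ y :* con 1ℚ :+ y :* con 1ℚ) := s :+ (s :* y :+ s :* y)) refl s y)
    (trans (cong (λ t → s + (t + t)) sy≡x)
      (trans (solve 1 (λ x → con 1ℚ :+ x :+ (x :+ x) := con 1ℚ :+ x :* (con (fromℕᵠ 3) :+ x :* con 0ℚ)) refl x)
        (sym (Coefficients.Z-horner (cycle 3 3≤3) x (allFin 3) [])))))
  extremal≤cycle x≤0 3≤5 _ 2 refl = ℚₚ.≤-reflexive (trans
    (solve 2 (λ s y → s :* (s :* con 1ℚ) :* (con 1ℚ :+ y :* con 1ℚ :+ y :* con 1ℚ :+ y :* (con 1ℚ :+ y :* con 1ℚ))
                := s :* s :+ (s :* (s :* y) :+ s :* (s :* y) :+ s :* (s :* y)) :+ s :* y :* (s :* y)) refl s y)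
    (trans (cong (λ t → s * s + (s * t + s * t + s * t) + t * t) sy≡x)
      (trans (solve 1 (λ x → (con 1ℚ :+ x) :* (con 1ℚ :+ x) :+ ((con 1ℚ :+ x) :* x :+ (con 1ℚ :+ x) :* x :+ (con 1ℚ :+ x) :* x) :+ x :* x
                  := con 1ℚ :+ x :* (con (fromℕᵠ 5) :+ x :* (con (fromℕᵠ 5) :+ x :* con 0ℚ))) refl x)
        (sym (Coefficients.Z-horner (cycle 5 3≤5) x (allFin 5) [])))))
  extremal≤cycle x≤0 3≤7 _ 3 refl = ℚₚ.≤-trans (ℚₚ.≤-reflexive (trans
    (solve 2 (λ s y → s :* (s :* (s :* con 1ℚ)) :* (con 1ℚ :+ y :* con 1ℚ :+ y :* con 1ℚ :+ y :* (con 1ℚ :+ y :* con 1ℚ)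
                        :+ y :* (con 1ℚ :+ y :* con 1ℚ :+ y :* con 1ℚ))
                := s :* (s :* s :+ con (fromℕᵠ 4) :* (s :* (s :* y)) :+ con (fromℕᵠ 3) :* (s :* y :* (s :* y)))) refl s y)
    (cong (λ t → s * (s * s + fromℕᵠ 4 * (s * t) + fromℕᵠ 3 * (t * t))) sy≡x)))
    (ℚₚ.≤-trans (by-difference ((- x) * ((- x) * (- x))) (0≤-* (0≤- x≤0) (0≤-* (0≤- x≤0) (0≤- x≤0)))
        (solve 1 (λ x → (:- x) :* ((:- x) :* (:- x))
                  := con 1ℚ :+ x :* (con (fromℕᵠ 7) :+ x :* (con (fromℕᵠ 14) :+ x :* (con (fromℕᵠ 7) :+ x :* con 0ℚ)))
                     :- (con 1ℚ :+ x) :* ((con 1ℚ :+ x) :* (con 1ℚ :+ x) :+ con (fromℕᵠ 4) :* ((con 1ℚ :+ x) :* x)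
                                       :+ con (fromℕᵠ 3) :* (x :* x))) refl x))
      (ℚₚ.≤-reflexive (sym (Coefficients.Z-horner (cycle 7 3≤7) x (allFin 7) []))))
  extremal≤cycle x≤0 _ n≤7 (suc (suc (suc (suc h)))) refl = contradiction n≤7 (λ le → ℕₚ.<⇒≱ (bound h) le)
    where
    bound : ∀ h → 8 ≤ⁿ suc (4 ℕ.+ h ℕ.+ (4 ℕ.+ h))
    bound h = s≤s (s≤s (s≤s (s≤s (s≤s (ℕₚ.≤-trans (ℕₚ.m≤m+n 3 (suc h)) (ℕₚ.m≤n+m (4 ℕ.+ h) h))))))

-- Combining the cases at a rational point

module OddOrder {n : ℕ} (h : ℕ) (n≡ : n ≡ suc (h ℕ.+ h)) (G : Graph (Fin n)) (connected : Connected G)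
                (wc : WellCovered G) (unicyclic : Unicyclic G) where
  private
    C : Cycle G
    C = proj₁ unicyclic

  module _ (x : ℚ) (x≤0 : x ≤ 0ℚ) (pos : Region.Positive-at G x) where
    private
      Z-pos : ∀ {L} → Unique L → ∀ F → 0ℚ < Polynomial.Z G x L F
      Z-pos L! F = Region.Z-positive G pos L! F

      s : ℚ
      s = 1ℚ + x

      0<s : 0ℚ < s
      -- A single vertex is an induced subgraph with polynomial 1 + x; the vertex taken is c 0.
      0<s = subst (0ℚ <_) (cong (1ℚ +_) (ℚₚ.*-identityʳ x))
        (Z-pos {CycleStructure.c G C (proj₂ unicyclic) 0 ∷ []} (unique-∷ (λ ()) []) [])

      instance
        s-pos : Positive s
        s-pos = positive 0<s

      1/s : ℚ
      1/s = (1/ s) {{ℚₚ.pos⇒nonZero s}}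

      y : ℚ
      y = x * 1/s

      y≤0 : y ≤ 0ℚ
      y≤0 = subst (y ≤_) (ℚₚ.*-zeroˡ 1/s)
        (ℚₚ.*-monoʳ-≤-nonNeg 1/s {{nonNegative (ℚₚ.<⇒≤ (ℚₚ.positive⁻¹ 1/s {{ℚₚ.1/pos⇒pos s}}))}} x≤0)

      sy≡x : s * y ≡ x
      sy≡x = trans (solve 3 (λ s x i → s :* (x :* i) := x :* (s :* i)) refl s x 1/s)
        (trans (cong (x *_) (ℚₚ.*-inverseʳ s {{ℚₚ.pos⇒nonZero s}})) (ℚₚ.*-identityʳ x))

      Z-G : ℚ
      Z-G = Polynomial.Z G x (allFin n) []

      open Extremal x y y≤0 sy≡x using (extremal-value; extremal≤cycle; Z-𝒮P)

      extremal-or-cycle : Z-G ≤ extremal-value h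
        ⊎ (n ≡ 7 × (∀ 3≤n → Z-G ≡ Polynomial.Z (cycle n 3≤n) x (allFin n) []))
      extremal-or-cycle = bound-or-cycle (peel-to-cycle (proj₁ (proj₂ R)) (initial (proj₁ R) (proj₂ (proj₂ R)))) {half = h} n≡
        where
        R = CycleStructure.spanning G C (proj₂ unicyclic) connected
        open Trees G wc x y y≤0 0<s sy≡x Z-pos using (initial)
        open Cases G wc x y y≤0 0<s sy≡x Z-pos C (proj₂ unicyclic)

    Z≤cycle : ∀ 3≤n → n ≤ⁿ 7 → Z-G ≤ Polynomial.Z (cycle n 3≤n) x (allFin n) []
    Z≤cycle 3≤n n≤7 = [ (λ le → ℚₚ.≤-trans le (extremal≤cycle x≤0 3≤n n≤7 h n≡)) , (λ (_ , eq) → ℚₚ.≤-reflexive (eq 3≤n)) ]′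
      extremal-or-cycle

    Z≤𝒮P : 9 ≤ⁿ n → (H : Graph (Fin n)) → H ∈𝒮P → Z-G ≤ Polynomial.Z H x (allFin n) []
    Z≤𝒮P 9≤n H H∈ = [ (λ le → ℚₚ.≤-trans le (ℚₚ.≤-reflexive (sym (Z-𝒮P H H∈ h n≡))))
                    , (λ (n≡7 , _) → contradiction (subst (9 ≤ⁿ_) n≡7 9≤n) (ℕₚ.<⇒≱ (ℕₚ.n≤1+n 8))) ]′ extremal-or-cycle

open import Defs
open import Data.Fin.Base using (Fin)
open import Data.Nat.Base using (ℕ; _%_) renaming (_≤_ to _≤ⁿ_)
open import Data.Product.Base using (_×_)
open import Relation.Binary.PropositionalEquality using (_≡_)

theorem3p18 : ∀ (n : ℕ) (3≤n : 3 ≤ⁿ n) → n % 2 ≡ 1 →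
    (G : Graph (Fin n)) → Connected G → WellCovered G → Unicyclic G →
    (n ≤ⁿ 7 → cycle n 3≤n ⪯ G) ×
    (9 ≤ⁿ n → (H : Graph (Fin n)) → H ∈𝒮P → H ⪯ G)
theorem3p18 n 3≤n odd G connected wc unicyclic =
  (λ n≤7 → ⪯-from-ℚ (cycle n 3≤n) G λ x x≤0 pos → Z≤cycle x x≤0 pos 3≤n n≤7) ,
  (λ 9≤n H H∈ → ⪯-from-ℚ H G λ x x≤0 pos → Z≤𝒮P x x≤0 pos 9≤n H H∈)
  where
  h : ℕ
  h = n ℕ./ 2
  n≡ : n ≡ suc (h ℕ.+ h)
  n≡ = trans (m≡m%n+[m/n]*n n 2) (cong₂ ℕ._+_ odd (trans (ℕₚ.*-comm h 2) (cong (h ℕ.+_) (ℕₚ.+-identityʳ h))))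
  open OddOrder h n≡ G connected wc unicyclic
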